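{- For all integers $r\ge 3$ and $n\ge r+12$, \[ \log m(n,r) \le \frac{1}{n-r+1}\binom{n}{r}\log\bigl(\mathrm{e}(n-r+1)\bigr). \]
   Context: $m(n,r)$ denotes the number of matroids of rank $r$ on the ground set $[n]=\{1,\dots,n\}$. $\log$ is the logarithm to base $2$ and $\mathrm{e}$ is Euler's number. -}

module Defs where

open import Algebra.Bundles using (CommutativeRing)
open import Data.Fin using (Fin)
import Data.Fin.Properties as Fin
open import Data.Fin.Subset using (Subset; inside; outside; ⊥; ⁅_⁆; ∣_∣; _∪_; _-_; _∈_; _∉_)
import Data.Fin.Subset.Properties as Subset
open import Data.Bool.Properties using () renaming (_≟_ to _≟ᵇ_)
open import Data.Integer as ℤ using (ℤ; +_; -[1+_]; +[1+_])
import Data.Integer.Properties as ℤ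
open import Data.List using (List; []; _∷_; _++_; map; filter; length)
open import Data.List.Membership.Propositional using () renaming (_∈_ to _∈ₗ_)
open import Data.List.Membership.Propositional.Properties using (∈-++⁺ˡ; ∈-++⁺ʳ; ∈-map⁺; ∈-filter⁺; ∈-length)
open import Data.List.Relation.Unary.All as All using (All)
open import Data.List.Relation.Unary.Any using (here; there)
open import Data.Nat as ℕ using (ℕ; zero; suc; _!; z≤n; s≤s)
import Data.Nat.Properties as ℕ
open import Data.Product using (_×_; _,_; proj₁; proj₂; ∃)
open import Data.Rational as ℚ using (ℚ; 0ℚ; 1ℚ; ½; _/_; _*_; _<_; _≤_; Positive; ↥_; ↧_; ↧ₙ_; 1/_; *<*; *≤*)
import Data.Rational.Properties as ℚ
import Data.Rational.Unnormalised as ℚᵘ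
import Data.Rational.Unnormalised.Properties as ℚᵘP
open import Data.Vec using ([]; _∷_)
import Data.Vec.Properties as Vec
open import Function using (_∘_; case_of_)
open import Relation.Binary.PropositionalEquality using (_≡_; refl; sym; trans; cong; cong₂; subst; subst₂; module ≡-Reasoning)
open import Relation.Nullary using (¬_; Dec; yes; no; contradiction; _×-dec_; ¬?)
open import Relation.Nullary.Decidable using (map′; _→-dec_)
open import Relation.Unary using (Decidable)
import Data.List.Membership.DecPropositional as DecMembership

open import Algebra.Definitions.RawSemiring ℚ.+-*-rawSemiring using (_^_) public

private
  commSemiring = CommutativeRing.commutativeSemiring ℚ.+-*-commutativeRing
  open import Algebra.Properties.CommutativeSemiring.Exp commSemiring using (^-distrib-*)
  open import Algebra.Properties.Semiring.Exp (CommutativeRing.semiring ℚ.+-*-commutativeRing)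
    using (^-assocʳ)

subsets : ∀ n → List (Subset n)
subsets zero    = [] ∷ []
subsets (suc n) = map (outside ∷_) (subsets n) ++ map (inside ∷_) (subsets n)

sublists : {A : Set} → List A → List (List A)
sublists []       = [] ∷ []
sublists (x ∷ xs) = sublists xs ++ map (x ∷_) (sublists xs)

-- The matroids with ground set [n], given by their sets of bases. Only the
-- membership relation of the list 𝓑 matters here.
record IsMatroid {n} (𝓑 : List (Subset n)) : Set where
  field
    nonempty : ∃ λ B → B ∈ₗ 𝓑
    exchange : ∀ {A B} → A ∈ₗ 𝓑 → B ∈ₗ 𝓑 → ∀ {x} → x ∈ A → x ∉ B →
               ∃ λ y → y ∈ B × y ∉ A × ((A - x) ∪ ⁅ y ⁆) ∈ₗ 𝓑

-- All bases of a matroid are equicardinal, their cardinality being the rank.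
HasRank : ∀ {n} → ℕ → List (Subset n) → Set
HasRank r 𝓑 = ∀ {B} → B ∈ₗ 𝓑 → ∣ B ∣ ≡ r

isMatroid? : ∀ {n} → Decidable (IsMatroid {n})
isMatroid? {n} 𝓑 = map′
  (λ (ne , ex) → record
    { nonempty = ne
    ; exchange = λ A∈ B∈ {x} → All.lookup (All.lookup ex A∈) B∈ x })
  (λ M → let open IsMatroid M in
    nonempty , All.tabulate λ A∈ → All.tabulate λ B∈ x → exchange A∈ B∈ {x})
  (nonempty? 𝓑 ×-dec
   All.all? (λ A → All.all? (λ B → Fin.all? λ x →
     (x Subset.∈? A) →-dec (¬? (x Subset.∈? B) →-dec
     Fin.any? λ y → (y Subset.∈? B) ×-dec (¬? (y Subset.∈? A) ×-dec
       (((A - x) ∪ ⁅ y ⁆) ∈ₗ? 𝓑)))) 𝓑) 𝓑)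
  where
  open DecMembership (Vec.≡-dec {n = n} _≟ᵇ_) using () renaming (_∈?_ to _∈ₗ?_)
  nonempty? : ∀ (𝓐 : List (Subset n)) → Dec (∃ λ B → B ∈ₗ 𝓐)
  nonempty? []      = no λ ()
  nonempty? (B ∷ _) = yes (B , here refl)

hasRank? : ∀ {n} r → Decidable (HasRank {n} r)
hasRank? r 𝓑 = map′ (λ h → All.lookup h) (λ h → All.tabulate h) (All.all? (λ B → ∣ B ∣ ℕ.≟ r) 𝓑)

-- Every subset of [n] occurs exactly once in `subsets n`, so every family of
-- subsets is the set of members of exactly one list in `sublists (subsets n)`.
m : ℕ → ℕ → ℕ
m n r = length (filter (λ 𝓑 → isMatroid? 𝓑 ×-dec hasRank? r 𝓑) (sublists (subsets n)))

∈-subsets : ∀ {n} (A : Subset n) → A ∈ₗ subsets n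
∈-subsets []            = here refl
∈-subsets (outside ∷ A) = ∈-++⁺ˡ (∈-map⁺ _ (∈-subsets A))
∈-subsets {suc n} (inside ∷ A) = ∈-++⁺ʳ (map (outside ∷_) (subsets n)) (∈-map⁺ _ (∈-subsets A))

[]∈sublists : {A : Set} (xs : List A) → [] ∈ₗ sublists xs
[]∈sublists []       = here refl
[]∈sublists (_ ∷ xs) = ∈-++⁺ˡ ([]∈sublists xs)

[x]∈sublists : {A : Set} {x : A} {xs : List A} → x ∈ₗ xs → (x ∷ []) ∈ₗ sublists xs
[x]∈sublists {xs = _ ∷ xs} (here refl) = ∈-++⁺ʳ (sublists xs) (∈-map⁺ _ ([]∈sublists xs))
[x]∈sublists (there x∈) = ∈-++⁺ˡ ([x]∈sublists x∈)

subset-of-size : ∀ {r n} → r ℕ.≤ n → ∃ λ (A : Subset n) → ∣ A ∣ ≡ r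
subset-of-size {n = n} z≤n = ⊥ , Subset.∣⊥∣≡0 n
subset-of-size (s≤s r≤n) with A , ∣A∣ ← subset-of-size r≤n = inside ∷ A , cong suc ∣A∣

m-positive : ∀ {n r} → r ℕ.≤ n → 0 ℕ.< m n r
m-positive {n} {r} r≤n with A , ∣A∣≡r ← subset-of-size r≤n =
  ∈-length (∈-filter⁺ (λ 𝓑 → isMatroid? 𝓑 ×-dec hasRank? r 𝓑)
    ([x]∈sublists (∈-subsets A)) (single-basis , λ { (here refl) → ∣A∣≡r }))
  where
  single-basis : ∀ {A} → IsMatroid (A ∷ [])
  single-basis = record
    { nonempty = _ , here refl
    ; exchange = λ { (here refl) (here refl) x∈A x∉A → contradiction x∈A x∉A } }

-- A real number x is the Dedekind cut { q | q < x }; hence x ≤ y is inclusion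
-- of cuts, and 0 < x is membership of 0.
record ℝ : Set₁ where
  field
    cut       : ℚ → Set
    inhabited : ∃ λ q → cut q
    bounded   : ∃ λ q → ¬ cut q
    downward  : ∀ {p q} → p < q → cut q → cut p
    rounded   : ∀ {p} → cut p → ∃ λ q → p < q × cut q

open ℝ public

infix 4 _≤ℝ_
_≤ℝ_ : ℝ → ℝ → Set
x ≤ℝ y = ∀ q → cut x q → cut y q

0<_ : ℝ → Set
0< x = cut x 0ℚ

ℕ⇒ℚ : ℕ → ℚ
ℕ⇒ℚ k = + k / 1

↥↧-/ : ∀ i d .{{_ : ℕ.NonZero d}} → ↥ (i / d) ℤ.* + d ≡ i ℤ.* ↧ (i / d)
↥↧-/ i (suc d) with ℚ.toℚᵘ-fromℚᵘ (ℚᵘ.mkℚᵘ i d)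
... | ℚᵘ.*≡* eq = trans (cong (ℤ._* + suc d) (sym (ℚ.↥ᵘ-toℚᵘ (i / suc d))))
                    (trans eq (cong (i ℤ.*_) (ℚ.↧ᵘ-toℚᵘ (i / suc d))))

-- Comparison of fractions that need not be in lowest terms.
/-mono-< : ∀ i c j d .{{_ : ℕ.NonZero c}} .{{_ : ℕ.NonZero d}} →
           i ℤ.* + d ℤ.< j ℤ.* + c → i / c < j / d
/-mono-< i (suc c) j (suc d) lt = ℚ.toℚᵘ-cancel-<
  (ℚᵘP.<-respˡ-≃ (ℚᵘP.≃-sym (ℚ.toℚᵘ-fromℚᵘ (ℚᵘ.mkℚᵘ i c)))
  (ℚᵘP.<-respʳ-≃ (ℚᵘP.≃-sym (ℚ.toℚᵘ-fromℚᵘ (ℚᵘ.mkℚᵘ j d))) (ℚᵘ.*<* lt)))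

/-mono-≤ : ∀ i c j d .{{_ : ℕ.NonZero c}} .{{_ : ℕ.NonZero d}} →
           i ℤ.* + d ℤ.≤ j ℤ.* + c → i / c ≤ j / d
/-mono-≤ i (suc c) j (suc d) le = ℚ.toℚᵘ-cancel-≤
  (ℚᵘP.≤-respˡ-≃ (ℚᵘP.≃-sym (ℚ.toℚᵘ-fromℚᵘ (ℚᵘ.mkℚᵘ i c)))
  (ℚᵘP.≤-respʳ-≃ (ℚᵘP.≃-sym (ℚ.toℚᵘ-fromℚᵘ (ℚᵘ.mkℚᵘ j d))) (ℚᵘ.*≤* le)))

ℕ⇒ℚ-suc : ∀ k → ℕ⇒ℚ (suc k) ≡ 1ℚ ℚ.+ ℕ⇒ℚ k
ℕ⇒ℚ-suc k = ℚ.toℚᵘ-injective (ℚᵘP.≃-trans (ℚ.toℚᵘ-fromℚᵘ (ℚᵘ.mkℚᵘ (+ suc k) 0))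
  (ℚᵘP.≃-sym (ℚᵘP.≃-trans (ℚ.toℚᵘ-homo-+ 1ℚ (ℕ⇒ℚ k))
    (ℚᵘP.≃-trans (ℚᵘP.+-congʳ ℚᵘ.1ℚᵘ (ℚ.toℚᵘ-fromℚᵘ (ℚᵘ.mkℚᵘ (+ k) 0)))
      (ℚᵘ.*≡* (cong (λ i → (+ 1 ℤ.+ i) ℤ.* + 1) (ℤ.*-identityʳ (+ k))))))))

/-* : ∀ i c j d .{{_ : ℕ.NonZero c}} .{{_ : ℕ.NonZero d}} .{{_ : ℕ.NonZero (c ℕ.* d)}} →
      (i / c) * (j / d) ≡ (i ℤ.* j) / (c ℕ.* d)
/-* i (suc c) j (suc d) = ℚ.toℚᵘ-injective (ℚᵘP.≃-trans
  (ℚ.toℚᵘ-homo-* (i / suc c) (j / suc d))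
  (ℚᵘP.≃-trans (ℚᵘP.*-cong (ℚ.toℚᵘ-fromℚᵘ (ℚᵘ.mkℚᵘ i c)) (ℚ.toℚᵘ-fromℚᵘ (ℚᵘ.mkℚᵘ j d)))
    (ℚᵘP.≃-sym (ℚ.toℚᵘ-fromℚᵘ (ℚᵘ.mkℚᵘ i c ℚᵘ.* ℚᵘ.mkℚᵘ j d)))))

_*≤_ : ∀ {p q p′ q′} → 0ℚ ≤ p × p ≤ p′ → 0ℚ ≤ q × q ≤ q′ → p * q ≤ p′ * q′
_*≤_ {p} {q} {p′} {q′} (0≤p , p≤p′) (0≤q , q≤q′) = ℚ.≤-trans
  (ℚ.*-monoˡ-≤-nonNeg p {{ℚ.nonNegative 0≤p}} q≤q′)
  (ℚ.*-monoʳ-≤-nonNeg q′ {{ℚ.nonNegative (ℚ.≤-trans 0≤q q≤q′)}} p≤p′)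

^-positive : ∀ {y} k → 0ℚ < y → 0ℚ < y ^ k
^-positive zero    _   = ℚ.positive⁻¹ 1ℚ
^-positive {y} (suc k) 0<y = subst (_< y * y ^ k) (ℚ.*-zeroʳ y)
  (ℚ.*-monoʳ-<-pos y {{ℚ.positive 0<y}} (^-positive k 0<y))

^-mono-≤ : ∀ {x y} k → 0ℚ < x → x ≤ y → x ^ k ≤ y ^ k
^-mono-≤ zero    _   _   = ℚ.≤-refl
^-mono-≤ (suc k) 0<x x≤y =
  (ℚ.<⇒≤ 0<x , x≤y) *≤ (ℚ.<⇒≤ (^-positive k 0<x) , ^-mono-≤ k 0<x x≤y)

^-cancel-< : ∀ {x y} k → 0ℚ < y → x ^ k < y ^ k → x < y
^-cancel-< k 0<y lt = ℚ.≰⇒> λ y≤x →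
  ℚ.<-irrefl refl (ℚ.<-≤-trans lt (^-mono-≤ k 0<y y≤x))

^-mono-< : ∀ {x y} k .{{_ : ℕ.NonZero k}} → 0ℚ < x → x < y → x ^ k < y ^ k
^-mono-< {x} {y} (suc k) 0<x x<y = ℚ.≤-<-trans
  (ℚ.*-monoˡ-≤-nonNeg x {{ℚ.nonNegative (ℚ.<⇒≤ 0<x)}} (^-mono-≤ k 0<x (ℚ.<⇒≤ x<y)))
  (ℚ.*-monoˡ-<-pos (y ^ k) {{ℚ.positive (^-positive k (ℚ.<-trans 0<x x<y))}} x<y)

2^_ : ℤ → ℚ
2^ (+ k)    = (+ 2 / 1) ^ k
2^ -[1+ k ] = ½ ^ suc k

2^-positive : ∀ i → 0ℚ < 2^ i
2^-positive (+ k)    = ^-positive k (ℚ.positive⁻¹ (+ 2 / 1))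
2^-positive -[1+ k ] = ^-positive (suc k) (ℚ.positive⁻¹ ½)

2^-suc : ∀ i → 2^ (ℤ.suc i) ≡ (+ 2 / 1) * 2^ i
2^-suc (+ k)         = refl
2^-suc -[1+ zero ]   = refl
2^-suc -[1+ suc k ]  = sym (trans (sym (ℚ.*-assoc (+ 2 / 1) ½ (½ ^ suc k))) (ℚ.*-identityˡ (½ ^ suc k)))

2^-≤-suc : ∀ i → 2^ i ≤ 2^ (ℤ.suc i)
2^-≤-suc i = subst₂ _≤_ (ℚ.*-identityˡ _) (sym (2^-suc i))
  (ℚ.*-monoʳ-≤-nonNeg (2^ i) {{ℚ.nonNegative (ℚ.<⇒≤ (2^-positive i))}}
    (ℚ.<⇒≤ (*<* {1ℚ} {+ 2 / 1} (ℤ.+<+ (s≤s (s≤s z≤n))))))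

2^-mono-≤ : ∀ {i j} → i ℤ.≤ j → 2^ i ≤ 2^ j
2^-mono-≤ {i} {j} i≤j = subst (λ l → 2^ i ≤ 2^ l) eq (go ℤ.∣ j ℤ.- i ∣)
  where
  go : ∀ k → 2^ i ≤ 2^ (+ k ℤ.+ i)
  go zero    = ℚ.≤-reflexive (cong 2^_ (sym (ℤ.+-identityˡ i)))
  go (suc k) = ℚ.≤-trans (go k) (subst (λ l → 2^ (+ k ℤ.+ i) ≤ 2^ l)
    (sym (ℤ.+-assoc (+ 1) (+ k) i)) (2^-≤-suc (+ k ℤ.+ i)))
  eq : + ℤ.∣ j ℤ.- i ∣ ℤ.+ i ≡ j
  eq = trans (cong (ℤ._+ i) (ℤ.0≤i⇒+∣i∣≡i (ℤ.i≤j⇒0≤j-i i≤j)))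
      (trans (ℤ.+-assoc j (ℤ.- i) i)
      (trans (cong (λ l → j ℤ.+ l) (ℤ.+-inverseˡ i)) (ℤ.+-identityʳ j)))

2^- : ∀ k → 2^ (ℤ.- (+ k)) ≡ ½ ^ k
2^- zero    = refl
2^- (suc k) = refl

2^-* : ∀ i k → 2^ (i ℤ.* + k) ≡ (2^ i) ^ k
2^-* (+ j)    k = trans (cong 2^_ (sym (ℤ.pos-* j k))) (sym (^-assocʳ (+ 2 / 1) j k))
2^-* -[1+ j ] k = trans (cong 2^_ (trans (sym (ℤ.neg-distribˡ-* (+ suc j) (+ k)))
                                         (cong (λ l → ℤ.- l) (sym (ℤ.pos-* (suc j) k)))))
                 (trans (2^- (suc j ℕ.* k)) (sym (^-assocʳ ½ (suc j) k)))

-- The truth of 2^(c/d) < y, stated as 2^c < y^d, does not depend on the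
-- representation of the exponent and is inherited by smaller exponents.
exponent-mono : ∀ {y} a b c d .{{_ : ℕ.NonZero b}} → 0ℚ < y → a ℤ.* + d ℤ.≤ c ℤ.* + b →
                2^ c < y ^ d → 2^ a < y ^ b
exponent-mono {y} a b c d 0<y ad≤cb lt = ^-cancel-< d (^-positive b 0<y) (begin-strict
  (2^ a) ^ d       ≡⟨ 2^-* a d ⟨
  2^ (a ℤ.* + d)   ≤⟨ 2^-mono-≤ ad≤cb ⟩
  2^ (c ℤ.* + b)   ≡⟨ 2^-* c b ⟩
  (2^ c) ^ b       <⟨ ^-mono-< b (2^-positive c) lt ⟩
  (y ^ d) ^ b      ≡⟨ ^-assocʳ y d b ⟩
  y ^ (d ℕ.* b)    ≡⟨ cong (y ^_) (ℕ.*-comm d b) ⟩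
  y ^ (b ℕ.* d)    ≡⟨ ^-assocʳ y b d ⟨
  (y ^ b) ^ d      ∎)
  where open ℚ.≤-Reasoning

archimedean : ∀ q → ∃ λ k → q < ℕ⇒ℚ (suc k)
archimedean q@(ℚ.mkℚ i d _) = ℤ.∣ i ∣ , subst (_< ℕ⇒ℚ (suc ℤ.∣ i ∣)) (ℚ.↥p/↧p≡p q)
  (/-mono-< i (suc d) (+ suc ℤ.∣ i ∣) 1 (begin-strict
    i ℤ.* + 1                  ≡⟨ ℤ.*-identityʳ i ⟩
    i                          ≤⟨ i≤∣i∣ i ⟩
    + ℤ.∣ i ∣                  <⟨ ℤ.+<+ ℕ.≤-refl ⟩
    + suc ℤ.∣ i ∣              ≤⟨ ℤ.+≤+ (ℕ.m≤m*n (suc ℤ.∣ i ∣) (suc d)) ⟩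
    + (suc ℤ.∣ i ∣ ℕ.* suc d)  ≡⟨ ℤ.pos-* (suc ℤ.∣ i ∣) (suc d) ⟩
    + suc ℤ.∣ i ∣ ℤ.* + suc d  ∎))
  where
  open ℤ.≤-Reasoning
  i≤∣i∣ : ∀ i → i ℤ.≤ + ℤ.∣ i ∣
  i≤∣i∣ (+ _)    = ℤ.≤-refl
  i≤∣i∣ -[1+ _ ] = ℤ.-≤+

bernoulli : ∀ {δ} k → 0ℚ < δ → ℕ⇒ℚ k * δ < (1ℚ ℚ.+ δ) ^ k
bernoulli {δ} zero    0<δ = subst (_< 1ℚ) (sym (ℚ.*-zeroˡ δ)) (ℚ.positive⁻¹ 1ℚ)
bernoulli {δ} (suc k) 0<δ = begin-strict
  ℕ⇒ℚ (suc k) * δ                ≡⟨ cong (_* δ) (ℕ⇒ℚ-suc k) ⟩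
  (1ℚ ℚ.+ ℕ⇒ℚ k) * δ             ≡⟨ ℚ.*-distribʳ-+ δ 1ℚ (ℕ⇒ℚ k) ⟩
  1ℚ * δ ℚ.+ ℕ⇒ℚ k * δ           ≡⟨ ℚ.+-comm (1ℚ * δ) _ ⟩
  ℕ⇒ℚ k * δ ℚ.+ 1ℚ * δ           <⟨ ℚ.+-mono-<-≤ (bernoulli k 0<δ) (ℚ.*-monoʳ-≤-nonNeg δ {{ℚ.nonNegative (ℚ.<⇒≤ 0<δ)}} (1≤ k)) ⟩
  P ℚ.+ P * δ                    ≡⟨ cong (ℚ._+ P * δ) (ℚ.*-identityʳ P) ⟨
  P * 1ℚ ℚ.+ P * δ               ≡⟨ ℚ.*-distribˡ-+ P 1ℚ δ ⟨
  P * (1ℚ ℚ.+ δ)                 ≡⟨ ℚ.*-comm P _ ⟩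
  (1ℚ ℚ.+ δ) * P                 ∎
  where
  open ℚ.≤-Reasoning
  P = (1ℚ ℚ.+ δ) ^ k
  1^ : ∀ k → 1ℚ ^ k ≡ 1ℚ
  1^ zero    = refl
  1^ (suc k) = trans (ℚ.*-identityˡ _) (1^ k)
  1≤ : ∀ k → 1ℚ ≤ (1ℚ ℚ.+ δ) ^ k
  1≤ k = subst (_≤ (1ℚ ℚ.+ δ) ^ k) (1^ k) (^-mono-≤ k (ℚ.positive⁻¹ 1ℚ)
    (subst (_≤ 1ℚ ℚ.+ δ) (ℚ.+-identityʳ 1ℚ) (ℚ.+-monoʳ-≤ 1ℚ (ℚ.<⇒≤ 0<δ))))

fromℕ : ℕ → ℝ
fromℕ k = record
  { cut       = λ q → q < + k / 1
  ; inhabited = ℚ.- 1ℚ , ℚ.<-≤-trans (ℚ.negative⁻¹ (ℚ.- 1ℚ)) (ℚ.nonNegative⁻¹ _ {{ℚ.normalize-nonNeg k 1}})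
  ; bounded   = + k / 1 , ℚ.<-irrefl refl
  ; downward  = ℚ.<-trans
  ; rounded   = ℚ.<-dense
  }

fromℕ-positive : ∀ {k} → 0 ℕ.< k → 0< fromℕ k
fromℕ-positive {suc k} _ = ℚ.positive⁻¹ _ {{ℚ.normalize-pos (suc k) 1}}

infixl 7 _÷ℚ_
_÷ℚ_ : ℝ → (c : ℚ) .{{_ : Positive c}} → ℝ
x ÷ℚ c = record
  { cut       = λ q → cut x (c * q)
  ; inhabited = let p , p∈x = inhabited x in c⁻¹ * p , subst (cut x) (sym (c*c⁻¹* p)) p∈x
  ; bounded   = let p , p∉x = bounded x in c⁻¹ * p , p∉x ∘ subst (cut x) (c*c⁻¹* p)
  ; downward  = λ p<q → downward x (ℚ.*-monoʳ-<-pos c p<q)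
  ; rounded   = λ {p} cp∈x → let q , cp<q , q∈x = rounded x cp∈x in
      c⁻¹ * q ,
      ℚ.*-cancelˡ-<-nonNeg c {{ℚ.pos⇒nonNeg c}} (subst (c * p <_) (sym (c*c⁻¹* q)) cp<q) ,
      subst (cut x) (sym (c*c⁻¹* q)) q∈x
  }
  where
  instance
    c≢0 : ℚ.NonZero c
    c≢0 = ℚ.pos⇒nonZero c
  c⁻¹ = 1/ c
  c*c⁻¹* : ∀ p → c * (c⁻¹ * p) ≡ p
  c*c⁻¹* p = trans (sym (ℚ.*-assoc c c⁻¹ p)) (trans (cong (_* p) (ℚ.*-inverseʳ c)) (ℚ.*-identityˡ p))

÷ℚ-positive : ∀ {x c} .{{_ : Positive c}} → 0< x → 0< (x ÷ℚ c)
÷ℚ-positive {x} {c} = subst (cut x) (sym (ℚ.*-zeroʳ c))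

infixl 7 _÷_
_÷_ : ℝ → (d : ℕ) .{{_ : ℕ.NonZero d}} → ℝ
x ÷ d = (x ÷ℚ (+ d / 1)) {{ℚ.normalize-pos d 1}}

-- Multiplication by k > 0 is division by the rational 1/k.
infixl 8 _·_
_·_ : ℕ → ℝ → ℝ
zero  · x = fromℕ 0
suc k · x = (x ÷ℚ (+ 1 / suc k)) {{ℚ.normalize-pos 1 (suc k)}}

·-positive : ∀ k .{{_ : ℕ.NonZero k}} {x} → 0< x → 0< (k · x)
·-positive (suc k) {x} = ÷ℚ-positive {x} {+ 1 / suc k} {{ℚ.normalize-pos 1 (suc k)}}

-- q < log₂ x iff 2^q < x iff 2^q < y for some rational 0 < y < x; with q = a/b
-- this last inequality is 2^a < y^b.
log₂ : (x : ℝ) → 0< x → ℝ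
log₂ x 0∈x = record
  { cut       = λ q → ∃ λ y → cut x y × 0ℚ < y × 2^ (↥ q) < y ^ ↧ₙ q
  ; inhabited = inhabited′
  ; bounded   = bounded′
  ; downward  = λ { {p@record{}} {q@record{}} (*<* lt) (y , y∈x , 0<y , 2^q<y) →
      y , y∈x , 0<y , exponent-mono (↥ p) (↧ₙ p) (↥ q) (↧ₙ q) 0<y (ℤ.<⇒≤ lt) 2^q<y }
  ; rounded   = λ { {p} (y , y∈x , 0<y , 2^p<y) →
      let q , p<q , 2^q<y = increase p 0<y 2^p<y in q , p<q , y , y∈x , 0<y , 2^q<y }
  }
  where
  Cut : ℚ → Set
  Cut q = ∃ λ y → cut x y × 0ℚ < y × 2^ (↥ q) < y ^ ↧ₙ q

  k<2^k : ∀ k → ℕ⇒ℚ k < (+ 2 / 1) ^ k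
  k<2^k k = subst (_< (+ 2 / 1) ^ k) (ℚ.*-identityʳ (ℕ⇒ℚ k)) (bernoulli k (ℚ.positive⁻¹ 1ℚ))

  inhabited′ : ∃ Cut
  inhabited′ = q , y , y∈x , 0<y ,
    exponent-mono (↥ q) (↧ₙ q) (ℤ.- (+ k)) 1 0<y (ℤ.≤-reflexive (↥↧-/ (ℤ.- (+ k)) 1))
      (subst₂ _<_ (sym (2^- k)) (sym (ℚ.*-identityʳ y)) ½^k<y)
    where
    y   = proj₁ (rounded x 0∈x)
    0<y = proj₁ (proj₂ (rounded x 0∈x))
    y∈x = proj₂ (proj₂ (rounded x 0∈x))
    instance
      y-pos : Positive y
      y-pos = ℚ.positive 0<y
      y≢0 : ℚ.NonZero y
      y≢0 = ℚ.pos⇒nonZero y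
    k = suc (proj₁ (archimedean (1/ y)))
    q = (ℤ.- (+ k)) / 1
    H = ½ ^ k
    T = (+ 2 / 1) ^ k
    1^ : ∀ k → 1ℚ ^ k ≡ 1ℚ
    1^ zero    = refl
    1^ (suc k) = trans (ℚ.*-identityˡ (1ℚ ^ k)) (1^ k)
    HT≡1 : H * T ≡ 1ℚ
    HT≡1 = trans (sym (^-distrib-* ½ (+ 2 / 1) k)) (1^ k)
    open ℚ.≤-Reasoning
    ½^k<y : H < y
    ½^k<y = begin-strict
      H               ≡⟨ ℚ.*-identityʳ H ⟨
      H * 1ℚ          ≡⟨ cong (H *_) (ℚ.*-inverseˡ y) ⟨
      H * (1/ y * y)  <⟨ ℚ.*-monoʳ-<-pos H {{ℚ.positive (^-positive k (ℚ.positive⁻¹ ½))}}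
                          (ℚ.*-monoˡ-<-pos y (ℚ.<-trans (proj₂ (archimedean (1/ y))) (k<2^k k))) ⟩
      H * (T * y)     ≡⟨ ℚ.*-assoc H T y ⟨
      H * T * y       ≡⟨ cong (_* y) HT≡1 ⟩
      1ℚ * y          ≡⟨ ℚ.*-identityˡ y ⟩
      y               ∎

  bounded′ : ∃ λ q → ¬ Cut q
  bounded′ with B , B∉x ← bounded x with k′ , B<k ← archimedean B = q , λ (y , y∈x , 0<y , 2^q<y) →
    let 2^k<y = subst ((+ 2 / 1) ^ k <_) (ℚ.*-identityʳ y)
                  (exponent-mono (+ k) 1 (↥ q) (↧ₙ q) 0<y (ℤ.≤-reflexive (sym (↥↧-/ (+ k) 1))) 2^q<y)
    in B∉x (downward x (ℚ.<-trans B<k (ℚ.<-trans (k<2^k k) 2^k<y)) y∈x)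
    where
    k = suc k′
    q = + k / 1

  increase : ∀ p {y} → 0ℚ < y → 2^ (↥ p) < y ^ ↧ₙ p → ∃ λ q → p < q × 2^ (↥ q) < y ^ ↧ₙ q
  increase p@record{} {y} 0<y 2^p<y = q ,
    subst (_< q) (ℚ.↥p/↧p≡p p) (/-mono-< a b (ℤ.suc (a ℤ.* + k)) (b ℕ.* k) a/b<q) ,
    exponent-mono (↥ q) (↧ₙ q) (ℤ.suc (a ℤ.* + k)) (b ℕ.* k) 0<y
      (ℤ.≤-reflexive (↥↧-/ (ℤ.suc (a ℤ.* + k)) (b ℕ.* k))) 2^q<y
    where
    a = ↥ p
    b = ↧ₙ p
    P = 2^ a
    instance
      P-pos : Positive P
      P-pos = ℚ.positive (2^-positive a)
      P≢0 : ℚ.NonZero P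
      P≢0 = ℚ.pos⇒nonZero P
      1/P-pos : Positive (1/ P)
      1/P-pos = ℚ.1/pos⇒pos P
    ρ = 1/ P * y ^ b
    δ = ρ ℚ.- 1ℚ
    1+δ≡ρ : 1ℚ ℚ.+ δ ≡ ρ
    1+δ≡ρ = trans (ℚ.+-comm 1ℚ δ) (trans (ℚ.+-assoc ρ (ℚ.- 1ℚ) 1ℚ)
              (trans (cong (ρ ℚ.+_) (ℚ.+-inverseˡ 1ℚ)) (ℚ.+-identityʳ ρ)))
    1<ρ : 1ℚ < ρ
    1<ρ = subst (_< ρ) (ℚ.*-inverseˡ P) (ℚ.*-monoʳ-<-pos (1/ P) 2^p<y)
    0<δ : 0ℚ < δ
    0<δ = subst (_< δ) (ℚ.+-inverseʳ 1ℚ) (ℚ.+-monoˡ-< (ℚ.- 1ℚ) 1<ρ)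
    instance
      δ-pos : Positive δ
      δ-pos = ℚ.positive 0<δ
      δ≢0 : ℚ.NonZero δ
      δ≢0 = ℚ.pos⇒nonZero δ
    large = archimedean ((+ 2 / 1) * 1/ δ)
    k = suc (proj₁ large)
    q = ℤ.suc (a ℤ.* + k) / (b ℕ.* k)
    a/b<q : a ℤ.* + (b ℕ.* k) ℤ.< ℤ.suc (a ℤ.* + k) ℤ.* + b
    a/b<q = subst (ℤ._< ℤ.suc (a ℤ.* + k) ℤ.* + b) eq
              (ℤ.*-monoʳ-<-pos (+ b) {a ℤ.* + k} (ℤ.suc[i]≤j⇒i<j ℤ.≤-refl))
      where
      eq : a ℤ.* + k ℤ.* + b ≡ a ℤ.* + (b ℕ.* k)
      eq = trans (ℤ.*-assoc a (+ k) (+ b))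
             (cong (a ℤ.*_) (trans (ℤ.*-comm (+ k) (+ b)) (sym (ℤ.pos-* b k))))
    open ℚ.≤-Reasoning
    2<ρ^k : + 2 / 1 < ρ ^ k
    2<ρ^k = begin-strict
      + 2 / 1                    ≡⟨ ℚ.*-identityʳ (+ 2 / 1) ⟨
      (+ 2 / 1) * 1ℚ             ≡⟨ cong ((+ 2 / 1) *_) (ℚ.*-inverseˡ δ) ⟨
      (+ 2 / 1) * (1/ δ * δ)     ≡⟨ ℚ.*-assoc (+ 2 / 1) (1/ δ) δ ⟨
      (+ 2 / 1) * 1/ δ * δ       <⟨ ℚ.*-monoˡ-<-pos δ (proj₂ large) ⟩
      ℕ⇒ℚ k * δ                  <⟨ bernoulli k 0<δ ⟩
      (1ℚ ℚ.+ δ) ^ k             ≡⟨ cong (_^ k) 1+δ≡ρ ⟩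
      ρ ^ k                      ∎
    2^q<y : 2^ (ℤ.suc (a ℤ.* + k)) < y ^ (b ℕ.* k)
    2^q<y = begin-strict
      2^ (ℤ.suc (a ℤ.* + k))     ≡⟨ 2^-suc (a ℤ.* + k) ⟩
      (+ 2 / 1) * 2^ (a ℤ.* + k) ≡⟨ cong ((+ 2 / 1) *_) (2^-* a k) ⟩
      (+ 2 / 1) * P ^ k          <⟨ ℚ.*-monoˡ-<-pos (P ^ k) {{ℚ.positive (^-positive k (2^-positive a))}} 2<ρ^k ⟩
      ρ ^ k * P ^ k              ≡⟨ ^-distrib-* ρ P k ⟨
      (ρ * P) ^ k                ≡⟨ cong (_^ k) ρP≡y^b ⟩
      (y ^ b) ^ k                ≡⟨ ^-assocʳ y b k ⟩
      y ^ (b ℕ.* k)              ∎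
      where
      ρP≡y^b : ρ * P ≡ y ^ b
      ρP≡y^b = trans (ℚ.*-comm ρ P) (trans (sym (ℚ.*-assoc P (1/ P) (y ^ b)))
                 (trans (cong (_* y ^ b) (ℚ.*-inverseʳ P)) (ℚ.*-identityˡ (y ^ b))))

invFact : ℕ → ℚ
invFact j = (+ 1 / (j !)) {{j ℕ.!≢0}}

∑1/j! : ℕ → ℚ
∑1/j! zero    = invFact 0
∑1/j! (suc n) = ∑1/j! n ℚ.+ invFact (suc n)

1/!-halves : ∀ n → invFact (suc (suc n)) ℚ.+ invFact (suc (suc n)) ≤ invFact (suc n)
1/!-halves n = subst (_≤ invFact (suc n)) double le
  where
  instance
    c≢0 = suc (suc n) ℕ.!≢0
    d≢0 = suc n ℕ.!≢0
    c*1≢0 = ℕ.m*n≢0 (suc (suc n) !) 1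
  c = suc (suc n) !
  d = suc n !
  t = invFact (suc (suc n))
  double : t * (+ 2 / 1) ≡ t ℚ.+ t
  double = trans (ℚ.*-distribˡ-+ t 1ℚ 1ℚ) (cong₂ ℚ._+_ (ℚ.*-identityʳ t) (ℚ.*-identityʳ t))
  le : t * (+ 2 / 1) ≤ invFact (suc n)
  le = subst (_≤ invFact (suc n)) (sym (/-* (+ 1) c (+ 2) 1))
    (/-mono-≤ (+ 2) (c ℕ.* 1) (+ 1) d
      (subst₂ ℤ._≤_ (ℤ.pos-* 2 d) (ℤ.pos-* 1 (c ℕ.* 1))
        (ℤ.+≤+ (subst (2 ℕ.* d ℕ.≤_) (sym (trans (ℕ.*-identityˡ (c ℕ.* 1)) (ℕ.*-identityʳ c)))
          (ℕ.*-monoˡ-≤ d {2} {suc (suc n)} (s≤s (s≤s z≤n)))))))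

1/!-positive : ∀ n → 0ℚ < invFact n
1/!-positive n = ℚ.positive⁻¹ _ {{ℚ.normalize-pos 1 (n !) {{n ℕ.!≢0}}}}

∑-step : ∀ n → ∑1/j! n < ∑1/j! (suc n)
∑-step n = subst (_< ∑1/j! (suc n)) (ℚ.+-identityʳ (∑1/j! n)) (ℚ.+-monoʳ-< (∑1/j! n) (1/!-positive (suc n)))

∑+1/!≤3 : ∀ n → ∑1/j! (suc n) ℚ.+ invFact (suc n) ≤ + 3 / 1
∑+1/!≤3 zero    = ℚ.≤-refl
∑+1/!≤3 (suc n) = ℚ.≤-trans
  (ℚ.≤-trans (ℚ.≤-reflexive (ℚ.+-assoc (∑1/j! (suc n)) (invFact (suc (suc n))) (invFact (suc (suc n)))))
    (ℚ.+-monoʳ-≤ (∑1/j! (suc n)) (1/!-halves n)))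
  (∑+1/!≤3 n)

∑<3 : ∀ n → ∑1/j! n < + 3 / 1
∑<3 n = ℚ.<-trans (∑-step n) (ℚ.<-≤-trans
  (subst (_< ∑1/j! (suc n) ℚ.+ invFact (suc n)) (ℚ.+-identityʳ _)
    (ℚ.+-monoʳ-< (∑1/j! (suc n)) (1/!-positive (suc n)))) (∑+1/!≤3 n))

-- The supremum of the partial sums of ∑ 1/j!.
e : ℝ
e = record
  { cut       = λ q → ∃ λ n → q < ∑1/j! n
  ; inhabited = 0ℚ , 0 , ℚ.positive⁻¹ 1ℚ
  ; bounded   = + 3 / 1 , λ (n , 3<∑) → ℚ.<-asym 3<∑ (∑<3 n)
  ; downward  = λ p<q (n , q<∑) → n , ℚ.<-trans p<q q<∑
  ; rounded   = λ (n , p<∑) → let q , p<q , q<∑ = ℚ.<-dense p<∑ in q , p<q , n , q<∑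
  }

e-positive : 0< e
e-positive = 0 , ℚ.positive⁻¹ 1ℚ

{-# OPTIONS --safe #-}
module Submission where

-- By Shearer's lemma applied to the families of bases, which are determined by
-- their contractions by single elements, log m(n,r) / C(n,r) (with m increased
-- by 1, for the empty family) does not exceed its value at (n-1,r-1). As n-r+1
-- does not change, this reduces the theorem to r = 3 and N = n-r+3 ≥ 15 elements.
-- A simple matroid of rank 3 is determined by its triples {a₁,a₂,aᵢ}, i ≥ 3, for
-- all lines a₁ < a₂ < ⋯. There are at most C(N,2)/3 of them, since a line with k
-- elements has C(k,2) ≥ 3(k-2) pairs. So the number of simple matroids is at most
-- the sum of C(C(N,3),i) over i ≤ C(N,2)/3, which is below (e(N-2))^(C(N,2)/3) as
-- C(N,3) = (N-2) C(N,2)/3. A matroid that is not simple has a loop x, or parallel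
-- elements x and y, and is determined by x, y and the deletion of x; these
-- matroids are so few that they fit in the gap between (1+1/(N-2))^(N-2) and
-- (1+1/(N-1))^(N-1) < e.

open import Defs
open import Data.Nat using (ℕ; suc; _+_; _∸_; _≥_)
open import Data.Nat.Properties using (≤-trans; m≤m+n)
open import Data.Nat.Combinatorics using (_C_)

open import Algebra.Bundles using (CommutativeRing)
open import Data.Bool using (Bool; true; false; if_then_else_; not; _∧_)
open import Data.Bool.Properties using (T?; T-≡) renaming (_≟_ to _≟ᵇ_)
open import Data.Fin using (Fin; zero; suc; punchIn; punchOut) renaming (_<_ to _<ᶠ_)
import Data.Fin.Properties as Fin
open import Data.Fin.Subset using (Subset; inside; outside; ⊥; ⁅_⁆; ∣_∣; _∪_; _-_) renaming (_∈_ to _∈ˢ_; _∉_ to _∉ˢ_)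
import Data.Fin.Subset.Properties as Subset
open import Data.Integer as ℤ using (ℤ; +_)
import Data.Integer.Properties as ℤ
open import Data.Integer.Tactic.RingSolver using () renaming (solve-∀ to solveℤ-∀)
open import Data.List using (List; []; _∷_; length; map; filter; filterᵇ; _++_; allFin; cartesianProductWith; cartesianProduct)
import Data.List.Membership.DecPropositional as DecMembership
open import Data.List.Membership.Propositional using (_∈_; _∉_)
open import Data.List.Membership.Propositional.Properties
open import Data.List.Properties using (length-map; length-++; length-tabulate; ++-identityʳ)
open import Data.List.Relation.Binary.Permutation.Propositional using (_↭_; ↭-refl; ↭-sym; ↭-trans; ↭-reflexive; prep; swap)
open import Data.List.Relation.Binary.Permutation.Propositional.Properties using (shift; ∈-resp-↭; ↭-length) renaming (map⁺ to ↭-map⁺)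
open import Data.List.Relation.Binary.Subset.Propositional using (_⊆_)
open import Data.List.Relation.Unary.All as All using (All; []; _∷_)
import Data.List.Relation.Unary.All.Properties as All
open import Data.List.Relation.Unary.AllPairs as AllPairs using (AllPairs; []; _∷_)
import Data.List.Relation.Unary.AllPairs.Properties as AllPairs
open import Data.List.Relation.Unary.Any as Any using (Any; here; there)
import Data.List.Relation.Unary.Any.Properties as Any
open import Data.List.Relation.Unary.Unique.DecPropositional using (unique?)
open import Data.List.Relation.Unary.Unique.Propositional using (Unique)
import Data.List.Relation.Unary.Unique.Propositional.Properties as Unique
open import Data.Nat using (zero; _*_; _/_; _≤_; _<_; _!; z≤n; s≤s; NonZero; _≟_; _≤?_; ≢-nonZero; ≢-nonZero⁻¹; >-nonZero; _≤′_; ≤′-reflexive; ≤′-step) renaming (_^_ to _↑_)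
open import Data.Nat.Combinatorics using (nC1≡n; nCn≡1; nCk≡nC[n∸k]; nCk+nC[k+1]≡[n+1]C[k+1])
open import Data.Nat.Divisibility using (divides)
open import Data.Nat.DivMod using (m*n/n≡m; m/n*n≤m; /-monoˡ-≤; +-distrib-/-∣ˡ)
open import Data.Nat.ListAction using (product)
open import Data.Nat.Properties
open import Data.Nat.Tactic.RingSolver using (solve-∀)
open import Data.Product using (_×_; _,_; proj₁; proj₂; ∃)
open import Data.Rational as ℚ using (ℚ; 0ℚ; ↥_; ↧_; ↧ₙ_)
import Data.Rational.Properties as ℚ
import Data.Rational.Unnormalised as ℚᵘ
import Data.Rational.Unnormalised.Properties as ℚᵘ
open import Data.Sum using (_⊎_; inj₁; inj₂)
open import Data.Vec as Vec using (Vec; []; _∷_; here; there)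
import Data.Vec.Properties as Vec
open import Function using (_∘_; id; Equivalence)
open import Relation.Binary.Definitions using (DecidableEquality; tri<; tri≈; tri>)
open import Relation.Binary.PropositionalEquality using (_≡_; _≢_; _≗_; refl; sym; trans; cong; cong₂; subst; subst₂; module ≡-Reasoning)
open import Relation.Nullary using (¬_; Dec; yes; no; contradiction; does; ¬?; _×-dec_; _⊎-dec_; _→-dec_)
open import Relation.Nullary.Decidable using (from-yes)
open import Relation.Unary using (Decidable)

open import Algebra.Properties.Semiring.Exp (CommutativeRing.semiring ℚ.+-*-commutativeRing) using (^-assocʳ)

-- The reduction stops at rank 3 because in rank 2 the inequality fails for large n: a matroid of
-- rank 2 is essentially a partition, and the number of partitions has logarithm about n log n,
-- against (n/2) log n. The constants come from a budget. With d = N-2 and s = N-1, passing from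
-- (1+1/d)^d to (1+1/s)^s gains a factor of at least 1+1/s³, and under the exponent C(N,2)/3 this
-- grows to more than 1+1/(6s). The matroids that are not simple are therefore kept within 1/(8s) of
-- the bound for the simple ones. No logarithm or root occurs before the end: membership in the cut
-- of a logarithm asks for one rational below its argument, here d(1+1/s)^s < ed, and the exponent
-- C(n,r)/d is kept as a fraction b/a, so that all counting bounds compare powers of natural
-- numbers. For the same reason Shearer's lemma is proved without entropy, by splitting families
-- along one coordinate and applying Hölder's inequality.

*-↑ : ∀ x y k → (x * y) ↑ k ≡ x ↑ k * y ↑ k
*-↑ x y zero    = refl
*-↑ x y (suc k) = trans (cong (x * y *_) (*-↑ x y k)) (regroup x y (x ↑ k) (y ↑ k))
  where
  regroup : ∀ x y p q → x * y * (p * q) ≡ x * p * (y * q)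
  regroup = solve-∀

↑-cancel-< : ∀ {x y} k → x ↑ k < y ↑ k → x < y
↑-cancel-< {x} {y} k lt = ≰⇒> λ y≤x → <⇒≱ lt (^-monoˡ-≤ k y≤x)

-- Superadditivity of the geometric mean

2xy≤x²+y² : ∀ x y → 2 * (x * y) ≤ x * x + y * y
2xy≤x²+y² x y with ≤-total x y
... | inj₁ x≤y with t , refl ← m≤n⇒∃[o]m+o≡n x≤y = subst (2 * (x * (x + t)) ≤_) (sym (eq x t)) (m≤m+n _ _)
  where
  eq : ∀ x t → x * x + (x + t) * (x + t) ≡ 2 * (x * (x + t)) + t * t
  eq = solve-∀
... | inj₂ y≤x with t , refl ← m≤n⇒∃[o]m+o≡n y≤x = subst (2 * ((y + t) * y) ≤_) (sym (eq y t)) (m≤m+n _ _)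
  where
  eq : ∀ y t → (y + t) * (y + t) + y * y ≡ 2 * ((y + t) * y) + t * t
  eq = solve-∀

-- AM-GM for y^(t+1) and t copies of u^(t+1). In the inductive step u^t · 2uy is split by 2uy ≤ u² +
-- y², and the part with y² is the inductive hypothesis times `y`; the term added on both sides is
-- what this leaves over.
young : ∀ t y u → suc t * (u ↑ t * y) ≤ y ↑ suc t + t * u ↑ suc t
young zero    y u = ≤-reflexive (eq y)
  where
  eq : ∀ y → 1 * (1 * y) ≡ y * 1 + 0
  eq = solve-∀
young (suc t) y u = +-cancelˡ-≤ (t * (u * P) * y) _ _ (begin
  t * (u * P) * y + suc (suc t) * (u * P * y)   ≡⟨ eq₁ t u P y ⟩
  suc t * (P * (2 * (u * y)))                   ≤⟨ *-monoʳ-≤ (suc t) (*-monoʳ-≤ P (2xy≤x²+y² u y)) ⟩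
  suc t * (P * (u * u + y * y))                 ≡⟨ eq₂ t u P y ⟩
  suc t * (P * y) * y + suc t * (u * (u * P))   ≤⟨ +-monoˡ-≤ _ (*-monoˡ-≤ y (young t y u)) ⟩
  (y * Q + t * (u * P)) * y + suc t * (u * (u * P))
                                                ≡⟨ eq₃ t u P y Q ⟩
  t * (u * P) * y + (y * (y * Q) + suc t * (u * (u * P))) ∎)
  where
  open ≤-Reasoning
  P = u ↑ t
  Q = y ↑ t
  eq₁ : ∀ t u P y → t * (u * P) * y + suc (suc t) * (u * P * y) ≡ suc t * (P * (2 * (u * y)))
  eq₁ = solve-∀
  eq₂ : ∀ t u P y → suc t * (P * (u * u + y * y)) ≡ suc t * (P * y) * y + suc t * (u * (u * P))
  eq₂ = solve-∀
  eq₃ : ∀ t u P y Q → (y * Q + t * (u * P)) * y + suc t * (u * (u * P)) ≡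
                      t * (u * P) * y + (y * (y * Q) + suc t * (u * (u * P)))
  eq₃ = solve-∀

-- AM-GM for `x` and t copies of s/t. It is `young` at y = t(s+x) and u = (t+1)s, where the multiple
-- of `s` contained in `y` cancels against t·u^(t+1).
amgm-step : ∀ t s x → suc t ↑ suc t * (s ↑ t * x) ≤ t ↑ t * (s + x) ↑ suc t
amgm-step zero    s x = ≤-trans (≤-reflexive (eq₁ x)) (≤-trans (m≤n+m x s) (≤-reflexive (eq₂ (s + x))))
  where
  eq₁ : ∀ x → 1 * 1 * (1 * x) ≡ x
  eq₁ = solve-∀
  eq₂ : ∀ x → x ≡ 1 * (x * 1)
  eq₂ = solve-∀
amgm-step t@(suc t′) s x = *-cancelˡ-≤ t (+-cancelʳ-≤ (t * (suc t ↑ suc t * (s * S))) _ _ (begin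
  t * (suc t ↑ suc t * (S * x)) + t * (suc t ↑ suc t * (s * S))
    ≡⟨ eq₁ t T s x S ⟩
  suc t * (T * S * (t * (s + x)))
    ≡⟨ cong (λ z → suc t * (z * (t * (s + x)))) (*-↑ (suc t) s t) ⟨
  suc t * ((suc t * s) ↑ t * (t * (s + x)))
    ≤⟨ young t (t * (s + x)) (suc t * s) ⟩
  (t * (s + x)) ↑ suc t + t * (suc t * s) ↑ suc t
    ≡⟨ cong₂ (λ y z → y + t * z) (*-↑ t (s + x) (suc t)) (*-↑ (suc t) s (suc t)) ⟩
  t ↑ suc t * (s + x) ↑ suc t + t * (suc t ↑ suc t * s ↑ suc t)
    ≡⟨ cong (_+ t * (suc t ↑ suc t * s ↑ suc t)) (*-assoc t (t ↑ t) _) ⟩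
  t * (t ↑ t * (s + x) ↑ suc t) + t * (suc t ↑ suc t * (s * S)) ∎))
  where
  open ≤-Reasoning
  S = s ↑ t
  T = suc t ↑ t
  eq₁ : ∀ t T s x S → t * (suc t * T * (S * x)) + t * (suc t * T * (s * S)) ≡ suc t * (T * S * (t * (s + x)))
  eq₁ = solve-∀

∏ : {I : Set} → (I → ℕ) → List I → ℕ
∏ f is = product (map f is)

∏-* : ∀ {I : Set} (f g : I → ℕ) is → ∏ (λ i → f i * g i) is ≡ ∏ f is * ∏ g is
∏-* f g []       = refl
∏-* f g (i ∷ is) = trans (cong (f i * g i *_) (∏-* f g is)) (eq (f i) (g i) (∏ f is) (∏ g is))
  where
  eq : ∀ a b p q → a * b * (p * q) ≡ a * p * (b * q)
  eq = solve-∀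

∏-mono : ∀ {I : Set} {f g : I → ℕ} is → (∀ i → f i ≤ g i) → ∏ f is ≤ ∏ g is
∏-mono []       f≤g = ≤-refl
∏-mono (i ∷ is) f≤g = *-mono-≤ (f≤g i) (∏-mono is f≤g)

∏-const : ∀ {I : Set} c (is : List I) → ∏ (λ _ → c) is ≡ c ↑ length is
∏-const c []       = refl
∏-const c (i ∷ is) = cong (c *_) (∏-const c is)

∏-↑ : ∀ {I : Set} (f : I → ℕ) k is → ∏ (λ i → f i ↑ k) is ≡ ∏ f is ↑ k
∏-↑ f k []       = sym (^-zeroˡ k)
∏-↑ f k (i ∷ is) = trans (cong (f i ↑ k *_) (∏-↑ f k is)) (sym (*-↑ (f i) (∏ f is) k))

-- ∑ᵢ uᵢ ∏_{j≠i} dⱼ, i.e. ∏ d · ∑ᵢ uᵢ / dᵢ without the division.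
cofactors : {I : Set} → (u d : I → ℕ) → List I → ℕ
cofactors u d []       = 0
cofactors u d (i ∷ is) = d i * cofactors u d is + u i * ∏ d is

cofactors-+ : ∀ {I : Set} (u w : I → ℕ) is → let d = λ i → u i + w i in
              cofactors u d is + cofactors w d is ≡ length is * ∏ d is
cofactors-+ u w []       = refl
cofactors-+ u w (i ∷ is) = trans (eq₁ (u i) (w i) _ _ _)
  (trans (cong (λ z → (u i + w i) * z + (u i + w i) * ∏ (λ j → u j + w j) is) (cofactors-+ u w is))
    (eq₂ (u i + w i) (length is) _))
  where
  eq₁ : ∀ a b U W D → (a + b) * U + a * D + ((a + b) * W + b * D) ≡ (a + b) * (U + W) + (a + b) * D
  eq₁ = solve-∀
  eq₂ : ∀ c t D → c * (t * D) + c * D ≡ suc t * (c * D)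
  eq₂ = solve-∀

-- AM-GM for the numbers uᵢ / dᵢ.
amgm : ∀ {I : Set} (u d : I → ℕ) is → let t = length is in
       t ↑ t * ∏ u is * ∏ d is ↑ t ≤ cofactors u d is ↑ t * ∏ d is
amgm u d []       = ≤-refl
amgm u d (i ∷ is) = *-cancelˡ-≤ (t ↑ t) {{tᵗ≢0 t}} (begin
  t ↑ t * (suc t ↑ suc t * (a * P) * (c * D) ↑ suc t)
    ≡⟨ cong (λ z → t ↑ t * (suc t ↑ suc t * (a * P) * (c * D * z))) (*-↑ c D t) ⟩
  t ↑ t * (suc t ↑ suc t * (a * P) * (c * D * (c ↑ t * D ↑ t)))
    ≡⟨ eq₁ (t ↑ t) (suc t ↑ suc t) a P c D (c ↑ t) (D ↑ t) ⟩
  suc t ↑ suc t * (a * (c * (c ↑ t * D))) * (t ↑ t * P * D ↑ t)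
    ≤⟨ *-monoʳ-≤ (suc t ↑ suc t * (a * (c * (c ↑ t * D)))) (amgm u d is) ⟩
  suc t ↑ suc t * (a * (c * (c ↑ t * D))) * (U ↑ t * D)
    ≡⟨ eq₂ (suc t ↑ suc t) a c D (c ↑ t) (U ↑ t) ⟩
  suc t ↑ suc t * (c ↑ t * U ↑ t * (a * D)) * (c * D)
    ≡⟨ cong (λ z → suc t ↑ suc t * (z * (a * D)) * (c * D)) (*-↑ c U t) ⟨
  suc t ↑ suc t * ((c * U) ↑ t * (a * D)) * (c * D)
    ≤⟨ *-monoˡ-≤ (c * D) (amgm-step t (c * U) (a * D)) ⟩
  t ↑ t * (c * U + a * D) ↑ suc t * (c * D)
    ≡⟨ *-assoc (t ↑ t) _ _ ⟩
  t ↑ t * ((c * U + a * D) ↑ suc t * (c * D)) ∎)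
  where
  open ≤-Reasoning
  t = length is
  a = u i
  c = d i
  P = ∏ u is
  D = ∏ d is
  U = cofactors u d is
  tᵗ≢0 : ∀ t → NonZero (t ↑ t)
  tᵗ≢0 zero    = _
  tᵗ≢0 (suc t) = m^n≢0 (suc t) (suc t)
  eq₁ : ∀ T T′ a P c D Q R → T * (T′ * (a * P) * (c * D * (Q * R))) ≡ T′ * (a * (c * (Q * D))) * (T * P * R)
  eq₁ = solve-∀
  eq₂ : ∀ T a c D Q R → T * (a * (c * (Q * D))) * (R * D) ≡ T * (Q * R * (a * D)) * (c * D)
  eq₂ = solve-∀

↑-positive : ∀ {x} k → 0 < x → 0 < x ↑ k
↑-positive {suc x} k _ = m^n>0 (suc x) k

-- Sum the inequalities of amgm for uᵢ/dᵢ and wᵢ/dᵢ, where d = u + w, by cofactors-+.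
hölder : ∀ {I : Set} (u w : I → ℕ) is .{{_ : NonZero (length is)}} {c p q} →
         p ↑ length is ≤ c * ∏ u is → q ↑ length is ≤ c * ∏ w is →
         (p + q) ↑ length is ≤ c * ∏ (λ i → u i + w i) is
hölder {I} u w is {c} {zero} {q} _ hq =
  ≤-trans hq (*-monoʳ-≤ c (∏-mono is λ i → m≤n+m (w i) (u i)))
hölder {I} u w is {c} {p} {zero} hp _ =
  ≤-trans (≤-reflexive (cong (_↑ length is) (+-identityʳ p)))
    (≤-trans hp (*-monoʳ-≤ c (∏-mono is λ i → m≤m+n (u i) (w i))))
hölder {I} u w is@(_ ∷ _) {c} {p@(suc _)} {q@(suc _)} hp hq = ≮⇒≥ λ lt →
  <-irrefl refl (begin-strict
    (p + q) * (t * D)               ≡⟨ *-distribʳ-+ (t * D) p q ⟩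
    p * (t * D) + q * (t * D)       <⟨ +-mono-<-≤ (below u hp (λ i → m≤m+n _ _) lt) (<⇒≤ (below w hq (λ i → m≤n+m _ _) lt)) ⟩
    (p + q) * cofactors u d is + (p + q) * cofactors w d is
                                    ≡⟨ *-distribˡ-+ (p + q) (cofactors u d is) _ ⟨
    (p + q) * (cofactors u d is + cofactors w d is)
                                    ≡⟨ cong ((p + q) *_) (cofactors-+ u w is) ⟩
    (p + q) * (t * D)               ∎)
  where
  open ≤-Reasoning
  t = length is
  d = λ i → u i + w i
  D = ∏ d is
  -- Under the negated claim `lt`, `amgm` bounds the cofactor sum strictly from below. The
  -- strictness needs c·∏v > 0, which a positive base supplies; hence the separate clauses for p = 0
  -- and q = 0.
  below : ∀ v {x} → suc x ↑ t ≤ c * ∏ v is → (∀ i → v i ≤ d i) → c * D < (p + q) ↑ t →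
          suc x * (t * D) < (p + q) * cofactors v d is
  below v {x′} hx v≤d lt = ↑-cancel-< t (begin-strict
    (x * (t * D)) ↑ t                     ≡⟨ trans (*-↑ x (t * D) t) (cong (x ↑ t *_) (*-↑ t D t)) ⟩
    x ↑ t * (t ↑ t * D ↑ t)               ≤⟨ *-monoˡ-≤ _ hx ⟩
    c * V * (t ↑ t * D ↑ t)               ≡⟨ eq₁ c V (t ↑ t) (D ↑ t) ⟩
    c * (t ↑ t * V * D ↑ t)               ≤⟨ *-monoʳ-≤ c (amgm v d is) ⟩
    c * (W ↑ t * D)                       ≡⟨ eq₂ c (W ↑ t) D ⟩
    c * D * W ↑ t                         <⟨ *-monoˡ-< (W ↑ t) {{>-nonZero Wᵗ>0}} lt ⟩
    (p + q) ↑ t * W ↑ t                   ≡⟨ *-↑ (p + q) W t ⟨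
    ((p + q) * W) ↑ t                     ∎)
    where
    x = suc x′
    V = ∏ v is
    W = cofactors v d is
    eq₁ : ∀ c V T E → c * V * (T * E) ≡ c * (T * V * E)
    eq₁ = solve-∀
    eq₂ : ∀ c E D → c * (E * D) ≡ c * D * E
    eq₂ = solve-∀
    cV>0 : 0 < c * V
    cV>0 = <-≤-trans (m^n>0 x t) hx
    D>0 : 0 < D
    D>0 = <-≤-trans (m*n>0⇒n>0 c V cV>0) (∏-mono is v≤d)
      where
      m*n>0⇒n>0 : ∀ m n → 0 < m * n → 0 < n
      m*n>0⇒n>0 m zero    h = contradiction (subst (0 <_) (*-zeroʳ m) h) λ ()
      m*n>0⇒n>0 m (suc n) h = s≤s z≤n
    Wᵗ>0 : 0 < W ↑ t
    Wᵗ>0 = n≢0⇒n>0 λ Wᵗ≡0 → <⇒≱ lhs>0 (≤-trans (amgm v d is) (≤-reflexive (cong (_* D) Wᵗ≡0)))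
      where
      V>0 : 0 < V
      V>0 = n≢0⇒n>0 λ V≡0 → <⇒≱ cV>0 (≤-reflexive (trans (cong (c *_) V≡0) (*-zeroʳ c)))
      lhs>0 : 0 < t ↑ t * V * D ↑ t
      lhs>0 = *-mono-≤ (*-mono-≤ (m^n>0 t t) V>0) (↑-positive t D>0)

-- Shearer's lemma

slice : ∀ {k} → Bool → List (Vec Bool (suc k)) → List (Vec Bool k)
slice b     []                = []
slice false ((false ∷ v) ∷ F) = v ∷ slice false F
slice false ((true  ∷ v) ∷ F) = slice false F
slice true  ((false ∷ v) ∷ F) = slice true F
slice true  ((true  ∷ v) ∷ F) = v ∷ slice true F

length-slice : ∀ {k} (F : List (Vec Bool (suc k))) →
               length F ≡ length (slice false F) + length (slice true F)
length-slice []                = refl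
length-slice ((false ∷ v) ∷ F) = cong suc (length-slice F)
length-slice ((true  ∷ v) ∷ F) = trans (cong suc (length-slice F)) (sym (+-suc _ _))

∈-slice⁺ : ∀ {k} b {v : Vec Bool k} {F} → (b ∷ v) ∈ F → v ∈ slice b F
∈-slice⁺ false                         (here refl) = here refl
∈-slice⁺ true                          (here refl) = here refl
∈-slice⁺ false {F = (false ∷ _) ∷ _} (there v∈) = there (∈-slice⁺ false v∈)
∈-slice⁺ false {F = (true  ∷ _) ∷ _} (there v∈) = ∈-slice⁺ false v∈
∈-slice⁺ true  {F = (false ∷ _) ∷ _} (there v∈) = ∈-slice⁺ true v∈
∈-slice⁺ true  {F = (true  ∷ _) ∷ _} (there v∈) = there (∈-slice⁺ true v∈)

∈-slice⁻ : ∀ {k} b {v : Vec Bool k} {F} → v ∈ slice b F → (b ∷ v) ∈ F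
∈-slice⁻ false {F = (false ∷ _) ∷ _} (here refl) = here refl
∈-slice⁻ false {F = (false ∷ _) ∷ _} (there v∈)  = there (∈-slice⁻ false v∈)
∈-slice⁻ false {F = (true  ∷ _) ∷ _} v∈          = there (∈-slice⁻ false v∈)
∈-slice⁻ true  {F = (false ∷ _) ∷ _} v∈          = there (∈-slice⁻ true v∈)
∈-slice⁻ true  {F = (true  ∷ _) ∷ _} (here refl) = here refl
∈-slice⁻ true  {F = (true  ∷ _) ∷ _} (there v∈)  = there (∈-slice⁻ true v∈)

slice-unique : ∀ {k} b {F : List (Vec Bool (suc k))} → Unique F → Unique (slice b F)
slice-unique b     {[]}              []         = []
slice-unique false {(false ∷ v) ∷ F} (v∉ ∷ F!) =
  All.tabulate (λ u∈ v≡u → All.lookup v∉ (∈-slice⁻ false u∈) (cong (false ∷_) v≡u)) ∷ slice-unique false F!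
slice-unique false {(true  ∷ v) ∷ F} (_  ∷ F!) = slice-unique false F!
slice-unique true  {(false ∷ v) ∷ F} (_  ∷ F!) = slice-unique true F!
slice-unique true  {(true  ∷ v) ∷ F} (v∉ ∷ F!) =
  All.tabulate (λ u∈ v≡u → All.lookup v∉ (∈-slice⁻ true u∈) (cong (true ∷_) v≡u)) ∷ slice-unique true F!

∏-if : ∀ {I : Set} (g : I → Bool) (f h : I → ℕ) is →
       ∏ (λ i → if g i then f i else h i) is ≡ ∏ h (filterᵇ (not ∘ g) is) * ∏ f (filterᵇ g is)
∏-if g f h []       = refl
∏-if g f h (i ∷ is) with g i
... | true  = trans (cong (f i *_) (∏-if g f h is)) (eq (f i) (∏ h (filterᵇ (not ∘ g) is)) (∏ f (filterᵇ g is)))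
  where
  eq : ∀ a b c → a * (b * c) ≡ b * (a * c)
  eq = solve-∀
... | false = trans (cong (h i *_) (∏-if g f h is)) (sym (*-assoc (h i) (∏ h (filterᵇ (not ∘ g) is)) (∏ f (filterᵇ g is))))

-- Indices with `g i` false contribute the same factor `u i` to both products. These factors form
-- the constant `c` of `hölder`, so that exactly `t` indices take part in it.
hölder-if : ∀ {I : Set} (g : I → Bool) (u w : I → ℕ) is {t} .{{_ : NonZero t}} {p q} → length (filterᵇ g is) ≡ t →
            p ↑ t ≤ ∏ u is → q ↑ t ≤ ∏ (λ i → if g i then w i else u i) is →
            (p + q) ↑ t ≤ ∏ (λ i → if g i then u i + w i else u i) is
hölder-if g u w is {p = p} {q} refl hp hq = subst ((p + q) ↑ t ≤_) (sym (∏-if g (λ i → u i + w i) u is))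
  (hölder u w (filterᵇ g is) {c = ∏ u (filterᵇ (not ∘ g) is)} {p} {q}
    (subst (p ↑ t ≤_) (trans (∏-if-const is) (∏-if g u u is)) hp)
    (subst (q ↑ t ≤_) (∏-if g w u is) hq))
  where
  t = length (filterᵇ g is)
  ∏-if-const : ∀ is → ∏ u is ≡ ∏ (λ i → if g i then u i else u i) is
  ∏-if-const []       = refl
  ∏-if-const (i ∷ is) with g i
  ... | true  = cong (u i *_) (∏-if-const is)
  ... | false = cong (u i *_) (∏-if-const is)

-- Coordinates outside the set become false instead of being dropped, so that all projections have
-- the same length and the induction in `shearer` can slice them together.
restrict : ∀ {J : Set} → (J → Bool) → (X : List J) → Vec Bool (length X) → Vec Bool (length X)
restrict P []      []      = []
restrict P (x ∷ X) (b ∷ v) = (P x ∧ b) ∷ restrict P X v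

-- Shearer's lemma: X is a set of coordinates, and the sets { x | inc i x },
-- for i in is, cover each coordinate exactly t times.
shearer : ∀ {I J : Set} (inc : I → J → Bool) (is : List I) t .{{_ : NonZero t}} (X : List J) →
          All (λ x → length (filterᵇ (λ i → inc i x) is) ≡ t) X →
          ∀ {F : List (Vec Bool (length X))} (G : I → List (Vec Bool (length X))) → Unique F →
          (∀ i {v} → v ∈ F → restrict (inc i) X v ∈ G i) →
          length F ↑ t ≤ ∏ (length ∘ G) is
shearer inc is t@(suc _) []      [] {[]}    G _ _ = z≤n
shearer inc is t [] [] {[] ∷ []} G _ F⊆ = ≤-trans (≤-reflexive (^-zeroˡ t)) (go is)
  where
  go : ∀ is → 1 ≤ ∏ (length ∘ G) is
  go []       = ≤-refl
  go (i ∷ is) = *-mono-≤ (nonempty (F⊆ i (here refl))) (go is)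
    where
    nonempty : ∀ {v} {F : List (Vec Bool 0)} → v ∈ F → 1 ≤ length F
    nonempty (here _)  = s≤s z≤n
    nonempty (there _) = s≤s z≤n
shearer inc is t [] [] {[] ∷ [] ∷ _} G ((≢ ∷ _) ∷ _) F⊆ = contradiction refl ≢
shearer inc is t (x ∷ X) (cx ∷ cX) {F} G F! F⊆ = begin
  length F ↑ t
    ≡⟨ cong (_↑ t) (length-slice F) ⟩
  (length (slice false F) + length (slice true F)) ↑ t
    ≤⟨ hölder-if (λ i → inc i x) u w is cx
         (shearer inc is t X cX (slice false ∘ G) (slice-unique false F!) false⊆)
         (subst (_ ≤_) (∏-cong is) (shearer inc is t X cX G₁ (slice-unique true F!) true⊆)) ⟩
  ∏ (λ i → if inc i x then u i + w i else u i) is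
    ≤⟨ ∏-mono is bound ⟩
  ∏ (length ∘ G) is ∎
  where
  open ≤-Reasoning
  u w : _ → ℕ
  u = length ∘ slice false ∘ G
  w = length ∘ slice true ∘ G
  -- A word of `F` with head true restricts to a word with head `inc i x`. If the i-th set misses
  -- `x`, both halves of `F` thus project into the same false slice of `G i`.
  G₁ : _ → _
  G₁ i = slice (inc i x) (G i)
  ∏-cong : ∀ is → ∏ (length ∘ G₁) is ≡ ∏ (λ i → if inc i x then w i else u i) is
  ∏-cong []       = refl
  ∏-cong (i ∷ is) with inc i x
  ... | true  = cong (w i *_) (∏-cong is)
  ... | false = cong (u i *_) (∏-cong is)
  bound : ∀ i → (if inc i x then u i + w i else u i) ≤ length (G i)
  bound i with inc i x
  ... | true  = ≤-reflexive (sym (length-slice (G i)))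
  ... | false = ≤-trans (m≤m+n (u i) (w i)) (≤-reflexive (sym (length-slice (G i))))
  false⊆ : ∀ i {v} → v ∈ slice false F → restrict (inc i) X v ∈ slice false (G i)
  false⊆ i {v} v∈ with inc i x | F⊆ i (∈-slice⁻ false v∈)
  ... | true  | ∈G = ∈-slice⁺ false ∈G
  ... | false | ∈G = ∈-slice⁺ false ∈G
  true⊆ : ∀ i {v} → v ∈ slice true F → restrict (inc i) X v ∈ G₁ i
  true⊆ i {v} v∈ with inc i x | F⊆ i (∈-slice⁻ true v∈)
  ... | true  | ∈G = ∈-slice⁺ true ∈G
  ... | false | ∈G = ∈-slice⁺ false ∈G

≡true-ext : ∀ {x y : Bool} → (x ≡ true → y ≡ true) → (y ≡ true → x ≡ true) → x ≡ y
≡true-ext {true}  {y}     f g = sym (f refl)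
≡true-ext {false} {true}  f g = g refl
≡true-ext {false} {false} f g = refl

does⁺ : ∀ {P : Set} (P? : Dec P) → P → does P? ≡ true
does⁺ (yes _) _ = refl
does⁺ (no ¬p) p = contradiction p ¬p

does⁻ : ∀ {P : Set} (P? : Dec P) → does P? ≡ true → P
does⁻ (yes p) _ = p

∈-↭ : ∀ {A : Set} {x : A} {xs} → x ∈ xs → ∃ λ ys → xs ↭ x ∷ ys
∈-↭ {x = x} x∈ with ys , zs , refl ← ∈-∃++ x∈ = ys ++ zs , shift x ys zs

Unique-⊆-length : ∀ {A : Set} {xs ys : List A} → Unique xs → xs ⊆ ys → length xs ≤ length ys
Unique-⊆-length []          _  = z≤n
Unique-⊆-length {xs = x ∷ xs} (x∉ ∷ xs!) ⊆ys with zs , ys↭ ← ∈-↭ (⊆ys (here refl)) =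
  ≤-trans (s≤s (Unique-⊆-length xs! xs⊆zs)) (≤-reflexive (sym (↭-length ys↭)))
  where
  xs⊆zs : xs ⊆ zs
  xs⊆zs y∈ with ∈-resp-↭ ys↭ (⊆ys (there y∈))
  ... | here refl = contradiction refl (All.lookup x∉ y∈)
  ... | there y∈zs = y∈zs

-- Families of bases and contraction

-- Choosing preimages, and not only removing duplicates among the values, allows the same families
-- to be counted by their traces and then contracted.
representatives : ∀ {A B : Set} → DecidableEquality B → (f : A → B) (xs : List A) →
                  ∃ λ ys → ys ⊆ xs × Unique (map f ys) × (∀ {x} → x ∈ xs → f x ∈ map f ys)
representatives _≟_ f []       = [] , (λ ()) , [] , λ ()
representatives _≟_ f (x ∷ xs) with representatives _≟_ f xs
... | ys , ys⊆ , ys! , covers with DecMembership._∈?_ _≟_ (f x) (map f ys)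
... | yes fx∈ = ys , there ∘ ys⊆ , ys! , λ { (here refl) → fx∈ ; (there x∈) → covers x∈ }
... | no  fx∉ = x ∷ ys , (λ { (here refl) → here refl ; (there y∈) → there (ys⊆ y∈) }) ,
                All.tabulate (λ y∈ fx≡y → fx∉ (subst (_∈ map f ys) (sym fx≡y) y∈)) ∷ ys! ,
                λ { (here refl) → here refl ; (there x∈) → there (covers x∈) }

AllPairs-map⁺ : ∀ {A B : Set} {P : A → Set} {R : A → A → Set} {S : B → B → Set} {f : A → B} {xs} →
                All P xs → AllPairs R xs → (∀ {x y} → P x → P y → R x y → S (f x) (f y)) → AllPairs S (map f xs)
AllPairs-map⁺ []         []         _    = []
AllPairs-map⁺ (Px ∷ Pxs) (Rx ∷ Rxs) R⇒S =
  All.map⁺ (All.zipWith (λ (Py , Rxy) → R⇒S Px Py Rxy) (Pxs , Rx)) ∷ AllPairs-map⁺ Pxs Rxs R⇒S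

-- b xs says that xs lists the elements of a basis without repetition, in any
-- order. The empty family of bases is allowed.
record Bases {n} (r : ℕ) (b : List (Fin n) → Bool) : Set where
  field
    perm     : ∀ {xs ys} → xs ↭ ys → b xs ≡ b ys
    rank     : ∀ {xs} → b xs ≡ true → length xs ≡ r
    repeat   : ∀ {x xs} → b (x ∷ x ∷ xs) ≢ true
    exchange : ∀ {x xs ys} → b (x ∷ xs) ≡ true → b ys ≡ true → Any (λ y → b (y ∷ xs) ≡ true) ys

  repeat-∈ : ∀ {x xs} → x ∈ xs → b (x ∷ xs) ≢ true
  repeat-∈ {x} x∈ eq with ys , xs↭ ← ∈-↭ x∈ = repeat (trans (sym (perm (prep x xs↭))) eq)

  unique : ∀ {xs} → b xs ≡ true → Unique xs
  unique {xs} eq = go xs [] eq (↭-reflexive (sym (++-identityʳ xs)))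
    where
    go : ∀ xs zs {ys} → b ys ≡ true → ys ↭ xs ++ zs → Unique xs
    go []       zs eq ys↭ = []
    go (x ∷ xs) zs eq ys↭ =
      All.tabulate (λ { x∈ refl → repeat-∈ (∈-++⁺ˡ x∈) (trans (sym (perm ys↭)) eq) }) ∷
      go xs (x ∷ zs) eq (↭-trans ys↭ (↭-sym (shift x xs zs)))

-- At a loop `v` no list is accepted. This is why `Bases` has to admit the empty family.
contract : ∀ {n} → Fin (suc n) → (List (Fin (suc n)) → Bool) → List (Fin n) → Bool
contract v b xs = b (v ∷ map (punchIn v) xs)

contract-bases : ∀ {n r v} {b : List (Fin (suc n)) → Bool} → Bases (suc r) b → Bases r (contract v b)
contract-bases {v = v} {b} B = record
  { perm     = λ xs↭ys → Bases.perm B (prep v (↭-map⁺ (punchIn v) xs↭ys))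
  ; rank     = λ {xs} eq → trans (sym (length-map (punchIn v) xs)) (suc-injective (Bases.rank B eq))
  ; repeat   = λ {x} eq → Bases.repeat B (trans (sym (Bases.perm B (rotate v _))) eq)
  ; exchange = λ eq eq′ → exch (Bases.exchange B (trans (Bases.perm B (swap _ v ↭-refl)) eq) eq′)
  }
  where
  rotate : ∀ {A : Set} (x y : A) {ys} → x ∷ y ∷ y ∷ ys ↭ y ∷ y ∷ x ∷ ys
  rotate x y = ↭-trans (swap x y ↭-refl) (prep y (swap x y ↭-refl))
  exch : ∀ {xs ys} → Any (λ y → b (y ∷ v ∷ xs) ≡ true) (v ∷ map (punchIn v) ys) →
         Any (λ y → b (v ∷ punchIn v y ∷ xs) ≡ true) ys
  -- The exchange takes place in the larger family and might return `v` itself, but then `v` would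
  -- occur twice.
  exch (here eq)   = contradiction eq (Bases.repeat B)
  exch (there any) = Any.map (trans (Bases.perm B (swap v _ ↭-refl))) (Any.map⁻ any)

∉⇒map-punchIn : ∀ {n} {v : Fin (suc n)} {xs} → v ∉ xs → ∃ λ ys → xs ≡ map (punchIn v) ys
∉⇒map-punchIn {xs = []}     v∉ = [] , refl
∉⇒map-punchIn {xs = x ∷ xs} v∉ with ys , refl ← ∉⇒map-punchIn (v∉ ∘ there) =
  punchOut (v∉ ∘ here) ∷ ys , cong (_∷ _) (sym (Fin.punchIn-punchOut (v∉ ∘ here)))

-- A list containing `v` twice is rejected by both families; any other list containing `v` is a
-- permutation of `v` followed by an image under `punchIn v`.
contract-injective : ∀ {n r v} {b b′ : List (Fin (suc n)) → Bool} → Bases r b → Bases r b′ →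
                     contract v b ≗ contract v b′ → ∀ {xs} → v ∈ xs → b xs ≡ b′ xs
contract-injective {v = v} B B′ eq v∈ with ys , xs↭ ← ∈-↭ v∈ with DecMembership._∈?_ Fin._≟_ v ys
... | yes v∈ys = ≡true-ext
  (λ h → contradiction (trans (sym (Bases.perm B xs↭)) h) (Bases.repeat-∈ B v∈ys))
  (λ h → contradiction (trans (sym (Bases.perm B′ xs↭)) h) (Bases.repeat-∈ B′ v∈ys))
... | no  v∉ys with zs , refl ← ∉⇒map-punchIn v∉ys =
  trans (Bases.perm B xs↭) (trans (eq zs) (sym (Bases.perm B′ xs↭)))

-- Families are functions, and unequal functions may still describe the same family; distinctness is
-- therefore pointwise.
record Collection {n} (r : ℕ) (F : List (List (Fin n) → Bool)) : Set where
  constructor _,_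
  field
    bases    : All (Bases r) F
    distinct : AllPairs (λ b b′ → ¬ b ≗ b′) F

tuples : ∀ n → ℕ → List (List (Fin n))
tuples n zero    = [] ∷ []
tuples n (suc r) = cartesianProductWith _∷_ (allFin n) (tuples n r)

∈-tuples : ∀ {n} (xs : List (Fin n)) → xs ∈ tuples n (length xs)
∈-tuples []       = here refl
∈-tuples (x ∷ xs) = ∈-cartesianProductWith⁺ _∷_ (∈-allFin x) (∈-tuples xs)

tuples-length : ∀ {n} r {xs : List (Fin n)} → xs ∈ tuples n r → length xs ≡ r
tuples-length zero (here refl) = refl
tuples-length {n} (suc r) xs∈ with _ , _ , _ , ys∈ , refl ← ∈-cartesianProductWith⁻ _∷_ (allFin n) (tuples n r) xs∈ =
  cong suc (tuples-length r ys∈)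

-- The coordinates for Shearer's lemma are ordered bases. A basis thus has several coordinates,
-- which is harmless: a coordinate still lies in the sets of exactly `r` elements, its distinct
-- entries.
injections : ∀ n → ℕ → List (List (Fin n))
injections n r = filter (unique? Fin._≟_) (tuples n r)

row : ∀ {J : Set} → (J → Bool) → (X : List J) → Vec Bool (length X)
row b X = Vec.map b (Vec.fromList X)

row-≡⁻ : ∀ {J : Set} {b b′ : J → Bool} X → row b X ≡ row b′ X → ∀ {x} → x ∈ X → b x ≡ b′ x
row-≡⁻ (_ ∷ X) eq (here refl) = Vec.∷-injectiveˡ eq
row-≡⁻ (_ ∷ X) eq (there x∈)  = row-≡⁻ X (Vec.∷-injectiveʳ eq) x∈

restrict-≡ : ∀ {J : Set} (P : J → Bool) {b b′ : J → Bool} X →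
             (∀ {x} → P x ≡ true → b x ≡ b′ x) → restrict P X (row b X) ≡ restrict P X (row b′ X)
restrict-≡ P []      eq = refl
restrict-≡ P (x ∷ X) eq = cong₂ _∷_ (head refl) (restrict-≡ P X eq)
  where
  head : ∀ {c} → P x ≡ c → P x ∧ _ ≡ P x ∧ _
  head {true}  Px = cong (P x ∧_) (eq Px)
  head {false} Px = trans (cong (_∧ _) Px) (sym (cong (_∧ _) Px))

-- Shearer's lemma for the coordinates xs of a basis family and the sets
-- { xs | v ∈ xs }, on which a family is given by its contraction by v.
contraction-bound : ∀ {n r F} → Collection {suc n} (suc r) F →
  ∃ λ (K : Fin (suc n) → List (List (Fin n) → Bool)) →
    (∀ v → Collection r (K v)) × length F ↑ suc r ≤ ∏ (length ∘ K) (allFin (suc n))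
contraction-bound {n} {r} {F} (F-bases , F-distinct) =
  K , K-collection ,
  subst₂ (λ k l → k ↑ suc r ≤ l) (length-map (λ b → row b X) F) (∏-≡ (allFin (suc n)))
    (shearer inc (allFin (suc n)) (suc r) X cover G rows! rows⊆)
  where
  open DecMembership (Fin._≟_ {suc n}) using (_∈?_)
  X = injections (suc n) (suc r)
  inc : Fin (suc n) → List (Fin (suc n)) → Bool
  inc v xs = does (v ∈? xs)
  trace : Fin (suc n) → (List (Fin (suc n)) → Bool) → Vec Bool (length X)
  trace v b = restrict (inc v) X (row b X)
  reps = λ v → representatives (Vec.≡-dec _≟ᵇ_) (trace v) F
  R : Fin (suc n) → List (List (Fin (suc n)) → Bool)
  R v = proj₁ (reps v)
  G : Fin (suc n) → List (Vec Bool (length X))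
  G v = map (trace v) (R v)
  K : Fin (suc n) → List (List (Fin n) → Bool)
  K v = map (contract v) (R v)
  ∏-≡ : ∀ vs → ∏ (length ∘ G) vs ≡ ∏ (length ∘ K) vs
  ∏-≡ []       = refl
  ∏-≡ (v ∷ vs) = cong₂ _*_ (trans (length-map _ (R v)) (sym (length-map _ (R v)))) (∏-≡ vs)

  R-bases : ∀ v → All (Bases (suc r)) (R v)
  R-bases v = All.tabulate λ b∈ → All.lookup F-bases (proj₁ (proj₂ (reps v)) b∈)

  K-collection : ∀ v → Collection r (K v)
  K-collection v = All.map⁺ (All.map contract-bases (R-bases v)) ,
    AllPairs-map⁺ (R-bases v) (AllPairs.map⁻ (proj₁ (proj₂ (proj₂ (reps v))))) λ B B′ ≢ eq →
      ≢ (restrict-≡ (inc v) X λ {xs} v∈ → contract-injective B B′ eq (does⁻ (v ∈? xs) v∈))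

  rows! : Unique (map (λ b → row b X) F)
  rows! = AllPairs-map⁺ F-bases F-distinct λ B B′ ≢ eq → ≢ λ xs → ≡true-ext
    (λ h → trans (sym (row-≡⁻ X eq (∈-X B h))) h)
    (λ h → trans (row-≡⁻ X eq (∈-X B′ h)) h)
    where
    ∈-X : ∀ {b xs} → Bases (suc r) b → b xs ≡ true → xs ∈ X
    ∈-X {xs = xs} B eq = ∈-filter⁺ (unique? Fin._≟_)
      (subst (λ k → xs ∈ tuples (suc n) k) (Bases.rank B eq) (∈-tuples xs)) (Bases.unique B eq)

  rows⊆ : ∀ v {u} → u ∈ map (λ b → row b X) F → restrict (inc v) X u ∈ G v
  rows⊆ v u∈ with b , b∈ , refl ← ∈-map⁻ (λ b → row b X) u∈ = proj₂ (proj₂ (proj₂ (reps v))) b∈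

  cover : All (λ xs → length (filterᵇ (λ v → inc v xs) (allFin (suc n))) ≡ suc r) X
  cover = All.tabulate λ {xs} xs∈ → let xs∈tuples , xs! = ∈-filter⁻ (unique? Fin._≟_) xs∈ in
    trans (≤-antisym
      (Unique-⊆-length (Unique.filter⁺ (T? ∘ λ v → inc v xs) (Unique.allFin⁺ (suc n)))
        (λ {v} v∈ → does⁻ (v ∈? xs) (Equivalence.to T-≡ (proj₂ (∈-filter⁻ (T? ∘ λ v → inc v xs) v∈)))))
      (Unique-⊆-length xs! (λ {v} v∈ → ∈-filter⁺ (T? ∘ λ v → inc v xs) (∈-allFin v)
        (Equivalence.from T-≡ (does⁺ (v ∈? xs) v∈)))))
      (tuples-length (suc r) xs∈tuples)

-- Matroids of rank 3

pairs : ∀ n → List (Fin n × Fin n)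
pairs zero    = []
pairs (suc n) = map (λ y → zero , suc y) (allFin n) ++ map (λ (x , y) → suc x , suc y) (pairs n)

triples : ∀ n → List (Fin n × Fin n × Fin n)
triples zero    = []
triples (suc n) = map (λ (y , z) → zero , suc y , suc z) (pairs n) ++
                  map (λ (x , y , z) → suc x , suc y , suc z) (triples n)

∈-pairs : ∀ {n} {x y : Fin n} → x <ᶠ y → (x , y) ∈ pairs n
∈-pairs {x = zero}  {suc y} _         = ∈-++⁺ˡ (∈-map⁺ _ (∈-allFin y))
∈-pairs {suc n} {suc x} {suc y} (s≤s x<y) = ∈-++⁺ʳ (map (λ y → zero , suc y) (allFin n)) (∈-map⁺ _ (∈-pairs x<y))

∈-triples : ∀ {n} {x y z : Fin n} → x <ᶠ y → y <ᶠ z → (x , y , z) ∈ triples n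
∈-triples {x = zero} {suc y} {suc z} _ (s≤s y<z) = ∈-++⁺ˡ (∈-map⁺ _ (∈-pairs y<z))
∈-triples {suc n} {suc x} {suc y} {suc z} (s≤s x<y) (s≤s y<z) =
  ∈-++⁺ʳ (map (λ (y , z) → zero , suc y , suc z) (pairs n)) (∈-map⁺ _ (∈-triples x<y y<z))

pairs-< : ∀ {n} {x y : Fin n} → (x , y) ∈ pairs n → x <ᶠ y
pairs-< {suc n} xy∈ with ∈-++⁻ (map (λ y → zero , suc y) (allFin n)) xy∈
... | inj₁ xy∈ with _ , _ , refl ← ∈-map⁻ _ xy∈ = s≤s z≤n
... | inj₂ xy∈ with _ , xy∈ , refl ← ∈-map⁻ _ xy∈ = s≤s (pairs-< xy∈)

triples-< : ∀ {n} {x y z : Fin n} → (x , y , z) ∈ triples n → x <ᶠ y × y <ᶠ z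
triples-< {suc n} xyz∈ with ∈-++⁻ (map (λ (y , z) → zero , suc y , suc z) (pairs n)) xyz∈
... | inj₁ xyz∈ with _ , yz∈ , refl ← ∈-map⁻ _ xyz∈ = s≤s z≤n , s≤s (pairs-< yz∈)
... | inj₂ xyz∈ with _ , xyz∈ , refl ← ∈-map⁻ _ xyz∈ with x<y , y<z ← triples-< xyz∈ = s≤s x<y , s≤s y<z

pairs-unique : ∀ n → Unique (pairs n)
pairs-unique zero    = []
pairs-unique (suc n) = Unique.++⁺
  (Unique.map⁺ (λ { refl → refl }) (Unique.allFin⁺ n))
  (Unique.map⁺ (λ { refl → refl }) (pairs-unique n)) disjoint
  where
  disjoint : ∀ {xy} → ¬ (xy ∈ map (λ y → zero , suc y) (allFin n) × xy ∈ map (λ (x , y) → suc x , suc y) (pairs n))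
  disjoint (∈₁ , ∈₂) with _ , _ , refl ← ∈-map⁻ _ ∈₁ with _ , _ , () ← ∈-map⁻ _ ∈₂

triples-unique : ∀ n → Unique (triples n)
triples-unique zero    = []
triples-unique (suc n) = Unique.++⁺
  (Unique.map⁺ (λ { refl → refl }) (pairs-unique n))
  (Unique.map⁺ (λ { refl → refl }) (triples-unique n)) disjoint
  where
  disjoint : ∀ {xyz} → ¬ (xyz ∈ map (λ (y , z) → zero , suc y , suc z) (pairs n) ×
                          xyz ∈ map (λ (x , y , z) → suc x , suc y , suc z) (triples n))
  disjoint (∈₁ , ∈₂) with _ , _ , refl ← ∈-map⁻ _ ∈₁ with _ , _ , () ← ∈-map⁻ _ ∈₂

length-map-++-map : ∀ {A B C : Set} (f : A → C) (g : B → C) xs ys →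
                    length (map f xs ++ map g ys) ≡ length xs + length ys
length-map-++-map f g xs ys = trans (length-++ (map f xs)) (cong₂ _+_ (length-map f xs) (length-map g ys))

length-pairs : ∀ n → length (pairs n) ≡ n C 2
length-pairs zero    = refl
length-pairs (suc n) = trans (length-map-++-map _ _ (allFin n) (pairs n))
  (trans (cong₂ _+_ (trans (length-tabulate {n = n} id) (sym (nC1≡n n))) (length-pairs n))
    (nCk+nC[k+1]≡[n+1]C[k+1] n 1))

length-triples : ∀ n → length (triples n) ≡ n C 3
length-triples zero    = refl
length-triples (suc n) = trans (length-map-++-map _ _ (pairs n) (triples n))
  (trans (cong₂ _+_ (length-pairs n) (length-triples n)) (nCk+nC[k+1]≡[n+1]C[k+1] n 2))

-- The volume of a Hamming ball, ∑_{i ≤ j} C(k,i).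
ball : ℕ → ℕ → ℕ
ball zero    j       = 1
ball (suc k) zero    = 1
ball (suc k) (suc j) = ball k j + ball k (suc j)

weight : ∀ {k} → Vec Bool k → ℕ
weight []          = 0
weight (true  ∷ v) = suc (weight v)
weight (false ∷ v) = weight v

weight-row : ∀ {J : Set} {P : J → Set} (P? : Decidable P) X → weight (row (does ∘ P?) X) ≡ length (filter P? X)
weight-row P? []      = refl
weight-row P? (x ∷ X) with P? x
... | yes _ = cong suc (weight-row P? X)
... | no  _ = weight-row P? X

weight≤ : ∀ {k} (v : Vec Bool k) → weight v ≤ k
weight≤ []          = z≤n
weight≤ (true  ∷ v) = s≤s (weight≤ v)
weight≤ (false ∷ v) = m≤n⇒m≤1+n (weight≤ v)

unique-ball : ∀ {k j} {F : List (Vec Bool k)} → Unique F → (∀ {v} → v ∈ F → weight v ≤ j) → length F ≤ ball k j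
unique-ball {zero} {F = []}          _ _ = z≤n
unique-ball {zero} {F = [] ∷ []}     _ _ = ≤-refl
unique-ball {zero} {F = [] ∷ [] ∷ _} ((≢ ∷ _) ∷ _) _ = contradiction refl ≢
unique-ball {suc k} {zero} {F} F! light = begin
  length F                                       ≡⟨ length-slice F ⟩
  length (slice false F) + length (slice true F) ≡⟨ cong (λ l → length (slice false F) + length l) (empty (slice true F) λ v∈ → <⇒≱ (light (∈-slice⁻ true v∈)) z≤n) ⟩
  length (slice false F) + 0                     ≡⟨ +-identityʳ _ ⟩
  length (slice false F)                         ≤⟨ unique-ball (slice-unique false F!) (λ v∈ → light (∈-slice⁻ false v∈)) ⟩
  ball k 0                                       ≡⟨ ball-zero k ⟩
  1                                              ∎
  where
  open ≤-Reasoning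
  empty : ∀ {A : Set} (xs : List A) → (∀ {x} → x ∉ xs) → xs ≡ []
  empty []      _  = refl
  empty (_ ∷ _) ∉xs = contradiction (here refl) ∉xs
  ball-zero : ∀ k → ball k 0 ≡ 1
  ball-zero zero    = refl
  ball-zero (suc k) = refl
unique-ball {suc k} {suc j} {F} F! light = begin
  length F                                       ≡⟨ length-slice F ⟩
  length (slice false F) + length (slice true F) ≤⟨ +-mono-≤ (unique-ball (slice-unique false F!) (λ v∈ → light (∈-slice⁻ false v∈)))
                                                             (unique-ball (slice-unique true F!) (λ v∈ → ≤-pred (light (∈-slice⁻ true v∈)))) ⟩
  ball k (suc j) + ball k j                      ≡⟨ +-comm (ball k (suc j)) _ ⟩
  ball k j + ball k (suc j)                      ∎
  where open ≤-Reasoning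

-- Simple matroids of rank 3 as linear spaces, and their codes

record Bases₃ {n} (b : Fin n → Fin n → Fin n → Bool) : Set where
  field
    swap₁₂   : ∀ x y z → b x y z ≡ b y x z
    swap₂₃   : ∀ x y z → b x y z ≡ b x z y
    repeat   : ∀ x y → b x x y ≡ false
    exchange : ∀ {x y z p q s} → b x y z ≡ true → b p q s ≡ true →
               b p y z ≡ true ⊎ b q y z ≡ true ⊎ b s y z ≡ true

  rotate : ∀ x y z → b x y z ≡ b y z x
  rotate x y z = trans (swap₁₂ x y z) (swap₂₃ y x z)

  repeat₁₃ : ∀ x y → b x y x ≡ false
  repeat₁₃ x y = trans (swap₂₃ x y x) (repeat x y)

  repeat₂₃ : ∀ x y → b x y y ≡ false
  repeat₂₃ x y = trans (rotate x y y) (repeat y x)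

_≗₃_ : ∀ {n} (b b′ : Fin n → Fin n → Fin n → Bool) → Set
b ≗₃ b′ = ∀ x y z → b x y z ≡ b′ x y z

record Collection₃ {n} (F : List (Fin n → Fin n → Fin n → Bool)) : Set where
  constructor _,_
  field
    bases    : All Bases₃ F
    distinct : AllPairs (λ b b′ → ¬ b ≗₃ b′) F

≢true⇒≡false : ∀ {x} → x ≢ true → x ≡ false
≢true⇒≡false {false} _ = refl
≢true⇒≡false {true}  h = contradiction refl h

≡false⇒≢true : ∀ {x} → x ≡ false → x ≢ true
≡false⇒≢true refl ()

module _ {n} {b b′ : Fin n → Fin n → Fin n → Bool} (B : Bases₃ b) (B′ : Bases₃ b′)
         (sorted : ∀ {x y z} → x <ᶠ y → y <ᶠ z → b x y z ≡ b′ x y z) where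
  private
    module B  = Bases₃ B
    module B′ = Bases₃ B′

    sorted₁₂-ext : ∀ {x y} → x <ᶠ y → ∀ z → b x y z ≡ b′ x y z
    sorted₁₂-ext {x} {y} x<y z with Fin.<-cmp y z
    ... | tri< y<z _ _ = sorted x<y y<z
    ... | tri≈ _ refl _ = trans (B.repeat₂₃ x y) (sym (B′.repeat₂₃ x y))
    ... | tri> _ _ z<y with Fin.<-cmp x z
    ...   | tri< x<z _ _  = trans (B.swap₂₃ x y z) (trans (sorted x<z z<y) (sym (B′.swap₂₃ x y z)))
    ...   | tri≈ _ refl _ = trans (B.repeat₁₃ x y) (sym (B′.repeat₁₃ x y))
    ...   | tri> _ _ z<x  = trans (sym (B.rotate z x y)) (trans (sorted z<x x<y) (B′.rotate z x y))

  sorted-ext : b ≗₃ b′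
  sorted-ext x y z with Fin.<-cmp x y
  ... | tri< x<y _ _  = sorted₁₂-ext x<y z
  ... | tri≈ _ refl _ = trans (B.repeat x z) (sym (B′.repeat x z))
  ... | tri> _ _ y<x  = trans (B.swap₁₂ x y z) (trans (sorted₁₂-ext y<x z) (sym (B′.swap₁₂ x y z)))

least : ∀ {n} {P : Fin n → Set} → Decidable P → ∃ P → ∃ λ i → P i × ∀ {j} → j <ᶠ i → ¬ P j
least {suc n} {P} P? (i , Pi) with P? zero
... | yes P0 = zero , P0 , λ ()
... | no ¬P0 with i | Pi
...   | zero  | P0 = contradiction P0 ¬P0
...   | suc k | Pk with l , Pl , min ← least (P? ∘ suc) (k , Pk) =
  suc l , Pl , λ { {zero} _ → ¬P0 ; {suc j} (s≤s j<l) → min j<l }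

-- No loops and no parallel elements, provided that n > 1.
Simple : ∀ {n} → (Fin n → Fin n → Fin n → Bool) → Set
Simple b = ∀ x y → x ≢ y → ∃ λ z → b x y z ≡ true

-- Under b x y z ≡ false, read as collinearity, the ground set is a linear space.
module Lines {n} {b : Fin n → Fin n → Fin n → Bool} (B : Bases₃ b) (simple : Simple b) where
  open Bases₃ B

  -- By simplicity some `c` completes x, y to a basis. Were x, z, w a basis, one of its elements
  -- could replace `c`; but `x` would repeat, and `z` and `w` lie on the line xy.
  line : ∀ {x y z w} → x ≢ y → b x y z ≡ false → b x y w ≡ false → b x z w ≡ false
  line {x} {y} {z} {w} x≢y xyz xyw with c , xyc ← simple x y x≢y =
    ≢true⇒≡false λ xzw → case (exchange (trans (rotate c x y) xyc) xzw)
    where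
    case : ¬ (b x x y ≡ true ⊎ b z x y ≡ true ⊎ b w x y ≡ true)
    case (inj₁ eq)        = ≡false⇒≢true (repeat x y) eq
    case (inj₂ (inj₁ eq)) = ≡false⇒≢true xyz (trans (sym (rotate z x y)) eq)
    case (inj₂ (inj₂ eq)) = ≡false⇒≢true xyw (trans (sym (rotate w x y)) eq)

  collinear : ∀ {x y p q r} → x ≢ y → p ≢ q →
              b x y p ≡ false → b x y q ≡ false → b x y r ≡ false → b p q r ≡ false
  collinear {x} {y} {p} {q} {r} x≢y p≢q xyp xyq xyr with x Fin.≟ p
  ... | yes refl = line x≢y xyq xyr
  ... | no  x≢p  = line (x≢p ∘ sym) (trans (swap₁₂ p x q) (line x≢y xyp xyq))
                                    (trans (swap₁₂ p x r) (line x≢y xyp xyr))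

-- A line with elements a₁ < a₂ < ⋯ is recorded by the triples {a₁,a₂,aᵢ}, i ≥ 3.
Code : ∀ {n} → (Fin n → Fin n → Fin n → Bool) → Fin n × Fin n × Fin n → Set
Code b (x , y , z) = b x y z ≡ false × ∀ w → w <ᶠ y → w ≢ x → b x y w ≡ true

code? : ∀ {n} (b : Fin n → Fin n → Fin n → Bool) → Decidable (Code b)
code? b (x , y , z) = (b x y z ≟ᵇ false) ×-dec
  Fin.all? λ w → (w Fin.<? y) →-dec (¬? (w Fin.≟ x) →-dec (b x y w ≟ᵇ true))

module _ {n} {b b′ : Fin n → Fin n → Fin n → Bool} (B : Bases₃ b) (B′ : Bases₃ b′)
         (simple : Simple b) (simple′ : Simple b′)
         (code⊆ : ∀ {x y z} → x <ᶠ y → y <ᶠ z → Code b (x , y , z) → Code b′ (x , y , z)) where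
  private
    module B  = Bases₃ B
    module B′ = Bases₃ B′
    module L  = Lines B simple
    module L′ = Lines B′ simple′

    another : ∀ {x y} → x ≢ y → ∀ u → ∃ λ w → b x y w ≡ false × w ≢ u
    another {x} {y} x≢y u with x Fin.≟ u
    ... | yes refl = y , B.repeat₂₃ x y , x≢y ∘ sym
    ... | no  x≢u  = x , B.repeat₁₃ x y , x≢u

  -- Let `u` and `v` be the two least points of the line xy in `b`. Every further point `p` of this
  -- line gives a code triple u, v, p, which `b′` shares. So x, y, z all lie on the line uv of `b′`.
  code-⊆ : ∀ {x y z} → b x y z ≡ false → b′ x y z ≡ false
  code-⊆ {x} {y} {z} xyz with x Fin.≟ y
  ... | yes refl = B′.repeat x z
  ... | no  x≢y
    with u , xyu , u-min ← least (λ w → b x y w ≟ᵇ false) (x , B.repeat₁₃ x y)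
    with v , (xyv , v≢u) , v-min ← least (λ w → (b x y w ≟ᵇ false) ×-dec ¬? (w Fin.≟ u)) (another x≢y u)
    = L′.collinear u≢v x≢y (on′ (B.repeat₁₃ x y)) (on′ (B.repeat₂₃ x y)) (on′ xyz)
    where
    u≢v : u ≢ v
    u≢v = v≢u ∘ sym
    u<v : u <ᶠ v
    u<v with Fin.<-cmp u v
    ... | tri< u<v _ _ = u<v
    ... | tri≈ _ u≡v _ = contradiction u≡v u≢v
    ... | tri> _ _ v<u = contradiction xyv (u-min v<u)
    on′ : ∀ {p} → b x y p ≡ false → b′ u v p ≡ false
    on′ {p} xyp with p Fin.≟ u | p Fin.≟ v
    ... | yes refl | _        = B′.repeat₁₃ u v
    ... | no _     | yes refl = B′.repeat₂₃ u v
    ... | no p≢u   | no p≢v   = proj₁ (code⊆ u<v v<p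
      (L.collinear x≢y u≢v xyu xyv xyp , λ w w<v w≢u → ≢false⇒≡true λ uvw →
        v-min w<v (L.collinear u≢v x≢y (L.collinear x≢y u≢v xyu xyv (B.repeat₁₃ x y))
                    (L.collinear x≢y u≢v xyu xyv (B.repeat₂₃ x y)) uvw , w≢u)))
      where
      ≢false⇒≡true : ∀ {c} → c ≢ false → c ≡ true
      ≢false⇒≡true {true}  _ = refl
      ≢false⇒≡true {false} h = contradiction refl h
      v<p : v <ᶠ p
      v<p with Fin.<-cmp v p
      ... | tri< v<p _ _ = v<p
      ... | tri≈ _ v≡p _ = contradiction (sym v≡p) p≢v
      ... | tri> _ _ p<v = contradiction (xyp , p≢u) (v-min p<v)

-- Three pairs of elements of the line are charged to the triple {a₁,a₂,aᵢ}:
-- {a₁,aᵢ}, {a₂,aᵢ} and, for some 2 < j < i, {aⱼ,aᵢ}, or {a₁,a₂} if i = 3.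
module Charging {n} {b : Fin n → Fin n → Fin n → Bool} (B : Bases₃ b) (simple : Simple b) where
  open Bases₃ B
  open Lines B simple

  Between : (x y z : Fin n) → Set
  Between x y z = ∃ λ (w : Fin n) → y <ᶠ w × w <ᶠ z × b x y w ≡ false

  between? : ∀ x y z → Dec (Between x y z)
  between? x y z = Fin.any? λ w → (y Fin.<? w) ×-dec (w Fin.<? z) ×-dec (b x y w ≟ᵇ false)

  third : ∀ x y z → Dec (Between x y z) → Fin n × Fin n
  third x y z (yes (w , _)) = w , z
  third x y z (no  _)       = x , y

  charge : (Fin n × Fin n × Fin n) × Fin 3 → Fin n × Fin n
  charge ((x , y , z) , zero)     = x , z
  charge ((x , y , z) , suc zero) = y , z
  charge ((x , y , z) , suc (suc zero)) = third x y z (between? x y z)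

  OnLine : Fin n → Fin n → Fin n × Fin n → Set
  OnLine x y (p , q) = p <ᶠ q × b x y p ≡ false × b x y q ≡ false

  charge-on-line : ∀ {x y z} i → x <ᶠ y → y <ᶠ z → b x y z ≡ false → OnLine x y (charge ((x , y , z) , i))
  charge-on-line {x} {y} zero       x<y y<z xyz = Fin.<-trans x<y y<z , repeat₁₃ x y , xyz
  charge-on-line {x} {y} (suc zero) x<y y<z xyz = y<z , repeat₂₃ x y , xyz
  charge-on-line {x} {y} {z} (suc (suc zero)) x<y y<z xyz with between? x y z
  ... | yes (w , y<w , w<z , xyw) = w<z , xyw , xyz
  ... | no  _ = x<y , repeat₁₃ x y , repeat₂₃ x y

  -- The greater entry of the pair is `z`, and the lesser one tells the three kinds apart, except
  -- for the charge `x , y`. That one is made only by the least `z`: of two such elements, the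
  -- smaller would lie between `y` and the larger.
  charge-injectiveʳ : ∀ {x y z z′} i i′ → x <ᶠ y → y <ᶠ z → y <ᶠ z′ → b x y z ≡ false → b x y z′ ≡ false →
                      charge ((x , y , z) , i) ≡ charge ((x , y , z′) , i′) → z ≡ z′ × i ≡ i′
  charge-injectiveʳ zero zero _ _ _ _ _ eq = cong proj₂ eq , refl
  charge-injectiveʳ zero (suc zero) x<y _ _ _ _ eq = contradiction (cong proj₁ eq) (Fin.<⇒≢ x<y)
  charge-injectiveʳ {x} {y} {z} {z′} zero (suc (suc zero)) x<y y<z _ _ _ eq with between? x y z′
  ... | yes (w , y<w , _) = contradiction (cong proj₁ eq) (Fin.<⇒≢ (Fin.<-trans x<y y<w))
  ... | no  _ = contradiction (sym (cong proj₂ eq)) (Fin.<⇒≢ y<z)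
  charge-injectiveʳ (suc zero) zero x<y _ _ _ _ eq = contradiction (sym (cong proj₁ eq)) (Fin.<⇒≢ x<y)
  charge-injectiveʳ (suc zero) (suc zero) _ _ _ _ _ eq = cong proj₂ eq , refl
  charge-injectiveʳ {x} {y} {z} {z′} (suc zero) (suc (suc zero)) x<y _ _ _ _ eq with between? x y z′
  ... | yes (w , y<w , _) = contradiction (cong proj₁ eq) (Fin.<⇒≢ y<w)
  ... | no  _ = contradiction (sym (cong proj₁ eq)) (Fin.<⇒≢ x<y)
  charge-injectiveʳ {x} {y} {z} {z′} (suc (suc zero)) zero x<y _ y<z′ _ _ eq with between? x y z
  ... | yes (w , y<w , _) = contradiction (sym (cong proj₁ eq)) (Fin.<⇒≢ (Fin.<-trans x<y y<w))
  ... | no  _ = contradiction (cong proj₂ eq) (Fin.<⇒≢ y<z′)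
  charge-injectiveʳ {x} {y} {z} {z′} (suc (suc zero)) (suc zero) x<y _ _ _ _ eq with between? x y z
  ... | yes (w , y<w , _) = contradiction (sym (cong proj₁ eq)) (Fin.<⇒≢ y<w)
  ... | no  _ = contradiction (cong proj₁ eq) (Fin.<⇒≢ x<y)
  charge-injectiveʳ {x} {y} {z} {z′} (suc (suc zero)) (suc (suc zero)) x<y y<z y<z′ xyz xyz′ eq
    with between? x y z | between? x y z′
  ... | yes _ | yes _ = cong proj₂ eq , refl
  ... | yes (w , y<w , _) | no _ = contradiction (sym (cong proj₁ eq)) (Fin.<⇒≢ (Fin.<-trans x<y y<w))
  ... | no _ | yes (w , y<w , _) = contradiction (cong proj₁ eq) (Fin.<⇒≢ (Fin.<-trans x<y y<w))
  ... | no ∄w | no ∄w′ with Fin.<-cmp z z′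
  ...   | tri< z<z′ _ _ = contradiction (z , y<z , z<z′ , xyz) ∄w′
  ...   | tri≈ _ z≡z′ _ = z≡z′ , refl
  ...   | tri> _ _ z′<z = contradiction (z′ , y<z′ , z′<z , xyz′) ∄w

  Code⁺ : Fin n × Fin n × Fin n → Set
  Code⁺ (x , y , z) = x <ᶠ y × y <ᶠ z × Code b (x , y , z)

  -- Suppose x ≠ x′. Minimality of `y` forces y ≤ x′, hence x < y′, and then `x` is a point of the
  -- line x′y′ that contradicts the minimality of `y′`. With x = x′, the lesser of `y` and `y′`
  -- contradicts the minimality of the other.
  first-two : ∀ {x y z x′ y′ z′} → Code⁺ (x , y , z) → Code⁺ (x′ , y′ , z′) →
              b x y x′ ≡ false → b x y y′ ≡ false → b x′ y′ x ≡ false → b x′ y′ y ≡ false → x ≡ x′ × y ≡ y′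
  first-two {x} {y} {z} {x′} {y′} (x<y , _ , _ , min) (x′<y′ , _ , _ , min′) xyx′ xyy′ x′y′x x′y′y
    with x Fin.≟ x′
  ... | no x≢x′ = contradiction x′y′x (≢-by (min′ x (<-≤-trans x<y (≤-trans (≮⇒≥ λ x′<y →
            contradiction xyx′ (≢-by (min x′ x′<y (x≢x′ ∘ sym)))) (<⇒≤ x′<y′))) x≢x′))
    where
    ≢-by : ∀ {c} → c ≡ true → c ≢ false
    ≢-by refl ()
  ... | yes refl with Fin.<-cmp y y′
  ...   | tri< y<y′ _ _ = contradiction (trans (sym x′y′y) (min′ y y<y′ (Fin.<⇒≢ x<y ∘ sym))) λ ()
  ...   | tri≈ _ y≡y′ _ = refl , y≡y′
  ...   | tri> _ _ y′<y = contradiction (trans (sym xyy′) (min y′ y′<y (Fin.<⇒≢ x′<y′ ∘ sym))) λ ()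

  same-line : ∀ {x y x′ y′ p q r} → x ≢ y → x′ ≢ y′ → p <ᶠ q → b x y p ≡ false → b x y q ≡ false →
              b x′ y′ p ≡ false → b x′ y′ q ≡ false → b x y r ≡ false → b x′ y′ r ≡ false
  same-line {x′ = x′} {y′} x≢y x′≢y′ p<q xyp xyq x′y′p x′y′q xyr = collinear p≢q x′≢y′
    (collinear x′≢y′ p≢q x′y′p x′y′q (repeat₁₃ x′ y′)) (collinear x′≢y′ p≢q x′y′p x′y′q (repeat₂₃ x′ y′))
    (collinear x≢y p≢q xyp xyq xyr)
    where p≢q = Fin.<⇒≢ p<q

  -- The charged pair lies on both lines, and two points determine a line, so the first two points
  -- agree. The rest is a comparison within one line.
  charge-injective : ∀ {c c′ i i′} → Code⁺ c → Code⁺ c′ → charge (c , i) ≡ charge (c′ , i′) → (c , i) ≡ (c′ , i′)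
  charge-injective {x , y , z} {x′ , y′ , z′} {i} {i′} code@(x<y , y<z , xyz , _) code′@(x′<y′ , y′<z′ , x′y′z′ , _) eq
    with p<q , xyp , xyq ← charge-on-line i x<y y<z xyz
    with _ , x′y′p , x′y′q ← subst (OnLine x′ y′) (sym eq) (charge-on-line i′ x′<y′ y′<z′ x′y′z′)
    with x≢y ← Fin.<⇒≢ x<y | x′≢y′ ← Fin.<⇒≢ x′<y′
    with refl , refl ← first-two code code′
      (same-line x′≢y′ x≢y p<q x′y′p x′y′q xyp xyq (repeat₁₃ x′ y′))
      (same-line x′≢y′ x≢y p<q x′y′p x′y′q xyp xyq (repeat₂₃ x′ y′))
      (same-line x≢y x′≢y′ p<q xyp xyq x′y′p x′y′q (repeat₁₃ x y))
      (same-line x≢y x′≢y′ p<q xyp xyq x′y′p x′y′q (repeat₂₃ x y))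
    with refl , refl ← charge-injectiveʳ i i′ x<y y<z y′<z′ xyz x′y′z′ eq = refl

open Collection₃

length-cartesianProduct : ∀ {A B : Set} (xs : List A) (ys : List B) →
                          length (cartesianProduct xs ys) ≡ length xs * length ys
length-cartesianProduct []       ys = refl
length-cartesianProduct (x ∷ xs) ys = trans (length-++ (map (x ,_) ys))
  (cong₂ _+_ (length-map (x ,_) ys) (length-cartesianProduct xs ys))

map-injective-unique : ∀ {A B : Set} {f : A → B} {xs} → Unique xs →
                       (∀ {x y} → x ∈ xs → y ∈ xs → f x ≡ f y → x ≡ y) → Unique (map f xs)
map-injective-unique []         inj = []
map-injective-unique (x∉ ∷ xs!) inj =
  All.map⁺ (All.tabulate λ y∈ fx≡fy → All.lookup x∉ y∈ (inj (here refl) (there y∈) fx≡fy)) ∷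
  map-injective-unique xs! (λ x∈ y∈ → inj (there x∈) (there y∈))

code-size : ∀ {n} {b : Fin n → Fin n → Fin n → Bool} → Bases₃ b → Simple b →
            length (filter (code? b) (triples n)) ≤ length (pairs n) / 3
code-size {n} {b} B simple = subst (_≤ length (pairs n) / 3) (m*n/n≡m (length codes) 3)
  (/-monoˡ-≤ 3 (begin
    length codes * 3                                   ≡⟨ length-cartesianProduct codes (allFin 3) ⟨
    length (cartesianProduct codes (allFin 3))         ≡⟨ length-map charge (cartesianProduct codes (allFin 3)) ⟨
    length (map charge (cartesianProduct codes (allFin 3)))
      ≤⟨ Unique-⊆-length (map-injective-unique (Unique.cartesianProduct⁺ (Unique.filter⁺ (code? b) (triples-unique n)) (Unique.allFin⁺ 3))
           λ c∈ c′∈ → charge-injective (code⁺ c∈) (code⁺ c′∈)) charged⊆ ⟩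
    length (pairs n)                                   ∎))
  where
  open ≤-Reasoning
  open Charging B simple
  codes = filter (code? b) (triples n)
  code⁺ : ∀ {c i} → (c , i) ∈ cartesianProduct codes (allFin 3) → Code⁺ c
  code⁺ ci∈ with c∈triples , code ← ∈-filter⁻ (code? b) (proj₁ (∈-cartesianProduct⁻ codes (allFin 3) ci∈))
            with x<y , y<z ← triples-< c∈triples = x<y , y<z , code
  charged⊆ : ∀ {pq} → pq ∈ map charge (cartesianProduct codes (allFin 3)) → pq ∈ pairs n
  charged⊆ pq∈ with (c , i) , ci∈ , refl ← ∈-map⁻ charge pq∈ with x<y , y<z , xyz , _ ← code⁺ ci∈ =
    ∈-pairs (proj₁ (charge-on-line i x<y y<z xyz))

simple-bound : ∀ {n} {F : List (Fin n → Fin n → Fin n → Bool)} → Collection₃ F → All Simple F →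
               length F ≤ ball (length (triples n)) (length (pairs n) / 3)
simple-bound {n} {F} (F-bases , F-distinct) F-simple =
  subst (_≤ ball (length (triples n)) (length (pairs n) / 3)) (length-map code F) (unique-ball
    (AllPairs-map⁺ (All.zip (F-bases , F-simple)) F-distinct injective) light)
  where
  code : (Fin n → Fin n → Fin n → Bool) → Vec Bool (length (triples n))
  code b = row (does ∘ code? b) (triples n)
  light : ∀ {v} → v ∈ map code F → weight v ≤ length (pairs n) / 3
  light v∈ with b , b∈ , refl ← ∈-map⁻ code v∈ = ≤-trans (≤-reflexive (weight-row (code? b) (triples n)))
    (code-size (All.lookup F-bases b∈) (All.lookup F-simple b∈))
  injective : ∀ {b b′} → Bases₃ b × Simple b → Bases₃ b′ × Simple b′ → ¬ b ≗₃ b′ → code b ≢ code b′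
  injective {b} {b′} (B , s) (B′ , s′) b≢b′ eq = b≢b′ λ x y z → ≡false-ext
    (code-⊆ B B′ s s′ λ {x} {y} {z} x<y y<z c →
      does⁻ (code? b′ (x , y , z)) (trans (sym (row-≡⁻ (triples n) eq (∈-triples x<y y<z))) (does⁺ (code? b (x , y , z)) c)))
    (code-⊆ B′ B s′ s λ {x} {y} {z} x<y y<z c →
      does⁻ (code? b (x , y , z)) (trans (row-≡⁻ (triples n) eq (∈-triples x<y y<z)) (does⁺ (code? b′ (x , y , z)) c)))
    where
    ≡false-ext : ∀ {x y : Bool} → (x ≡ false → y ≡ false) → (y ≡ false → x ≡ false) → x ≡ y
    ≡false-ext {false} {y}     f g = sym (f refl)
    ≡false-ext {true}  {false} f g = g refl
    ≡false-ext {true}  {true}  f g = refl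

-- The right side is 2^C(n,3). This wasteful bound only starts the induction in `crude-bound`, at n
-- = 5.
all-bound : ∀ {n} {F : List (Fin n → Fin n → Fin n → Bool)} → Collection₃ F →
            length F ≤ ball (length (triples n)) (length (triples n))
all-bound {n} {F} (F-bases , F-distinct) =
  subst (_≤ ball (length (triples n)) (length (triples n))) (length-map (λ b → row (on b) (triples n)) F) (unique-ball
    (AllPairs-map⁺ F-bases F-distinct λ B B′ b≢b′ eq → b≢b′ (sorted-ext B B′ λ x<y y<z →
      row-≡⁻ (triples n) eq (∈-triples x<y y<z)))
    (λ {v} _ → weight≤ v))
  where
  on : (Fin n → Fin n → Fin n → Bool) → Fin n × Fin n × Fin n → Bool
  on b (x , y , z) = b x y z

-- Loops, parallel elements and deletion

delete : ∀ {n} → Fin (suc n) → (Fin (suc n) → Fin (suc n) → Fin (suc n) → Bool) → Fin n → Fin n → Fin n → Bool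
delete v b x y z = b (punchIn v x) (punchIn v y) (punchIn v z)

delete-bases : ∀ {n} v {b : Fin (suc n) → Fin (suc n) → Fin (suc n) → Bool} → Bases₃ b → Bases₃ (delete v b)
delete-bases v B = record
  { swap₁₂   = λ x y z → swap₁₂ (punchIn v x) (punchIn v y) (punchIn v z)
  ; swap₂₃   = λ x y z → swap₂₃ (punchIn v x) (punchIn v y) (punchIn v z)
  ; repeat   = λ x y → repeat (punchIn v x) (punchIn v y)
  ; exchange = exchange
  }
  where open Bases₃ B

-- One relation serves both cases, so that all matroids that are not simple are distributed over N²
-- pairs: on the diagonal it says that `x` is a loop, off it that `x` and `y` replace each other in
-- all bases.
Redundant : ∀ {n} → (Fin n → Fin n → Fin n → Bool) → Fin n × Fin n → Set
Redundant b (x , y) = x ≡ y × (∀ p q → b x p q ≡ false) ⊎ x ≢ y × (∀ p q → b x p q ≡ b y p q)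

redundant? : ∀ {n} (b : Fin n → Fin n → Fin n → Bool) → Decidable (Redundant b)
redundant? b (x , y) =
  ((x Fin.≟ y) ×-dec Fin.all? λ p → Fin.all? λ q → b x p q ≟ᵇ false) ⊎-dec
  (¬? (x Fin.≟ y) ×-dec Fin.all? λ p → Fin.all? λ q → b x p q ≟ᵇ b y p q)

simple? : ∀ {n} → Decidable (Simple {n})
simple? b = Fin.all? λ x → Fin.all? λ y → ¬? (x Fin.≟ y) →-dec Fin.any? λ z → b x y z ≟ᵇ true

module _ {n} {b : Fin n → Fin n → Fin n → Bool} (B : Bases₃ b) where
  open Bases₃ B

  -- In a basis y, u, v the elements `u` and then `v` are replaced by elements of the basis x, p, q.
  -- As `x` never shares a basis with `y`, the entering elements are `p` and `q`.
  parallel : ∀ {x y} → (∀ z → b x y z ≡ false) → (∃ λ u → ∃ λ v → b y u v ≡ true) →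
             ∀ {p q} → b x p q ≡ true → b y p q ≡ true
  parallel {x} {y} xy (u , v , yuv) {p} {q} xpq = first (exchange (trans (sym (swap₁₂ y u v)) yuv) xpq)
    where
    no-xy : ∀ {A : Set} z → b x y z ≡ true → A
    no-xy z xyz = contradiction xyz (≡false⇒≢true (xy z))
    second : ∀ {p q} → b x p q ≡ true → b p y v ≡ true → b y p q ≡ true
    second {p} {q} xpq pyv = finish (exchange (trans (sym (trans (rotate p y v) (rotate y v p))) pyv) xpq)
      where
      finish : b x p y ≡ true ⊎ b p p y ≡ true ⊎ b q p y ≡ true → b y p q ≡ true
      finish (inj₁ xpy)        = no-xy p (trans (sym (swap₂₃ x p y)) xpy)
      finish (inj₂ (inj₁ ppy)) = contradiction ppy (≡false⇒≢true (repeat p y))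
      finish (inj₂ (inj₂ qpy)) = trans (trans (swap₂₃ y p q) (rotate y q p)) qpy
    first : b x y v ≡ true ⊎ b p y v ≡ true ⊎ b q y v ≡ true → b y p q ≡ true
    first (inj₁ xyv)        = no-xy v xyv
    first (inj₂ (inj₁ pyv)) = second xpq pyv
    first (inj₂ (inj₂ qyv)) = trans (swap₂₃ y p q) (second (trans (swap₂₃ x q p) xpq) qyv)

  ¬simple⇒redundant : ¬ Simple b → ∃ (Redundant b)
  ¬simple⇒redundant ¬simple with x , ¬x ← Fin.¬∀⟶∃¬ n _ (λ x → Fin.all? λ y → ¬? (x Fin.≟ y) →-dec Fin.any? λ z → b x y z ≟ᵇ true) ¬simple
    with y , ¬xy ← Fin.¬∀⟶∃¬ n _ (λ y → ¬? (x Fin.≟ y) →-dec Fin.any? λ z → b x y z ≟ᵇ true) ¬x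
    with x Fin.≟ y
  ... | yes x≡y = contradiction (λ x≢y → contradiction x≡y x≢y) ¬xy
  ... | no  x≢y with loop? x | loop? y
    where
    loop? : ∀ x → Dec (∃ λ p → ∃ λ q → b x p q ≡ true)
    loop? x = Fin.any? λ p → Fin.any? λ q → b x p q ≟ᵇ true
  ...   | no  x-loop | _          = (x , x) , inj₁ (refl , λ p q → ≢true⇒≡false λ eq → x-loop (p , q , eq))
  ...   | yes _      | no  y-loop = (y , y) , inj₁ (refl , λ p q → ≢true⇒≡false λ eq → y-loop (p , q , eq))
  ...   | yes x≠0    | yes y≠0    = (x , y) , inj₂ (x≢y , λ p q → ≡true-ext
          (parallel (λ z → ≢true⇒≡false (xy z)) y≠0)
          (parallel (λ z → trans (swap₁₂ y x z) (≢true⇒≡false (xy z))) x≠0))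
    where
    xy : ∀ z → b x y z ≢ true
    xy z eq = ¬xy λ _ → z , eq

module _ {n} {b b′ : Fin (suc n) → Fin (suc n) → Fin (suc n) → Bool} (B : Bases₃ b) (B′ : Bases₃ b′) where
  private
    module B  = Bases₃ B
    module B′ = Bases₃ B′

  -- Triples through `x` are recovered from the deletion: none is a basis if `x` is a loop, and
  -- otherwise `y` stands in for `x`.
  delete-injective : ∀ {x y} → Redundant b (x , y) → Redundant b′ (x , y) → delete x b ≗₃ delete x b′ → b ≗₃ b′
  delete-injective {x} {y} red red′ eq = agree
    where
    avoiding : ∀ {p q s} → x ≢ p → x ≢ q → x ≢ s → b p q s ≡ b′ p q s
    avoiding x≢p x≢q x≢s with e ← eq (punchOut x≢p) (punchOut x≢q) (punchOut x≢s)
      rewrite Fin.punchIn-punchOut x≢p | Fin.punchIn-punchOut x≢q | Fin.punchIn-punchOut x≢s = e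
    agree-through : Redundant b (x , y) → Redundant b′ (x , y) → ∀ p q → b x p q ≡ b′ x p q
    agree-through (inj₁ (_ , loop)) (inj₁ (_ , loop′)) p q = trans (loop p q) (sym (loop′ p q))
    agree-through (inj₁ (x≡y , _))  (inj₂ (x≢y , _))   p q = contradiction x≡y x≢y
    agree-through (inj₂ (x≢y , _))  (inj₁ (x≡y , _))   p q = contradiction x≡y x≢y
    agree-through (inj₂ (x≢y , x∥y)) (inj₂ (_ , x∥y′)) p q with x Fin.≟ p | x Fin.≟ q
    ... | yes refl | _        = trans (B.repeat x q) (sym (B′.repeat x q))
    ... | no _     | yes refl = trans (B.repeat₁₃ x p) (sym (B′.repeat₁₃ x p))
    ... | no x≢p   | no x≢q   = trans (x∥y p q) (trans (avoiding x≢y x≢p x≢q) (sym (x∥y′ p q)))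
    through : ∀ p q → b x p q ≡ b′ x p q
    through = agree-through red red′
    agree : b ≗₃ b′
    agree p q s with x Fin.≟ p | x Fin.≟ q | x Fin.≟ s
    ... | yes refl | _        | _        = through q s
    ... | no _     | yes refl | _        = trans (B.swap₁₂ p x s) (trans (through p s) (sym (B′.swap₁₂ p x s)))
    ... | no _     | no _     | yes refl = trans (sym (B.rotate x p q)) (trans (through p q) (B′.rotate x p q))
    ... | no x≢p   | no x≢q   | no x≢s   = avoiding x≢p x≢q x≢s

length-filter-¬ : ∀ {A : Set} {P : A → Set} (P? : Decidable P) xs →
                  length xs ≡ length (filter P? xs) + length (filter (¬? ∘ P?) xs)
length-filter-¬ P? []       = refl
length-filter-¬ P? (x ∷ xs) with P? x
... | yes _ = cong suc (length-filter-¬ P? xs)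
... | no  _ = trans (cong suc (length-filter-¬ P? xs)) (sym (+-suc _ _))

filter-collection₃ : ∀ {n} {P : (Fin n → Fin n → Fin n → Bool) → Set} (P? : Decidable P) {F} →
                     Collection₃ F → Collection₃ (filter P? F)
filter-collection₃ P? (F-bases , F-distinct) = All.filter⁺ P? F-bases , AllPairs.filter⁺ P? F-distinct

redundant-bound : ∀ {n k} → (∀ {F} → Collection₃ {n} F → length F ≤ k) →
                  ∀ xys {F} → Collection₃ {suc n} F → All (λ b → Any (Redundant b) xys) F → length F ≤ length xys * k
redundant-bound bound []         {[]}    _  _         = z≤n
redundant-bound bound []         {_ ∷ _} _  (() ∷ _)
redundant-bound {n} {k} bound ((x , y) ∷ xys) {F} cF any = begin
  length F                                     ≡⟨ length-filter-¬ xy? F ⟩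
  length (filter xy? F) + length (filter (¬? ∘ xy?) F)
    ≤⟨ +-mono-≤ fibre (redundant-bound bound xys (filter-collection₃ (¬? ∘ xy?) cF) rest) ⟩
  k + length xys * k                           ∎
  where
  open ≤-Reasoning
  xy? : Decidable (λ b → Redundant b (x , y))
  xy? b = redundant? b (x , y)
  rest : All (λ b → Any (Redundant b) xys) (filter (¬? ∘ xy?) F)
  rest = All.tabulate λ b∈ → let b∈F , ¬xy = ∈-filter⁻ (¬? ∘ xy?) b∈ in
    Any.tail ¬xy (All.lookup any b∈F)
  fibre : length (filter xy? F) ≤ k
  fibre = subst (_≤ k) (length-map (delete x) (filter xy? F))
    (bound (All.map⁺ (All.map (delete-bases x) (bases cF′)) ,
            AllPairs-map⁺ (All.zip (bases cF′ , All.all-filter xy? F)) (distinct cF′)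
              λ (B , r) (B′ , r′) b≢b′ eq → b≢b′ (delete-injective B B′ r r′ eq)))
    where cF′ = filter-collection₃ xy? cF

rank-3-recursion : ∀ {n k} → (∀ {F} → Collection₃ {n} F → length F ≤ k) → ∀ {F} → Collection₃ {suc n} F →
                   length F ≤ ball (suc n C 3) ((suc n C 2) / 3) + (suc n * suc n) * k
rank-3-recursion {n} {k} bound {F} cF = begin
  length F                                          ≡⟨ length-filter-¬ simple? F ⟩
  length (filter simple? F) + length (filter (¬? ∘ simple?) F)
    ≤⟨ +-mono-≤ (simple-bound (filter-collection₃ simple? cF) (All.all-filter simple? F))
                (redundant-bound bound xys (filter-collection₃ (¬? ∘ simple?) cF) redundant) ⟩
  ball (length (triples N)) (length (pairs N) / 3) + length xys * k
    ≡⟨ cong₂ (λ l l′ → ball l (l′ / 3) + length xys * k) (length-triples N) (length-pairs N) ⟩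
  ball (N C 3) ((N C 2) / 3) + length xys * k
    ≡⟨ cong (λ l → ball (N C 3) ((N C 2) / 3) + l * k) (trans (length-cartesianProduct (allFin N) (allFin N))
         (cong₂ _*_ (length-tabulate {n = N} id) (length-tabulate {n = N} id))) ⟩
  ball (N C 3) ((N C 2) / 3) + (N * N) * k          ∎
  where
  open ≤-Reasoning
  N = suc n
  xys = cartesianProduct (allFin N) (allFin N)
  redundant : All (λ b → Any (Redundant b) xys) (filter (¬? ∘ simple?) F)
  redundant = All.tabulate λ b∈ → let b∈F , ¬s = ∈-filter⁻ (¬? ∘ simple?) b∈
                                      (x , y) , red = ¬simple⇒redundant (All.lookup (bases cF) b∈F) ¬s in
    Any.map (λ { refl → red }) (∈-cartesianProduct⁺ (∈-allFin x) (∈-allFin y))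

ternary : ∀ {n} → (List (Fin n) → Bool) → Fin n → Fin n → Fin n → Bool
ternary b x y z = b (x ∷ y ∷ z ∷ [])

ternary-bases : ∀ {n} {b : List (Fin n) → Bool} → Bases 3 b → Bases₃ (ternary b)
ternary-bases B = record
  { swap₁₂   = λ x y z → perm (swap x y ↭-refl)
  ; swap₂₃   = λ x y z → perm (prep x (swap y z ↭-refl))
  ; repeat   = λ x y → ≢true⇒≡false repeat
  ; exchange = λ xyz pqs → select (exchange xyz pqs)
  }
  where
  open Bases B
  select : ∀ {A : Set} {P : A → Set} {p q s} → Any P (p ∷ q ∷ s ∷ []) → P p ⊎ P q ⊎ P s
  select (here Pp)                 = inj₁ Pp
  select (there (here Pq))         = inj₂ (inj₁ Pq)
  select (there (there (here Ps))) = inj₂ (inj₂ Ps)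

ternary-injective : ∀ {n} {b b′ : List (Fin n) → Bool} → Bases 3 b → Bases 3 b′ →
                    ternary b ≗₃ ternary b′ → b ≗ b′
ternary-injective {b = b} {b′} B B′ eq xs = ≡true-ext
  (λ h → trans (sym (agree xs (Bases.rank B h))) h) (λ h → trans (agree xs (Bases.rank B′ h)) h)
  where
  agree : ∀ xs → length xs ≡ 3 → b xs ≡ b′ xs
  agree (x ∷ y ∷ z ∷ []) refl = eq x y z

ternary-collection : ∀ {n F} → Collection {n} 3 F → Collection₃ (map ternary F)
ternary-collection (F-bases , F-distinct) = All.map⁺ (All.map ternary-bases F-bases) ,
  AllPairs-map⁺ F-bases F-distinct λ B B′ b≢b′ eq → b≢b′ (ternary-injective B B′ eq)

-- Estimates for rank 3

ball-zero : ∀ k → ball k 0 ≡ 1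
ball-zero zero    = refl
ball-zero (suc k) = refl

ball-one : ∀ k → ball k 1 ≡ suc k
ball-one zero    = refl
ball-one (suc k) = cong₂ _+_ (ball-zero k) (ball-one k)

ball-monoʳ-≤ : ∀ k {i j} → i ≤ j → ball k i ≤ ball k j
ball-monoʳ-≤ zero    _ = ≤-refl
ball-monoʳ-≤ (suc k) {zero}  {zero}  _ = ≤-refl
ball-monoʳ-≤ (suc k) {zero}  {suc j} _ = ≤-trans (≤-trans (≤-reflexive (sym (ball-zero k))) (ball-monoʳ-≤ k z≤n)) (m≤m+n _ _)
ball-monoʳ-≤ (suc k) {suc i} {suc j} (s≤s i≤j) = +-mono-≤ (ball-monoʳ-≤ k i≤j) (ball-monoʳ-≤ k (s≤s i≤j))

ball-m≤n+m : ∀ k l j → ball k j ≤ ball (l + k) j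
ball-m≤n+m k zero    j       = ≤-refl
ball-m≤n+m k (suc l) zero    = ≤-reflexive (ball-zero k)
ball-m≤n+m k (suc l) (suc j) = ≤-trans (ball-m≤n+m k l (suc j)) (m≤n+m _ _)

ball-monoˡ-≤ : ∀ {k l} j → k ≤ l → ball k j ≤ ball l j
ball-monoˡ-≤ {k} j k≤l with o , refl ← m≤n⇒∃[o]m+o≡n k≤l =
  subst (λ l → ball k j ≤ ball l j) (+-comm o k) (ball-m≤n+m k o j)

-- Concatenating two light words gives a light word. Read backwards, splitting the coordinates into
-- blocks bounds a ball from below, which is how the ratios below are estimated.
ball-* : ∀ k j l i → ball k j * ball l i ≤ ball (k + l) (j + i)
ball-* zero    j       l i = ≤-trans (≤-reflexive (*-identityˡ (ball l i))) (ball-monoʳ-≤ l (m≤n+m i j))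
ball-* (suc k) zero    l i = ≤-trans (≤-reflexive (*-identityˡ (ball l i))) (ball-m≤n+m l (suc k) i)
ball-* (suc k) (suc j) l i = ≤-trans (≤-reflexive (*-distribʳ-+ (ball l i) (ball k j) (ball k (suc j))))
  (+-mono-≤ (ball-* k j l i) (ball-* k (suc j) l i))

-- For i ≤ j each summand C(k,i) is at most C(k,i) d^(j-i), and the sum of C(k,i) d^(-i) over all i
-- is (1+1/d)^k.
ball-↑ : ∀ d k j .{{_ : NonZero d}} → ball k j * d ↑ k ≤ d ↑ j * suc d ↑ k
ball-↑ d zero    j       = ≤-trans (m^n>0 d j) (≤-reflexive (sym (*-identityʳ (d ↑ j))))
ball-↑ d (suc k) zero    = ≤-trans (≤-reflexive (+-identityʳ _)) (≤-trans (^-monoˡ-≤ (suc k) (n≤1+n d)) (≤-reflexive (sym (+-identityʳ _))))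
ball-↑ d (suc k) (suc j) = begin
  (ball k j + ball k (suc j)) * (d * d ↑ k)               ≡⟨ eq₁ (ball k j) (ball k (suc j)) d (d ↑ k) ⟩
  d * (ball k j * d ↑ k) + d * (ball k (suc j) * d ↑ k)   ≤⟨ +-mono-≤ (*-monoʳ-≤ d (ball-↑ d k j)) (*-monoʳ-≤ d (ball-↑ d k (suc j))) ⟩
  d * (d ↑ j * suc d ↑ k) + d * (d * d ↑ j * suc d ↑ k)   ≡⟨ eq₂ d (d ↑ j) (suc d ↑ k) ⟩
  d * d ↑ j * (suc d * suc d ↑ k)                         ∎
  where
  open ≤-Reasoning
  eq₁ : ∀ p q d e → (p + q) * (d * e) ≡ d * (p * e) + d * (q * e)
  eq₁ = solve-∀
  eq₂ : ∀ d p q → d * (p * q) + d * (d * p * q) ≡ d * p * (suc d * q)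
  eq₂ = solve-∀

pascal : ∀ n k → suc n C suc k ≡ n C k + n C suc k
pascal n k = sym (nCk+nC[k+1]≡[n+1]C[k+1] n k)

[1+n]C2 : ∀ n → suc n C 2 ≡ n + n C 2
[1+n]C2 n = trans (pascal n 1) (cong (_+ n C 2) (nC1≡n n))

2*[1+n]C2 : ∀ n → 2 * (suc n C 2) ≡ suc n * n
2*[1+n]C2 zero    = refl
2*[1+n]C2 (suc n) = trans (cong (2 *_) ([1+n]C2 (suc n))) (trans (*-distribˡ-+ 2 (suc n) (suc n C 2))
  (trans (cong (λ z → 2 * suc n + z) (2*[1+n]C2 n)) (eq n)))
  where
  eq : ∀ n → 2 * suc n + suc n * n ≡ suc (suc n) * suc n
  eq = solve-∀

3*[2+n]C3 : ∀ n → 3 * (suc (suc n) C 3) ≡ (suc (suc n) C 2) * n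
3*[2+n]C3 zero    = refl
3*[2+n]C3 (suc n) = begin-equality
  3 * (suc N C 3)          ≡⟨ cong (3 *_) (pascal N 2) ⟩
  3 * (X + N C 3)          ≡⟨ *-distribˡ-+ 3 X (N C 3) ⟩
  3 * X + 3 * (N C 3)      ≡⟨ cong (λ z → 3 * X + z) (3*[2+n]C3 n) ⟩
  3 * X + X * n            ≡⟨ eq₁ X n ⟩
  2 * X + X * suc n        ≡⟨ cong (_+ X * suc n) (2*[1+n]C2 (suc n)) ⟩
  N * suc n + X * suc n    ≡⟨ *-distribʳ-+ (suc n) N X ⟨
  (N + X) * suc n          ≡⟨ cong (_* suc n) ([1+n]C2 N) ⟨
  (suc N C 2) * suc n      ∎
  where
  open ≤-Reasoning
  N = suc (suc n)
  X = N C 2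
  eq₁ : ∀ X n → 3 * X + X * n ≡ 2 * X + X * suc n
  eq₁ = solve-∀

≤-induction : ∀ (P : ℕ → Set) a → P a → (∀ n → a ≤ n → P n → P (suc n)) → ∀ n → a ≤ n → P n
≤-induction P a Pa step n a≤n = go (≤⇒≤′ a≤n)
  where
  go : ∀ {n} → a ≤′ n → P n
  go (≤′-reflexive refl) = Pa
  go (≤′-step a≤′n)      = step _ (≤′⇒≤ a≤′n) (go a≤′n)

k*[1+n]≤nC2 : ∀ k a → k ≤ a → k * suc a ≤ a C 2 → ∀ n → a ≤ n → k * suc n ≤ n C 2
k*[1+n]≤nC2 k a k≤a base = ≤-induction (λ n → k * suc n ≤ n C 2) a base λ n a≤n ih → begin
  k * suc (suc n)   ≡⟨ *-suc k (suc n) ⟩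
  k + k * suc n     ≤⟨ +-mono-≤ (≤-trans k≤a a≤n) ih ⟩
  n + n C 2         ≡⟨ [1+n]C2 n ⟨
  suc n C 2         ∎
  where open ≤-Reasoning

3*[1+n]≤nC2 : ∀ n → 8 ≤ n → 3 * suc n ≤ n C 2
3*[1+n]≤nC2 = k*[1+n]≤nC2 3 8 (from-yes (3 ≤? 8)) (from-yes (27 ≤? 28))

6*[1+n]≤nC2 : ∀ n → 14 ≤ n → 6 * suc n ≤ n C 2
6*[1+n]≤nC2 = k*[1+n]≤nC2 6 14 (from-yes (6 ≤? 14)) (from-yes (90 ≤? 91))

-- Growth of the bound for simple matroids, and the share of the others

volume : ℕ → ℕ
volume n = ball (n C 3) ((n C 2) / 3)

-- One more element adds C(n,2) triples and n pairs, hence C(n,2) coordinates and a weight allowance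
-- of at least `i`.
volume-growth : ∀ n i → i * 3 ≤ n → volume n * ball (n C 2) i ≤ volume (suc n)
volume-growth n i 3i≤n = begin
  volume n * ball (n C 2) i                            ≤⟨ ball-* (n C 3) ((n C 2) / 3) (n C 2) i ⟩
  ball (n C 3 + n C 2) ((n C 2) / 3 + i)               ≡⟨ cong (λ k → ball k ((n C 2) / 3 + i)) (trans (+-comm (n C 3) (n C 2)) (sym (pascal n 2))) ⟩
  ball (suc n C 3) ((n C 2) / 3 + i)                   ≤⟨ ball-monoʳ-≤ (suc n C 3) (begin
    (n C 2) / 3 + i                                      ≡⟨ +-comm ((n C 2) / 3) i ⟩
    i + (n C 2) / 3                                      ≡⟨ cong (_+ (n C 2) / 3) (m*n/n≡m i 3) ⟨
    (i * 3) / 3 + (n C 2) / 3                            ≡⟨ +-distrib-/-∣ˡ {m = i * 3} (n C 2) {d = 3} (divides i refl) ⟨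
    (i * 3 + n C 2) / 3                                  ≤⟨ /-monoˡ-≤ 3 (+-monoˡ-≤ (n C 2) 3i≤n) ⟩
    (n + n C 2) / 3                                      ≡⟨ cong (_/ 3) ([1+n]C2 n) ⟨
    (suc n C 2) / 3                                      ∎) ⟩
  volume (suc n)                                       ∎
  where open ≤-Reasoning

crude-ratio : ∀ n → 6 ≤ n → 6 * (suc n * suc n) ≤ 5 * ball (n C 2) 2
crude-ratio n 6≤n with m≤n⇒m<n∨m≡n 6≤n
-- The general argument picks at most one element from each of two blocks of sizes N and 2N. These
-- fit into C(n,2) only from n = 8 on, so n = 6 and n = 7 are computed.
... | inj₂ refl = from-yes (294 ≤? 605)
... | inj₁ 7≤n with m≤n⇒m<n∨m≡n 7≤n
...   | inj₂ refl = from-yes (384 ≤? 1160)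
...   | inj₁ 8≤n = begin
  6 * (N * N)                       ≤⟨ subst (6 * (N * N) ≤_) (sym (eq N)) (m≤m+n _ _) ⟩
  5 * (suc N * suc (2 * N))         ≡⟨ cong₂ (λ k l → 5 * (k * l)) (ball-one N) (ball-one (2 * N)) ⟨
  5 * (ball N 1 * ball (2 * N) 1)   ≤⟨ *-monoʳ-≤ 5 (ball-* N 1 (2 * N) 1) ⟩
  5 * ball (N + 2 * N) 2            ≤⟨ *-monoʳ-≤ 5 (ball-monoˡ-≤ 2 (3*[1+n]≤nC2 n 8≤n)) ⟩
  5 * ball (n C 2) 2                ∎
  where
  open ≤-Reasoning
  N = suc n
  eq : ∀ N → 5 * (suc N * suc (2 * N)) ≡ 6 * (N * N) + (4 * N * N + 15 * N + 5)
  eq = solve-∀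

crude-growth : ∀ n → 5 ≤ n → suc n * suc n * (6 * volume n) ≤ 5 * volume (suc n)
crude-growth n 5≤n with m≤n⇒m<n∨m≡n 5≤n
... | inj₂ refl = from-yes (38016 ≤? 108500)
... | inj₁ 6≤n  = begin
  suc n * suc n * (6 * volume n)        ≡⟨ eq (suc n * suc n) (volume n) ⟩
  volume n * (6 * (suc n * suc n))      ≤⟨ *-monoʳ-≤ (volume n) (crude-ratio n 6≤n) ⟩
  volume n * (5 * ball (n C 2) 2)       ≡⟨ eq₂ (volume n) (ball (n C 2) 2) ⟩
  5 * (volume n * ball (n C 2) 2)       ≤⟨ *-monoʳ-≤ 5 (volume-growth n 2 6≤n) ⟩
  5 * volume (suc n)                    ∎
  where
  open ≤-Reasoning
  eq : ∀ x v → x * (6 * v) ≡ v * (6 * x)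
  eq = solve-∀
  eq₂ : ∀ v w → v * (5 * w) ≡ 5 * (v * w)
  eq₂ = solve-∀

-- At n = 5 the factor 6 is the least integer that works: 2^10 = 1024, and `volume 5` is 176. It
-- reproduces itself since the matroids that are not simple take up at most 5 of the 6 shares.
crude-bound : ∀ n → 5 ≤ n → ∀ {F} → Collection₃ {n} F → length F ≤ 6 * volume n
crude-bound = ≤-induction (λ n → ∀ {F} → Collection₃ {n} F → length F ≤ 6 * volume n) 5
  (λ cF → ≤-trans (all-bound cF) (from-yes (1024 ≤? 1056)))
  λ n 5≤n ih {F} cF → begin
    length F                                                   ≤⟨ rank-3-recursion ih cF ⟩
    volume (suc n) + suc n * suc n * (6 * volume n)            ≤⟨ +-monoʳ-≤ (volume (suc n)) (crude-growth n 5≤n) ⟩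
    6 * volume (suc n)                                         ∎
  where open ≤-Reasoning

-- The number 48 is the factor 6 of `crude-bound` times the 8 in the fraction 1/(8n). Blocks of
-- sizes N, N, N and 3N give a polynomial of degree 4 against degree 3 on the left. Their total 6N
-- is at most C(n,2) exactly from n = 14 on, which is the source of the threshold.
sharp-ratio : ∀ n → 14 ≤ n → 48 * (n * (suc n * suc n)) ≤ ball (n C 2) 4
sharp-ratio n 14≤n = begin
  48 * (n * (N * N))                             ≤⟨ *-monoʳ-≤ 48 (*-monoˡ-≤ (N * N) (n≤1+n n)) ⟩
  48 * (N * (N * N))                             ≡⟨ eq₁ N ⟩
  3 * (15 * (N * (N * N))) + 3 * (N * (N * N))   ≤⟨ +-monoˡ-≤ _ (*-monoʳ-≤ 3 (*-monoˡ-≤ (N * (N * N)) (s≤s 14≤n))) ⟩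
  3 * (N * (N * (N * N))) + 3 * (N * (N * N))    ≤⟨ subst (3 * (N * (N * (N * N))) + 3 * (N * (N * N)) ≤_) (sym (eq₂ N)) (m≤m+n _ _) ⟩
  suc N * suc N * suc N * suc (3 * N)            ≡⟨ cong₂ (λ k l → k * k * k * l) (ball-one N) (ball-one (3 * N)) ⟨
  ball N 1 * ball N 1 * ball N 1 * ball (3 * N) 1
    ≤⟨ *-monoˡ-≤ (ball (3 * N) 1) (≤-trans (*-monoˡ-≤ (ball N 1) (ball-* N 1 N 1)) (ball-* (N + N) 2 N 1)) ⟩
  ball (N + N + N) 3 * ball (3 * N) 1            ≤⟨ ball-* (N + N + N) 3 (3 * N) 1 ⟩
  ball (N + N + N + 3 * N) 4                     ≡⟨ cong (λ k → ball k 4) (eq₃ N) ⟩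
  ball (6 * N) 4                                 ≤⟨ ball-monoˡ-≤ 4 (6*[1+n]≤nC2 n 14≤n) ⟩
  ball (n C 2) 4                                 ∎
  where
  open ≤-Reasoning
  N = suc n
  eq₁ : ∀ N → 48 * (N * (N * N)) ≡ 3 * (15 * (N * (N * N))) + 3 * (N * (N * N))
  eq₁ = solve-∀
  eq₂ : ∀ N → suc N * suc N * suc N * suc (3 * N) ≡
              3 * (N * (N * (N * N))) + 3 * (N * (N * N)) + (7 * (N * (N * N)) + 12 * (N * N) + 6 * N + 1)
  eq₂ = solve-∀
  eq₃ : ∀ N → N + N + N + 3 * N ≡ 6 * N
  eq₃ = solve-∀

sharp-bound : ∀ n → 14 ≤ n → ∀ {F} → Collection₃ {suc n} F → 8 * n * length F ≤ suc (8 * n) * volume (suc n)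
sharp-bound n 14≤n {F} cF = begin
  8 * n * length F                               ≤⟨ *-monoʳ-≤ (8 * n) (rank-3-recursion (crude-bound n (≤-trans (from-yes (5 ≤? 14)) 14≤n)) cF) ⟩
  8 * n * (V + N * N * (6 * volume n))           ≡⟨ eq n N V (volume n) ⟩
  volume n * (48 * (n * (N * N))) + 8 * n * V    ≤⟨ +-monoˡ-≤ (8 * n * V) (≤-trans (*-monoʳ-≤ (volume n) (sharp-ratio n 14≤n))
                                                      (volume-growth n 4 (≤-trans (from-yes (12 ≤? 14)) 14≤n))) ⟩
  V + 8 * n * V                                  ∎
  where
  open ≤-Reasoning
  N = suc n
  V = volume N
  eq : ∀ n N V v → 8 * n * (V + N * N * (6 * v)) ≡ v * (48 * (n * (N * N))) + 8 * n * V
  eq = solve-∀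

-- Bernoulli's inequalities and the gap between two approximations of e

bernoulli-up : ∀ y k → y ↑ k * (y + k) ≤ y * suc y ↑ k
bernoulli-up y zero    = ≤-reflexive (eq y)
  where
  eq : ∀ y → 1 * (y + 0) ≡ y * 1
  eq = solve-∀
bernoulli-up y (suc k) = begin
  y * y ↑ k * (y + suc k)                      ≡⟨ eq₁ y (y ↑ k) k ⟩
  y * (y ↑ k * (y + k)) + y * y ↑ k            ≤⟨ +-mono-≤ (*-monoʳ-≤ y (bernoulli-up y k)) (*-monoʳ-≤ y (^-monoˡ-≤ k (n≤1+n y))) ⟩
  y * (y * suc y ↑ k) + y * suc y ↑ k          ≡⟨ eq₂ y (suc y ↑ k) ⟩
  y * (suc y * suc y ↑ k)                      ∎
  where
  open ≤-Reasoning
  eq₁ : ∀ y p k → y * p * (y + suc k) ≡ y * (p * (y + k)) + y * p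
  eq₁ = solve-∀
  eq₂ : ∀ y q → y * (y * q) + y * q ≡ y * (suc y * q)
  eq₂ = solve-∀

-- Bernoulli's inequality (1 - 1/(x+1))^k ≥ 1 - k/(x+1), with the subtracted term moved across.
bernoulli-down : ∀ x k → suc x ↑ k * suc x ≤ x ↑ k * suc x + k * suc x ↑ k
bernoulli-down x zero    = m≤m+n _ _
bernoulli-down x (suc k) = begin
  suc x * Y * suc x                                 ≡⟨ eq₁ x Y ⟩
  x * (Y * suc x) + Y * suc x                       ≤⟨ +-monoˡ-≤ (Y * suc x) (*-monoʳ-≤ x (bernoulli-down x k)) ⟩
  x * (X * suc x + k * Y) + Y * suc x               ≤⟨ m≤m+n _ (k * Y) ⟩
  x * (X * suc x + k * Y) + Y * suc x + k * Y       ≡⟨ eq₂ x X Y k ⟩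
  x * X * suc x + suc k * (suc x * Y)               ∎
  where
  open ≤-Reasoning
  X = x ↑ k
  Y = suc x ↑ k
  eq₁ : ∀ x Y → suc x * Y * suc x ≡ x * (Y * suc x) + Y * suc x
  eq₁ = solve-∀
  eq₂ : ∀ x X Y k → x * (X * suc x + k * Y) + Y * suc x + k * Y ≡ x * X * suc x + suc k * (suc x * Y)
  eq₂ = solve-∀

-- (1 + 1/d)^d (1 + 1/s³) ≤ (1 + 1/s)^s for s = d + 1.
euler-growth : ∀ d → let s = suc d in
               s ↑ d * s ↑ s * suc (s ↑ 3) ≤ d ↑ d * suc s ↑ s * s ↑ 3
euler-growth d = begin
  -- The ratio of the two sides rests on (1+1/s) (d(d+2)/s²)^d ≥ (1+1/s) (1 - d/s²), by
  -- `bernoulli-down` at x = d(d+2) = s²-1. Here s³+1 factors as (s+1)(s²-s+1), and s²-s+1 is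
  -- d²+d+1.
  S * (s * S) * suc (s ↑ 3)                       ≡⟨ eq₁ d S ⟩
  (S * S) * (d * d + d + 1) * ((2 + d) * s)       ≤⟨ *-monoˡ-≤ ((2 + d) * s) power-bound ⟩
  D * T * (s * s) * ((2 + d) * s)                 ≡⟨ eq₂ d D T ⟩
  D * (suc s * T) * s ↑ 3                         ∎
  where
  open ≤-Reasoning
  s = suc d
  S = s ↑ d
  D = d ↑ d
  T = suc s ↑ d
  x = d * (2 + d)
  1+x≡s² : ∀ d → suc (d * (2 + d)) ≡ suc d * suc d
  1+x≡s² = solve-∀
  split : ∀ d W → d * W + W * (d * d + d + 1) ≡ W * (suc d * suc d)
  split = solve-∀
  eq₁ : ∀ d S → S * (suc d * S) * suc (suc d * (suc d * (suc d * 1))) ≡ (S * S) * (d * d + d + 1) * ((2 + d) * suc d)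
  eq₁ = solve-∀
  eq₂ : ∀ d D T → D * T * (suc d * suc d) * ((2 + d) * suc d) ≡ D * (suc (suc d) * T) * (suc d * (suc d * (suc d * 1)))
  eq₂ = solve-∀
  power-bound : (S * S) * (d * d + d + 1) ≤ D * T * (s * s)
  power-bound = +-cancelˡ-≤ (d * (S * S)) _ _ (begin
    d * (S * S) + (S * S) * (d * d + d + 1)   ≡⟨ split d (S * S) ⟩
    (S * S) * (s * s)                         ≡⟨ cong₂ _*_ (trans (sym (*-↑ s s d)) (cong (_↑ d) (sym (1+x≡s² d)))) (sym (1+x≡s² d)) ⟩
    suc x ↑ d * suc x                         ≤⟨ bernoulli-down x d ⟩
    x ↑ d * suc x + d * suc x ↑ d             ≡⟨ cong₂ (λ y z → y * suc x + d * z) (*-↑ d (2 + d) d) (trans (cong (_↑ d) (1+x≡s² d)) (*-↑ s s d)) ⟩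
    D * T * suc x + d * (S * S)               ≡⟨ cong (λ y → D * T * y + d * (S * S)) (1+x≡s² d) ⟩
    D * T * (s * s) + d * (S * S)             ≡⟨ +-comm (D * T * (s * s)) _ ⟩
    d * (S * S) + D * T * (s * s)             ∎)

-- This pays for the matroids that are not simple: (1+1/(8s))³ is at most (1+1/s³)^b, because b/s³
-- exceeds 1/(2s) while the cube costs about 3/(8s).
slack : ∀ s b .{{_ : NonZero s}} → 2 * b ≡ suc s * s →
        suc (8 * s) ↑ 3 * (s ↑ 3) ↑ b ≤ (8 * s) ↑ 3 * suc (s ↑ 3) ↑ b
slack s b 2b≡ = *-cancelˡ-≤ (2 * y) {{m*n≢0 2 y {{_}} {{m^n≢0 s 3}}}} (begin
  2 * y * (suc (8 * s) ↑ 3 * y ↑ b)               ≡⟨ eq₁ y (suc (8 * s) ↑ 3) (y ↑ b) ⟩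
  2 * (y * suc (8 * s) ↑ 3) * y ↑ b               ≤⟨ *-monoˡ-≤ (y ↑ b) poly ⟩
  (8 * s) ↑ 3 * (2 * y + 2 * b) * y ↑ b           ≡⟨ eq₂ ((8 * s) ↑ 3) y b (y ↑ b) ⟩
  2 * (8 * s) ↑ 3 * (y ↑ b * (y + b))             ≤⟨ *-monoʳ-≤ (2 * (8 * s) ↑ 3) (bernoulli-up y b) ⟩
  2 * (8 * s) ↑ 3 * (y * suc y ↑ b)               ≡⟨ eq₃ ((8 * s) ↑ 3) y (suc y ↑ b) ⟩
  2 * y * ((8 * s) ↑ 3 * suc y ↑ b)               ∎)
  where
  open ≤-Reasoning
  y = s ↑ 3
  eq₁ : ∀ y p q → 2 * y * (p * q) ≡ 2 * (y * p) * q
  eq₁ = solve-∀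
  eq₂ : ∀ p y b q → p * (2 * y + 2 * b) * q ≡ 2 * p * (q * (y + b))
  eq₂ = solve-∀
  eq₃ : ∀ p y q → 2 * p * (y * q) ≡ 2 * y * (p * q)
  eq₃ = solve-∀
  poly : 2 * (y * suc (8 * s) ↑ 3) ≤ (8 * s) ↑ 3 * (2 * y + 2 * b)
  poly = ≤-trans (diff s) (≤-reflexive (cong (λ c → (8 * s) ↑ 3 * (2 * y + c)) (sym 2b≡)))
    where
    -- In terms of s the last factor of the difference is 128s² + 464s - 2; putting s = d+1 into the
    -- linear part makes all coefficients natural.
    expand : ∀ d → let s = suc d in
             (8 * s) * ((8 * s) * ((8 * s) * 1)) * (2 * (s * (s * (s * 1))) + suc s * s) ≡
             2 * (s * (s * (s * 1)) * (suc (8 * s) * (suc (8 * s) * (suc (8 * s) * 1)))) +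
             s * s * s * (128 * (s * s) + 464 * d + 462)
    expand = solve-∀
    diff : ∀ s .{{_ : NonZero s}} → 2 * (s ↑ 3 * suc (8 * s) ↑ 3) ≤ (8 * s) ↑ 3 * (2 * s ↑ 3 + suc s * s)
    diff (suc d) = subst (2 * (suc d ↑ 3 * suc (8 * suc d) ↑ 3) ≤_) (sym (expand d)) (m≤m+n _ _)

-- Cubing clears the exponent b/3. With denominators restored the chain reads μ³ ≤ (1+1/(8s))³ V³ ≤
-- (1+1/s³)^b (d(1+1/d)^d)^b ≤ (d(1+1/s)^s)^b; the factor cancelled at the start collects the
-- denominators.
rank-3-count : ∀ d → 13 ≤ d → let s = suc d; b = suc s C 2 in ∀ {F} → Collection₃ {suc s} F →
               length F ↑ 3 * (s ↑ s) ↑ b ≤ (d * suc s ↑ s) ↑ b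
rank-3-count d@(suc _) 13≤d {F} cF = *-cancelˡ-≤ ((8 * s) ↑ 3 * (d ↑ d) ↑ b * (s ↑ 3) ↑ b) {{nonzero}} (begin
  (8 * s) ↑ 3 * Db * Yb * (μ ↑ 3 * Sb)                ≡⟨ eq₁ ((8 * s) ↑ 3) Db Yb (μ ↑ 3) Sb ⟩
  (8 * s) ↑ 3 * μ ↑ 3 * Db * (Sb * Yb)                ≡⟨ cong (λ z → z * Db * (Sb * Yb)) (*-↑ (8 * s) μ 3) ⟨
  (8 * s * μ) ↑ 3 * Db * (Sb * Yb)                    ≤⟨ *-monoˡ-≤ (Sb * Yb) (*-monoˡ-≤ Db (^-monoˡ-≤ 3 (sharp-bound s (s≤s 13≤d) cF))) ⟩
  (suc (8 * s) * V) ↑ 3 * Db * (Sb * Yb)              ≡⟨ cong (λ z → z * Db * (Sb * Yb)) (*-↑ (suc (8 * s)) V 3) ⟩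
  suc (8 * s) ↑ 3 * V ↑ 3 * Db * (Sb * Yb)            ≡⟨ eq₂ (suc (8 * s) ↑ 3) (V ↑ 3) Db Sb Yb ⟩
  suc (8 * s) ↑ 3 * (V ↑ 3 * Db) * (Sb * Yb)          ≤⟨ *-monoˡ-≤ (Sb * Yb) (*-monoʳ-≤ (suc (8 * s) ↑ 3) volume-bound) ⟩
  suc (8 * s) ↑ 3 * (d ↑ b * Tb) * (Sb * Yb)          ≡⟨ eq₃ (suc (8 * s) ↑ 3) (d ↑ b) Tb Sb Yb ⟩
  d ↑ b * (Tb * Sb) * (suc (8 * s) ↑ 3 * Yb)          ≤⟨ *-monoʳ-≤ (d ↑ b * (Tb * Sb)) (slack s b (2*[1+n]C2 s)) ⟩
  d ↑ b * (Tb * Sb) * ((8 * s) ↑ 3 * suc (s ↑ 3) ↑ b) ≡⟨ eq₄ (d ↑ b) (Tb * Sb) ((8 * s) ↑ 3) (suc (s ↑ 3) ↑ b) ⟩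
  (8 * s) ↑ 3 * d ↑ b * (Tb * Sb * suc (s ↑ 3) ↑ b)   ≤⟨ *-monoʳ-≤ ((8 * s) ↑ 3 * d ↑ b) growth ⟩
  (8 * s) ↑ 3 * d ↑ b * (Db * Eb * Yb)                ≡⟨ eq₅ ((8 * s) ↑ 3) (d ↑ b) Db Eb Yb ⟩
  (8 * s) ↑ 3 * Db * Yb * (d ↑ b * Eb)                ≡⟨ cong ((8 * s) ↑ 3 * Db * Yb *_) (*-↑ d (suc s ↑ s) b) ⟨
  (8 * s) ↑ 3 * Db * Yb * (d * suc s ↑ s) ↑ b         ∎)
  where
  open ≤-Reasoning
  s = suc d
  N = suc s
  b = N C 2
  μ = length F
  V = volume N
  Db = (d ↑ d) ↑ b
  Sb = (s ↑ s) ↑ b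
  Tb = (s ↑ d) ↑ b
  Eb = (suc s ↑ s) ↑ b
  Yb = (s ↑ 3) ↑ b
  nonzero : NonZero ((8 * s) ↑ 3 * Db * Yb)
  nonzero = m*n≢0 _ _ {{m*n≢0 _ _ {{m^n≢0 (8 * s) 3}} {{m^n≢0 (d ↑ d) b {{m^n≢0 d d}}}}}} {{m^n≢0 (s ↑ 3) b {{m^n≢0 s 3}}}}
  eq₁ : ∀ a D Y m S → a * D * Y * (m * S) ≡ a * m * D * (S * Y)
  eq₁ = solve-∀
  eq₂ : ∀ a v D S Y → a * v * D * (S * Y) ≡ a * (v * D) * (S * Y)
  eq₂ = solve-∀
  eq₃ : ∀ a e T S Y → a * (e * T) * (S * Y) ≡ e * (T * S) * (a * Y)
  eq₃ = solve-∀
  eq₄ : ∀ e u a y → e * u * (a * y) ≡ a * e * (u * y)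
  eq₄ = solve-∀
  eq₅ : ∀ a e D E Y → a * e * (D * E * Y) ≡ a * D * Y * (e * E)
  eq₅ = solve-∀
  volume-bound : V ↑ 3 * Db ≤ d ↑ b * Tb
  volume-bound = begin
    V ↑ 3 * (d ↑ d) ↑ b                        ≡⟨ cong (V ↑ 3 *_) (power d) ⟩
    V ↑ 3 * (d ↑ (N C 3)) ↑ 3                  ≡⟨ *-↑ V (d ↑ (N C 3)) 3 ⟨
    (V * d ↑ (N C 3)) ↑ 3                      ≤⟨ ^-monoˡ-≤ 3 (ball-↑ d (N C 3) (b / 3)) ⟩
    (d ↑ (b / 3) * s ↑ (N C 3)) ↑ 3            ≡⟨ *-↑ (d ↑ (b / 3)) (s ↑ (N C 3)) 3 ⟩
    (d ↑ (b / 3)) ↑ 3 * (s ↑ (N C 3)) ↑ 3      ≡⟨ cong₂ _*_ (^-*-assoc d (b / 3) 3) (sym (power s)) ⟩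
    d ↑ (b / 3 * 3) * (s ↑ d) ↑ b              ≤⟨ *-monoˡ-≤ Tb (^-monoʳ-≤ d (m/n*n≤m b 3)) ⟩
    d ↑ b * (s ↑ d) ↑ b                        ∎
    where
    power : ∀ x → (x ↑ d) ↑ b ≡ (x ↑ (N C 3)) ↑ 3
    power x = trans (^-*-assoc x d b) (trans (cong (x ↑_) (trans (*-comm d b)
      (trans (sym (3*[2+n]C3 d)) (*-comm 3 (N C 3))))) (sym (^-*-assoc x (N C 3) 3)))
  growth : Tb * Sb * suc (s ↑ 3) ↑ b ≤ Db * Eb * Yb
  growth = subst₂ _≤_ (distrib (s ↑ d) (s ↑ s) (suc (s ↑ 3))) (distrib (d ↑ d) (suc s ↑ s) (s ↑ 3)) (^-monoˡ-≤ b (euler-growth d))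
    where
    distrib : ∀ x y z → (x * y * z) ↑ b ≡ x ↑ b * y ↑ b * z ↑ b
    distrib x y z = trans (*-↑ (x * y) z b) (cong (_* z ↑ b) (*-↑ x y b))

-- s^j j! times ∑_{i≤j} (k/s)^i / i!.
expSum : ℕ → ℕ → ℕ → ℕ
expSum s k zero    = 1
expSum s k (suc j) = suc j * s * expSum s k j + k ↑ suc j

-- The derivative of a partial sum of the exponential series is the preceding partial sum. Term by
-- term, the discrete form is (k+1)^(i+1) ≥ k^(i+1) + (i+1) k^i.
expSum-suc : ∀ s k j → expSum s k (suc j) + suc j * expSum s k j ≤ expSum s (suc k) (suc j)
expSum-suc s k zero    = ≤-reflexive (eq s k)
  where
  eq : ∀ s k → 1 * s * 1 + k * 1 + 1 * 1 ≡ 1 * s * 1 + suc k * 1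
  eq = solve-∀
expSum-suc s k (suc j) = begin
  J * s * Q + k * K + J * Q            ≡⟨ eq₁ s k K Q′ j ⟩
  J * s * (Q + suc j * Q′) + (k * K + J * K)  ≤⟨ +-mono-≤ (*-monoʳ-≤ (J * s) (expSum-suc s k j)) (power-bound k (suc j)) ⟩
  J * s * expSum s (suc k) (suc j) + suc k ↑ J ∎
  where
  open ≤-Reasoning
  J = suc (suc j)
  K = k ↑ suc j
  Q′ = expSum s k j
  Q = suc j * s * Q′ + K
  eq₁ : ∀ s k K Q′ j → let J = suc (suc j); Q = suc j * s * Q′ + K in
        J * s * Q + k * K + J * Q ≡ J * s * (Q + suc j * Q′) + (k * K + J * K)
  eq₁ = solve-∀
  power-bound : ∀ k i → k * k ↑ i + suc i * k ↑ i ≤ suc k * suc k ↑ i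
  power-bound k zero    = ≤-reflexive (eq k)
    where
    eq : ∀ k → k * 1 + 1 * 1 ≡ suc k * 1
    eq = solve-∀
  power-bound k (suc i) = begin
    k * (k * k ↑ i) + suc (suc i) * (k * k ↑ i)   ≡⟨ eq k i (k ↑ i) ⟩
    k * (k * k ↑ i + suc i * k ↑ i) + k * k ↑ i   ≤⟨ +-mono-≤ (*-monoʳ-≤ k (power-bound k i)) (^-monoˡ-≤ (suc i) (n≤1+n k)) ⟩
    k * (suc k * suc k ↑ i) + suc k * suc k ↑ i   ≡⟨ +-comm (k * (suc k * suc k ↑ i)) _ ⟩
    suc k * (suc k * suc k ↑ i)                   ∎
    where
    eq : ∀ k i p → k * (k * p) + suc (suc i) * (k * p) ≡ k * (k * p + suc i * p) + k * p
    eq = solve-∀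

-- (1 + 1/s)^k ≤ ∑_{i≤k} (k/s)^i / i!, by induction on k: increasing k/s by 1/s
-- increases the next partial sum by at least 1/s times the present one.
expSum-lower : ∀ s k → suc s ↑ k * k ! ≤ expSum s k k
expSum-lower s zero    = ≤-refl
expSum-lower s (suc k) = begin
  suc s * suc s ↑ k * (suc k * k !)                   ≡⟨ eq₁ s (suc s ↑ k) k (k !) ⟩
  suc k * suc s * (suc s ↑ k * k !)                   ≤⟨ *-monoʳ-≤ (suc k * suc s) (expSum-lower s k) ⟩
  suc k * suc s * expSum s k k                        ≡⟨ eq₂ s k (expSum s k k) ⟩
  suc k * s * expSum s k k + suc k * expSum s k k     ≤⟨ +-monoˡ-≤ (suc k * expSum s k k) (m≤m+n (suc k * s * expSum s k k) (k ↑ suc k)) ⟩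
  expSum s k (suc k) + suc k * expSum s k k           ≤⟨ expSum-suc s k k ⟩
  expSum s (suc k) (suc k)                            ∎
  where
  open ≤-Reasoning
  eq₁ : ∀ s p k f → suc s * p * (suc k * f) ≡ suc k * suc s * (p * f)
  eq₁ = solve-∀
  eq₂ : ∀ s k q → suc k * suc s * q ≡ suc k * s * q + suc k * q
  eq₂ = solve-∀

-- k! ∑_{i≤k} 1/i!.
arrangements : ℕ → ℕ
arrangements zero    = 1
arrangements (suc k) = suc k * arrangements k + 1

expSum-diagonal : ∀ s j → expSum s s j ≡ s ↑ j * arrangements j
expSum-diagonal s zero    = refl
expSum-diagonal s (suc j) = trans (cong (λ z → suc j * s * z + s ↑ suc j) (expSum-diagonal s j))
  (eq s j (s ↑ j) (arrangements j))
  where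
  eq : ∀ s j p h → suc j * s * (p * h) + s * p ≡ s * p * (suc j * h + 1)
  eq = solve-∀

-- Since `e` is defined by partial sums of its series, the power (1+1/s)^s has to be placed below
-- one of them.
euler-lower : ∀ s → suc s ↑ s * s ! ≤ s ↑ s * arrangements s
euler-lower s = ≤-trans (expSum-lower s s) (≤-reflexive (expSum-diagonal s s))

-- Higher ranks

nC0≡1 : ∀ n → n C 0 ≡ 1
nC0≡1 n = trans (nCk≡nC[n∸k] (z≤n {n})) (nCn≡1 n)

absorption : ∀ n k → suc k * (suc n C suc k) ≡ suc n * (n C k)
absorption n zero = trans (*-identityˡ (suc n C 1)) (trans (nC1≡n (suc n))
  (sym (trans (cong (suc n *_) (nC0≡1 n)) (*-identityʳ (suc n)))))
absorption zero    (suc k) = *-zeroʳ (suc (suc k))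
absorption (suc n) (suc k) = begin
  suc (suc k) * (suc (suc n) C suc (suc k))       ≡⟨ cong (suc (suc k) *_) (pascal (suc n) (suc k)) ⟩
  suc (suc k) * (X + suc n C suc (suc k))         ≡⟨ eq (suc k) X _ ⟩
  X + suc k * X + suc (suc k) * (suc n C suc (suc k))
                                                  ≡⟨ cong₂ (λ y z → X + y + z) (absorption n k) (absorption n (suc k)) ⟩
  X + suc n * (n C k) + suc n * (n C suc k)       ≡⟨ +-assoc X _ _ ⟩
  X + (suc n * (n C k) + suc n * (n C suc k))     ≡⟨ cong (λ y → X + y) (trans (sym (*-distribˡ-+ (suc n) (n C k) _)) (cong (suc n *_) (sym (pascal n k)))) ⟩
  X + suc n * X                                   ∎
  where
  open ≡-Reasoning
  X = suc n C suc k
  eq : ∀ k x y → suc k * (x + y) ≡ x + k * x + suc k * y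
  eq = solve-∀

nCk>0 : ∀ {n k} → k ≤ n → 0 < n C k
nCk>0 {n}     {zero}  _         = ≤-reflexive (sym (nC0≡1 n))
nCk>0 {suc n} {suc k} (s≤s k≤n) = ≤-trans (nCk>0 k≤n) (≤-trans (m≤m+n _ _) (≤-reflexive (sym (pascal n k))))

-- At most (U/D)^(b/a) basis families have rank r, where b/a = C(n,r)/d.
record CountBound (U D d n r : ℕ) : Set where
  field
    a b   : ℕ
    a≢0   : NonZero a
    ratio : b * d ≡ a * (n C r)
    bound : ∀ {F} → Collection {n} r F → length F ↑ a * D ↑ b ≤ U ↑ b

-- Multiplying the bounds for the contractions by all n+1 elements makes the exponent b(n+1),
-- against (r+1)a for the family itself. By `absorption` the new fraction is C(n+1,r+1)/d with the
-- same `d`.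
count-lift : ∀ {U D d n r} → CountBound U D d n r → CountBound U D d (suc n) (suc r)
count-lift {U} {D} {d} {n} {r} count = record
  { a     = suc r * a
  ; b     = b * suc n
  ; a≢0   = m*n≢0 (suc r) a {{_}} {{a≢0}}
  ; ratio = begin
      b * suc n * d                        ≡⟨ eq₁ b (suc n) d ⟩
      suc n * (b * d)                      ≡⟨ cong (suc n *_) ratio ⟩
      suc n * (a * (n C r))                ≡⟨ eq₂ (suc n) a (n C r) ⟩
      a * (suc n * (n C r))                ≡⟨ cong (a *_) (absorption n r) ⟨
      a * (suc r * (suc n C suc r))        ≡⟨ eq₃ a (suc r) (suc n C suc r) ⟩
      suc r * a * (suc n C suc r)          ∎
  ; bound = λ {F} cF → bound′ F cF
  }
  where
  open CountBound count
  open ≡-Reasoning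
  eq₁ : ∀ b n d → b * n * d ≡ n * (b * d)
  eq₁ = solve-∀
  eq₂ : ∀ n a c → n * (a * c) ≡ a * (n * c)
  eq₂ = solve-∀
  eq₃ : ∀ a r c → a * (r * c) ≡ r * a * c
  eq₃ = solve-∀
  ∏-allFin : ∀ x → ∏ (λ _ → x) (allFin (suc n)) ≡ x ↑ suc n
  ∏-allFin x = trans (∏-const x (allFin (suc n))) (cong (x ↑_) (length-tabulate {n = suc n} id))
  bound′ : ∀ F → Collection (suc r) F → length F ↑ (suc r * a) * D ↑ (b * suc n) ≤ U ↑ (b * suc n)
  bound′ F cF with K , cK , le ← contraction-bound cF = R.begin
    length F ↑ (suc r * a) * D ↑ (b * suc n)
      R.≡⟨ cong₂ _*_ (sym (^-*-assoc (length F) (suc r) a)) (trans (sym (^-*-assoc D b (suc n))) (sym (∏-allFin (D ↑ b)))) ⟩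
    (length F ↑ suc r) ↑ a * ∏ (λ _ → D ↑ b) vs
      R.≤⟨ *-monoˡ-≤ _ (^-monoˡ-≤ a le) ⟩
    ∏ (length ∘ K) vs ↑ a * ∏ (λ _ → D ↑ b) vs
      R.≡⟨ cong (_* ∏ (λ _ → D ↑ b) vs) (∏-↑ (length ∘ K) a vs) ⟨
    ∏ (λ v → length (K v) ↑ a) vs * ∏ (λ _ → D ↑ b) vs
      R.≡⟨ ∏-* (λ v → length (K v) ↑ a) (λ _ → D ↑ b) vs ⟨
    ∏ (λ v → length (K v) ↑ a * D ↑ b) vs
      R.≤⟨ ∏-mono vs (λ v → bound (cK v)) ⟩
    ∏ (λ _ → U ↑ b) vs
      R.≡⟨ trans (∏-allFin (U ↑ b)) (^-*-assoc U b (suc n)) ⟩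
    U ↑ (b * suc n) R.∎
    where
    module R = ≤-Reasoning
    vs = allFin (suc n)

count-rank-3 : ∀ d → 13 ≤ d → let s = suc d in CountBound (d * suc s ↑ s) (s ↑ s) d (suc s) 3
count-rank-3 d 13≤d = record
  { a     = 3
  ; b     = suc (suc d) C 2
  ; a≢0   = _
  ; ratio = sym (3*[2+n]C3 d)
  ; bound = λ {F} cF → subst (λ μ → μ ↑ 3 * (s ↑ s) ↑ (suc s C 2) ≤ (d * suc s ↑ s) ↑ (suc s C 2))
                         (length-map ternary F) (rank-3-count d 13≤d (ternary-collection cF))
  }
  where s = suc d

count : ∀ d k → 13 ≤ d → let s = suc d in CountBound (d * suc s ↑ s) (s ↑ s) d (k + suc s) (k + 3)
count d zero    13≤d = count-rank-3 d 13≤d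
count d (suc k) 13≤d = count-lift (count d k 13≤d)

-- Logarithms and e

/-cong : ∀ i c j d .{{_ : NonZero c}} .{{_ : NonZero d}} → i ℤ.* + d ≡ j ℤ.* + c → i ℚ./ c ≡ j ℚ./ d
/-cong i c j d eq = ℚ.≤-antisym (/-mono-≤ i c j d (ℤ.≤-reflexive eq)) (/-mono-≤ j d i c (ℤ.≤-reflexive (sym eq)))

/-+ : ∀ i c j d .{{_ : NonZero c}} .{{_ : NonZero d}} .{{_ : NonZero (c * d)}} →
      (i ℚ./ c) ℚ.+ (j ℚ./ d) ≡ (i ℤ.* + d ℤ.+ j ℤ.* + c) ℚ./ (c * d)
/-+ i (suc c) j (suc d) = ℚ.toℚᵘ-injective (ℚᵘ.≃-trans
  (ℚ.toℚᵘ-homo-+ (i ℚ./ suc c) (j ℚ./ suc d))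
  (ℚᵘ.≃-trans (ℚᵘ.+-cong (ℚ.toℚᵘ-fromℚᵘ (ℚᵘ.mkℚᵘ i c)) (ℚ.toℚᵘ-fromℚᵘ (ℚᵘ.mkℚᵘ j d)))
    (ℚᵘ.≃-sym (ℚ.toℚᵘ-fromℚᵘ (ℚᵘ.mkℚᵘ i c ℚᵘ.+ ℚᵘ.mkℚᵘ j d)))))

/-^ : ∀ i d k .{{_ : NonZero d}} .{{_ : NonZero (d ↑ k)}} → (+ i ℚ./ d) ^ k ≡ + (i ↑ k) ℚ./ (d ↑ k)
/-^ i d zero    = refl
/-^ i d (suc k) {{_}} {{nz}} = trans (cong ((+ i ℚ./ d) ℚ.*_) (/-^ i d k))
  (trans (/-* (+ i) d (+ (i ↑ k)) (d ↑ k)) (/-cong (+ i ℤ.* + (i ↑ k)) (d ↑ suc k) (+ (i ↑ suc k)) (d ↑ suc k) (cong (ℤ._* + (d ↑ suc k)) (sym (ℤ.pos-* i (i ↑ k))))))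
  where
  instance
    dk≢0 : NonZero (d ↑ k)
    dk≢0 = m^n≢0 d k

∑1/j!≡ : ∀ k → ∑1/j! k ≡ (+ arrangements k ℚ./ (k !)) {{k !≢0}}
∑1/j!≡ zero    = refl
∑1/j!≡ (suc k) = trans (cong (ℚ._+ invFact (suc k)) (∑1/j!≡ k))
  (trans (/-+ (+ arrangements k) (k !) (+ 1) (suc k !))
    (/-cong (+ arrangements k ℤ.* + (suc k !) ℤ.+ + 1 ℤ.* + (k !)) (k ! * suc k !) (+ arrangements (suc k)) (suc k !) (trans (cong (λ f → (+ arrangements k ℤ.* f ℤ.+ + 1 ℤ.* + (k !)) ℤ.* f) (ℤ.pos-* (suc k) (k !)))
      (trans (eq (+ arrangements k) (+ suc k) (+ (k !)))
        (sym (cong₂ ℤ._*_ (cong (ℤ._+ + 1) (ℤ.pos-* (suc k) (arrangements k)))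
                      (trans (ℤ.pos-* (k !) (suc k !)) (cong (+ (k !) ℤ.*_) (ℤ.pos-* (suc k) (k !))))))))))
  where
  instance
    k!≢0 = k !≢0
    [1+k]!≢0 = suc k !≢0
    prod≢0 = m*n≢0 (k !) (suc k !)
  eq : ∀ h s f → (h ℤ.* (s ℤ.* f) ℤ.+ + 1 ℤ.* f) ℤ.* (s ℤ.* f) ≡ (s ℤ.* h ℤ.+ + 1) ℤ.* (f ℤ.* (s ℤ.* f))
  eq = solveℤ-∀

-- c log₂ x / d = log₂ x^(b/a), so x need only be approximated by rationals y.
log₂-≤ : ∀ M (0<M : 0< fromℕ M) x (0<x : 0< x) c d a b .{{_ : NonZero a}} .{{_ : NonZero b}} .{{_ : NonZero d}} .{{_ : NonZero c}} →
         b * d ≡ a * c → ∀ y → 0ℚ ℚ.< y → cut x y → ℕ⇒ℚ M ^ a ℚ.≤ y ^ b →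
         log₂ (fromℕ M) 0<M ≤ℝ (c · log₂ x 0<x) ÷ d
log₂-≤ M 0<M x 0<x c@(suc c′) d a b bd≡ac y 0<y y∈x M^a≤y^b q (y₀ , y₀<M , 0<y₀ , 2^q<y₀) =
  y , y∈x , 0<y , exponent-mono (↥ q′) (↧ₙ q′) (↥ q ℤ.* + a) (↧ₙ q * b) 0<y le lt
  where
  -- By the definitions of `÷` and `·`, the goal is that `q′` lies in the cut of the logarithm of
  -- `x`. Its value is dq/c = aq/b.
  q′ = (+ 1 ℚ./ c) ℚ.* ((+ d ℚ./ 1) ℚ.* q)
  instance
    ↧qb≢0 : NonZero (↧ₙ q * b)
    ↧qb≢0 = m*n≢0 (↧ₙ q) b
    1↧q≢0 : NonZero (1 * ↧ₙ q)
    1↧q≢0 = m*n≢0 1 (↧ₙ q)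
    c1↧q≢0 : NonZero (c * (1 * ↧ₙ q))
    c1↧q≢0 = m*n≢0 c (1 * ↧ₙ q)
  q′≡ : q′ ≡ (↥ q ℤ.* + a) ℚ./ (↧ₙ q * b)
  q′≡ = begin
    (+ 1 ℚ./ c) ℚ.* ((+ d ℚ./ 1) ℚ.* q)                        ≡⟨ cong (λ p → (+ 1 ℚ./ c) ℚ.* ((+ d ℚ./ 1) ℚ.* p)) (ℚ.↥p/↧p≡p q) ⟨
    (+ 1 ℚ./ c) ℚ.* ((+ d ℚ./ 1) ℚ.* (↥ q ℚ./ ↧ₙ q))           ≡⟨ cong ((+ 1 ℚ./ c) ℚ.*_) (/-* (+ d) 1 (↥ q) (↧ₙ q)) ⟩
    (+ 1 ℚ./ c) ℚ.* ((+ d ℤ.* ↥ q) ℚ./ (1 * ↧ₙ q))             ≡⟨ /-* (+ 1) c (+ d ℤ.* ↥ q) (1 * ↧ₙ q) ⟩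
    (+ 1 ℤ.* (+ d ℤ.* ↥ q)) ℚ./ (c * (1 * ↧ₙ q))               ≡⟨ /-cong (+ 1 ℤ.* (+ d ℤ.* ↥ q)) (c * (1 * ↧ₙ q)) (↥ q ℤ.* + a) (↧ₙ q * b) cross ⟩
    (↥ q ℤ.* + a) ℚ./ (↧ₙ q * b)                               ∎
    where
    open ≡-Reasoning
    cross : + 1 ℤ.* (+ d ℤ.* ↥ q) ℤ.* + (↧ₙ q * b) ≡ ↥ q ℤ.* + a ℤ.* + (c * (1 * ↧ₙ q))
    cross = begin
      + 1 ℤ.* (+ d ℤ.* ↥ q) ℤ.* + (↧ₙ q * b)          ≡⟨ cong (+ 1 ℤ.* (+ d ℤ.* ↥ q) ℤ.*_) (ℤ.pos-* (↧ₙ q) b) ⟩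
      + 1 ℤ.* (+ d ℤ.* ↥ q) ℤ.* (+ ↧ₙ q ℤ.* + b)      ≡⟨ eq₁ (+ d) (↥ q) (+ ↧ₙ q) (+ b) ⟩
      ↥ q ℤ.* + ↧ₙ q ℤ.* (+ b ℤ.* + d)                ≡⟨ cong (↥ q ℤ.* + ↧ₙ q ℤ.*_) (trans (sym (ℤ.pos-* b d)) (trans (cong +_ bd≡ac) (ℤ.pos-* a c))) ⟩
      ↥ q ℤ.* + ↧ₙ q ℤ.* (+ a ℤ.* + c)                ≡⟨ eq₂ (↥ q) (+ ↧ₙ q) (+ a) (+ c) ⟩
      ↥ q ℤ.* + a ℤ.* (+ c ℤ.* + ↧ₙ q)                ≡⟨ cong (↥ q ℤ.* + a ℤ.*_) (trans (sym (ℤ.pos-* c (↧ₙ q))) (cong (λ z → + (c * z)) (sym (*-identityˡ (↧ₙ q))))) ⟩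
      ↥ q ℤ.* + a ℤ.* + (c * (1 * ↧ₙ q))              ∎
      where
      eq₁ : ∀ d p n b → + 1 ℤ.* (d ℤ.* p) ℤ.* (n ℤ.* b) ≡ p ℤ.* n ℤ.* (b ℤ.* d)
      eq₁ = solveℤ-∀
      eq₂ : ∀ p n a c → p ℤ.* n ℤ.* (a ℤ.* c) ≡ p ℤ.* a ℤ.* (c ℤ.* n)
      eq₂ = solveℤ-∀
  le : ↥ q′ ℤ.* + (↧ₙ q * b) ℤ.≤ ↥ q ℤ.* + a ℤ.* + ↧ₙ q′
  le = ℤ.≤-reflexive (subst (λ p → ↥ p ℤ.* + (↧ₙ q * b) ≡ ↥ q ℤ.* + a ℤ.* ↧ p) (sym q′≡) (↥↧-/ (↥ q ℤ.* + a) (↧ₙ q * b)))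
  lt : 2^ (↥ q ℤ.* + a) ℚ.< y ^ (↧ₙ q * b)
  lt = begin-strict
    2^ (↥ q ℤ.* + a)          ≡⟨ 2^-* (↥ q) a ⟩
    (2^ (↥ q)) ^ a            <⟨ ^-mono-< a (2^-positive (↥ q)) 2^q<y₀ ⟩
    (y₀ ^ ↧ₙ q) ^ a           ≤⟨ ^-mono-≤ a (^-positive (↧ₙ q) 0<y₀) (^-mono-≤ (↧ₙ q) 0<y₀ (ℚ.<⇒≤ y₀<M)) ⟩
    (ℕ⇒ℚ M ^ ↧ₙ q) ^ a        ≡⟨ ^-swap (ℕ⇒ℚ M) (↧ₙ q) a ⟩
    (ℕ⇒ℚ M ^ a) ^ ↧ₙ q        ≤⟨ ^-mono-≤ (↧ₙ q) (^-positive a (ℚ.<-trans 0<y₀ y₀<M)) M^a≤y^b ⟩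
    (y ^ b) ^ ↧ₙ q            ≡⟨ ^-swap y b (↧ₙ q) ⟩
    (y ^ ↧ₙ q) ^ b            ≡⟨ ^-assocʳ y (↧ₙ q) b ⟩
    y ^ (↧ₙ q * b)            ∎
    where
    open ℚ.≤-Reasoning
    ^-swap : ∀ z j k → (z ^ j) ^ k ≡ (z ^ k) ^ j
    ^-swap z j k = trans (^-assocʳ z j k) (trans (cong (z ^_) (*-comm j k)) (sym (^-assocʳ z k j)))

-- By the definition of `·`, this says that d(1+1/s)^s lies in the cut of `d · e`. Strictness comes
-- from one further term of the series.
euler-cut : ∀ d .{{_ : NonZero d}} → let s = suc d in
            cut e ((+ 1 ℚ./ d) ℚ.* (+ (d * suc s ↑ s) ℚ./ (s ↑ s)) {{m^n≢0 s s}})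
euler-cut d = suc s , ℚ.≤-<-trans (begin
  (+ 1 ℚ./ d) ℚ.* (+ U ℚ./ D)          ≡⟨ /-* (+ 1) d (+ U) D ⟩
  (+ 1 ℤ.* + U) ℚ./ (d * D)            ≤⟨ /-mono-≤ (+ 1 ℤ.* + U) (d * D) (+ arrangements s) (s !) cross ⟩
  + arrangements s ℚ./ (s !)           ≡⟨ ∑1/j!≡ s ⟨
  ∑1/j! s                              ∎) (∑-step s)
  where
  open ℚ.≤-Reasoning
  s = suc d
  D = s ↑ s
  U = d * suc s ↑ s
  instance
    D≢0 = m^n≢0 s s
    dD≢0 = m*n≢0 d D
    s!≢0 = s !≢0
  cross : + 1 ℤ.* + U ℤ.* + (s !) ℤ.≤ + arrangements s ℤ.* + (d * D)
  cross = subst₂ ℤ._≤_ (trans (ℤ.pos-* U (s !)) (cong (ℤ._* + (s !)) (sym (ℤ.*-identityˡ (+ U)))))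
    (ℤ.pos-* (arrangements s) (d * D)) (ℤ.+≤+ (≤-trans (≤-reflexive (*-assoc d (suc s ↑ s) (s !)))
      (≤-trans (*-monoʳ-≤ d (euler-lower s)) (≤-reflexive (eq d D (arrangements s))))))
    where
    eq : ∀ d D h → d * (D * h) ≡ h * (d * D)
    eq = solve-∀

-- The list of all matroids

support : ∀ {n} → List (Fin n) → Subset n
support []       = ⊥
support (x ∷ xs) = ⁅ x ⁆ ∪ support xs

∈-support⁺ : ∀ {n} {x : Fin n} {xs} → x ∈ xs → x ∈ˢ support xs
∈-support⁺ {x = x} (here refl) = Subset.x∈p∪q⁺ (inj₁ (Subset.x∈⁅x⁆ x))
∈-support⁺         (there x∈)  = Subset.x∈p∪q⁺ (inj₂ (∈-support⁺ x∈))

∈-support⁻ : ∀ {n} {x : Fin n} xs → x ∈ˢ support xs → x ∈ xs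
∈-support⁻ []       x∈ = contradiction x∈ Subset.∉⊥
∈-support⁻ (y ∷ ys) x∈ with Subset.x∈p∪q⁻ ⁅ y ⁆ (support ys) x∈
... | inj₁ x∈y  = here (Subset.x∈⁅y⁆⇒x≡y y x∈y)
... | inj₂ x∈ys = there (∈-support⁻ ys x∈ys)

support-cong : ∀ {n} {xs ys : List (Fin n)} → xs ⊆ ys → ys ⊆ xs → support xs ≡ support ys
support-cong {xs = xs} {ys} xs⊆ys ys⊆xs = Subset.⊆-antisym
  (λ x∈ → ∈-support⁺ (xs⊆ys (∈-support⁻ xs x∈))) (λ x∈ → ∈-support⁺ (ys⊆xs (∈-support⁻ ys x∈)))

∣p∪q∣≤∣p∣+∣q∣ : ∀ {n} (p q : Subset n) → ∣ p ∪ q ∣ ≤ ∣ p ∣ + ∣ q ∣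
∣p∪q∣≤∣p∣+∣q∣ []            []            = z≤n
∣p∪q∣≤∣p∣+∣q∣ (outside ∷ p) (outside ∷ q) = ∣p∪q∣≤∣p∣+∣q∣ p q
∣p∪q∣≤∣p∣+∣q∣ (outside ∷ p) (inside ∷ q)  = ≤-trans (s≤s (∣p∪q∣≤∣p∣+∣q∣ p q)) (≤-reflexive (sym (+-suc ∣ p ∣ ∣ q ∣)))
∣p∪q∣≤∣p∣+∣q∣ (inside ∷ p)  (outside ∷ q) = s≤s (∣p∪q∣≤∣p∣+∣q∣ p q)
∣p∪q∣≤∣p∣+∣q∣ (inside ∷ p)  (inside ∷ q)  = s≤s (≤-trans (∣p∪q∣≤∣p∣+∣q∣ p q) (+-monoʳ-≤ ∣ p ∣ (n≤1+n ∣ q ∣)))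

∣support∣≤length : ∀ {n} (xs : List (Fin n)) → ∣ support xs ∣ ≤ length xs
∣support∣≤length {n} []   = ≤-reflexive (Subset.∣⊥∣≡0 n)
∣support∣≤length (x ∷ xs) = ≤-trans (∣p∪q∣≤∣p∣+∣q∣ ⁅ x ⁆ (support xs))
  (+-mono-≤ (≤-reflexive (Subset.∣⁅x⁆∣≡1 x)) (∣support∣≤length xs))

∣support∣-repeat : ∀ {n} {x : Fin n} {xs} → x ∈ xs → ∣ support (x ∷ xs) ∣ ≤ length xs
∣support∣-repeat {xs = xs} x∈ = ≤-trans
  (≤-reflexive (cong ∣_∣ (support-cong {ys = xs} (λ { (here refl) → x∈ ; (there y∈) → y∈ }) there))) (∣support∣≤length xs)

elements : ∀ {n} → Subset n → List (Fin n)
elements []            = []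
elements (outside ∷ A) = map suc (elements A)
elements (inside ∷ A)  = zero ∷ map suc (elements A)

length-elements : ∀ {n} (A : Subset n) → length (elements A) ≡ ∣ A ∣
length-elements []            = refl
length-elements (outside ∷ A) = trans (length-map suc (elements A)) (length-elements A)
length-elements (inside ∷ A)  = cong suc (trans (length-map suc (elements A)) (length-elements A))

∈-elements⁺ : ∀ {n} {A : Subset n} {x} → x ∈ˢ A → x ∈ elements A
∈-elements⁺ {A = inside ∷ A}  here       = here refl
∈-elements⁺ {A = outside ∷ A} (there x∈) = ∈-map⁺ suc (∈-elements⁺ x∈)
∈-elements⁺ {A = inside ∷ A}  (there x∈) = there (∈-map⁺ suc (∈-elements⁺ x∈))

∈-elements⁻ : ∀ {n} {A : Subset n} {x} → x ∈ elements A → x ∈ˢ A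
∈-elements⁻ {A = outside ∷ A} x∈ with _ , y∈ , refl ← ∈-map⁻ suc x∈ = there (∈-elements⁻ y∈)
∈-elements⁻ {A = inside ∷ A} (here refl) = here
∈-elements⁻ {A = inside ∷ A} (there x∈) with _ , y∈ , refl ← ∈-map⁻ suc x∈ = there (∈-elements⁻ y∈)

support-elements : ∀ {n} (A : Subset n) → support (elements A) ≡ A
support-elements A = Subset.⊆-antisym (λ x∈ → ∈-elements⁻ (∈-support⁻ (elements A) x∈)) (λ x∈ → ∈-support⁺ (∈-elements⁺ x∈))

module _ {n} (r : ℕ) (𝓑 : List (Subset n)) where
  open DecMembership (Vec.≡-dec {n = n} _≟ᵇ_) using (_∈?_)

  -- For a matroid of rank `r` the length condition excludes repetitions: they would leave a support
  -- of fewer than `r` elements.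
  listsBasis? : (xs : List (Fin n)) → Dec (length xs ≡ r × support xs ∈ 𝓑)
  listsBasis? xs = (length xs ≟ r) ×-dec (support xs ∈? 𝓑)

  listsBasis : List (Fin n) → Bool
  listsBasis xs = does (listsBasis? xs)

matroid-bases : ∀ {n r} {𝓑 : List (Subset n)} → IsMatroid 𝓑 → HasRank r 𝓑 → Bases r (listsBasis r 𝓑)
matroid-bases {n} {r} {𝓑} M rank = record
  { perm     = λ xs↭ys → ≡true-ext (transport xs↭ys) (transport (↭-sym xs↭ys))
  ; rank     = λ {xs} eq → proj₁ (does⁻ (listsBasis? r 𝓑 xs) eq)
  ; repeat   = λ {x} {xs} → no-repeat {x} {x ∷ xs} (here refl)
  ; exchange = λ {x} {xs} {ys} → exch x xs ys
  }
  where
  transport : ∀ {xs ys} → xs ↭ ys → listsBasis r 𝓑 xs ≡ true → listsBasis r 𝓑 ys ≡ true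
  transport {xs} {ys} xs↭ys eq with l , ∈𝓑 ← does⁻ (listsBasis? r 𝓑 xs) eq =
    does⁺ (listsBasis? r 𝓑 ys) (trans (sym (↭-length xs↭ys)) l ,
      subst (_∈ 𝓑) (support-cong {xs = xs} (∈-resp-↭ xs↭ys) (∈-resp-↭ (↭-sym xs↭ys))) ∈𝓑)
  no-repeat : ∀ {x xs} → x ∈ xs → listsBasis r 𝓑 (x ∷ xs) ≢ true
  no-repeat {x} {xs} x∈ eq with l , ∈𝓑 ← does⁻ (listsBasis? r 𝓑 (x ∷ xs)) eq =
    <-irrefl (trans (rank ∈𝓑) (sym l)) (s≤s (∣support∣-repeat {xs = xs} x∈))
  exch : ∀ x xs ys → listsBasis r 𝓑 (x ∷ xs) ≡ true → listsBasis r 𝓑 ys ≡ true →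
         Any (λ y → listsBasis r 𝓑 (y ∷ xs) ≡ true) ys
  exch x xs ys eq eq′ with DecMembership._∈?_ Fin._≟_ x ys
  ... | yes x∈ys = Any.map (λ { refl → eq }) x∈ys
  ... | no  x∉ys
    with l , A∈ ← does⁻ (listsBasis? r 𝓑 (x ∷ xs)) eq
    with _ , B∈ ← does⁻ (listsBasis? r 𝓑 ys) eq′
    with y , y∈ , _ , A′∈ ← IsMatroid.exchange M A∈ B∈ (∈-support⁺ {xs = x ∷ xs} (here refl)) (x∉ys ∘ ∈-support⁻ ys) =
    Any.map (λ { refl → does⁺ (listsBasis? r 𝓑 (y ∷ xs)) (l , subst (_∈ 𝓑) swapped A′∈) }) (∈-support⁻ ys y∈)
    where
    A = support (x ∷ xs)
    x∉A-x : x ∉ˢ A - x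
    -- If `x` were still present, removing it again would decrease the size, but a second removal
    -- changes nothing.
    x∉A-x x∈ = <-irrefl (cong ∣_∣ (Subset.p─q─q≡p─q A ⁅ x ⁆)) (Subset.x∈p⇒∣p-x∣<∣p∣ x∈)
    A-x≡ : A - x ≡ support xs
    A-x≡ = Subset.⊆-antisym
      (λ z∈ → case z∈ (∈-support⁻ (x ∷ xs) (Subset.p─q⊆p A ⁅ x ⁆ z∈)))
      (λ z∈ → Subset.x∈p∧x≢y⇒x∈p-y (∈-support⁺ (there (∈-support⁻ xs z∈)))
        λ { refl → no-repeat (∈-support⁻ xs z∈) eq })
      where
      case : ∀ {z} → z ∈ˢ A - x → z ∈ x ∷ xs → z ∈ˢ support xs
      case z∈ (here refl)  = contradiction z∈ x∉A-x
      case z∈ (there z∈xs) = ∈-support⁺ z∈xs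
    swapped : ∀ {y} → (A - x) ∪ ⁅ y ⁆ ≡ support (y ∷ xs)
    swapped {y} = trans (cong (_∪ ⁅ y ⁆) A-x≡) (Subset.∪-comm (support xs) ⁅ y ⁆)

listsBasis-injective : ∀ {n r} {𝓐 𝓑 : List (Subset n)} → HasRank r 𝓐 → listsBasis r 𝓐 ≗ listsBasis r 𝓑 → 𝓐 ⊆ 𝓑
listsBasis-injective {r = r} {𝓐} {𝓑} rank eq {A} A∈ = subst (_∈ 𝓑) (support-elements A)
  (proj₂ (does⁻ (listsBasis? r 𝓑 (elements A)) (trans (sym (eq (elements A)))
    (does⁺ (listsBasis? r 𝓐 (elements A))
      (trans (length-elements A) (rank A∈) , subst (_∈ 𝓐) (sym (support-elements A)) A∈)))))

subsets-unique : ∀ n → Unique (subsets n)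
subsets-unique zero    = [] ∷ []
subsets-unique (suc n) = Unique.++⁺
  (Unique.map⁺ (λ { refl → refl }) (subsets-unique n)) (Unique.map⁺ (λ { refl → refl }) (subsets-unique n)) disjoint
  where
  disjoint : ∀ {A} → ¬ (A ∈ map (outside ∷_) (subsets n) × A ∈ map (inside ∷_) (subsets n))
  disjoint (∈₁ , ∈₂) with _ , _ , refl ← ∈-map⁻ _ ∈₁ with _ , _ , () ← ∈-map⁻ _ ∈₂

∈-sublists⇒⊆ : ∀ {A : Set} {xs ys : List A} → ys ∈ sublists xs → ys ⊆ xs
∈-sublists⇒⊆ {xs = []} (here refl) ()
∈-sublists⇒⊆ {xs = x ∷ xs} ys∈ y∈ with ∈-++⁻ (sublists xs) ys∈
... | inj₁ ys∈ = there (∈-sublists⇒⊆ ys∈ y∈)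
... | inj₂ ys∈ with zs , zs∈ , refl ← ∈-map⁻ (x ∷_) ys∈ with y∈
...   | here refl = here refl
...   | there y∈zs = there (∈-sublists⇒⊆ zs∈ y∈zs)

-- `m` counts lists, whereas a `Collection` needs families that differ as sets.
sublists-distinct : ∀ {A : Set} {xs : List A} → Unique xs →
                    AllPairs (λ ys zs → ¬ (ys ⊆ zs × zs ⊆ ys)) (sublists xs)
sublists-distinct []                        = [] ∷ []
sublists-distinct {xs = x ∷ xs} (x∉ ∷ xs!) = AllPairs.++⁺ (sublists-distinct xs!)
  (AllPairs-map⁺ x∉sublists (sublists-distinct xs!) λ x∉ys x∉zs ys≢zs (⊆₁ , ⊆₂) →
    ys≢zs (drop-head x∉ys ⊆₁ , drop-head x∉zs ⊆₂))
  (All.map (λ x∉ys → All.map⁺ (All.tabulate λ _ (_ , ⊆ys) → x∉ys (⊆ys (here refl)))) x∉sublists)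
  where
  x∉sublists : All (x ∉_) (sublists xs)
  x∉sublists = All.tabulate λ ys∈ x∈ → All.lookup x∉ (∈-sublists⇒⊆ ys∈ x∈) refl
  drop-head : ∀ {ys zs} → x ∉ ys → (x ∷ ys) ⊆ (x ∷ zs) → ys ⊆ zs
  drop-head x∉ys sub y∈ with sub (there y∈)
  ... | here refl  = contradiction y∈ x∉ys
  ... | there y∈zs = y∈zs

matroid-collection : ∀ n r → ∃ λ F → Collection {n} r F × length F ≡ m n r
matroid-collection n r = map (listsBasis r) 𝓜 ,
  (All.map⁺ (All.map (λ (M , rank) → matroid-bases M rank) isMatroid) ,
   AllPairs-map⁺ isMatroid (AllPairs.filter⁺ matroid? (sublists-distinct (subsets-unique n)))
     λ {𝓐} {𝓑} (_ , rank) (_ , rank′) ≢ eq →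
       ≢ (listsBasis-injective {𝓑 = 𝓑} rank eq , listsBasis-injective {𝓑 = 𝓐} rank′ (sym ∘ eq))) ,
  length-map (listsBasis r) 𝓜
  where
  matroid? = λ (𝓑 : List (Subset n)) → isMatroid? 𝓑 ×-dec hasRank? r 𝓑
  𝓜 = filter matroid? (sublists (subsets n))
  isMatroid : All (λ 𝓑 → IsMatroid 𝓑 × HasRank r 𝓑) 𝓜
  isMatroid = All.all-filter matroid? (sublists (subsets n))

theorem1p5 : (n r : ℕ) → r ≥ 3 → (n≥r+12 : n ≥ r + 12) →
    log₂ (fromℕ (m n r)) (fromℕ-positive (m-positive (≤-trans (m≤m+n r 12) n≥r+12)))
    ≤ℝ ((n C r) · log₂ (suc (n ∸ r) · e) (·-positive (suc (n ∸ r)) {e} e-positive)) ÷ suc (n ∸ r)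
theorem1p5 n r r≥3 n≥r+12 =
  log₂-≤ (m n r) (fromℕ-positive (m-positive (≤-trans (m≤m+n r 12) n≥r+12))) (d · e) (·-positive d {e} e-positive) (n C r) d a b ratio y (ℚ.positive⁻¹ y {{ℚ.normalize-pos U D}}) (euler-cut d) M^a≤y^b
  where
  d = suc (n ∸ r)
  s = suc d
  D = s ↑ s
  U = d * suc s ↑ s
  r≤n : r ≤ n
  r≤n = ≤-trans (m≤m+n r 12) n≥r+12
  -- This gives s ≥ 14 and N = s+1 ≥ 15, as `sharp-bound` requires.
  13≤d : 13 ≤ d
  13≤d = s≤s (≤-trans (≤-reflexive (sym (m+n∸m≡n r 12))) (∸-monoˡ-≤ r n≥r+12))
  n≡ : (r ∸ 3) + suc s ≡ n
  n≡ = trans (sym (+-assoc (r ∸ 3) 3 (n ∸ r))) (trans (cong (_+ (n ∸ r)) (m∸n+n≡m r≥3)) (m+[n∸m]≡n r≤n))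
  open CountBound (subst₂ (CountBound U D d) n≡ (m∸n+n≡m r≥3) (count d (r ∸ 3) 13≤d))
  instance
    a-nonZero : NonZero a
    a-nonZero = a≢0
    nCr≢0 : NonZero (n C r)
    nCr≢0 = >-nonZero (nCk>0 r≤n)
    b≢0 : NonZero b
    b≢0 = ≢-nonZero λ b≡0 → ≢-nonZero⁻¹ (a * (n C r)) {{m*n≢0 a (n C r)}} (trans (sym ratio) (cong (_* d) b≡0))
    D≢0 : NonZero D
    D≢0 = m^n≢0 s s
    U≢0 : NonZero U
    U≢0 = m*n≢0 d (suc s ↑ s) {{_}} {{m^n≢0 (suc s) s}}
    1ᵃ≢0 : NonZero (1 ↑ a)
    1ᵃ≢0 = m^n≢0 1 a
    Dᵇ≢0 : NonZero (D ↑ b)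
    Dᵇ≢0 = m^n≢0 D b
  y = + U ℚ./ D
  M^a≤y^b : ℕ⇒ℚ (m n r) ^ a ℚ.≤ y ^ b
  M^a≤y^b = subst₂ ℚ._≤_ (sym (/-^ (m n r) 1 a)) (sym (/-^ U D b))
    (/-mono-≤ (+ (m n r ↑ a)) (1 ↑ a) (+ (U ↑ b)) (D ↑ b)
      (subst₂ ℤ._≤_ (ℤ.pos-* (m n r ↑ a) (D ↑ b)) (ℤ.pos-* (U ↑ b) (1 ↑ a))
        (ℤ.+≤+ (≤-trans m-bound (≤-reflexive (sym (trans (cong (U ↑ b *_) (^-zeroˡ a)) (*-identityʳ (U ↑ b)))))))))
    where
    m-bound : m n r ↑ a * D ↑ b ≤ U ↑ b
    m-bound with F , cF , eq ← matroid-collection n r = subst (λ k → k ↑ a * D ↑ b ≤ U ↑ b) eq (bound cF)
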